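{- Let $q=p^e\ge3$ be a prime power and let $\mathbb U^\flat_{S,\mathcal D}$ be an $\mathrm{SL}(2,q)$-$\flat$-unital. Then every automorphism of $\mathbb U^\flat_{S,\mathcal D}$ fixes the block $[\infty]$.
   Context: Affine $\mathrm{SL}(2,q)$-unital: let $S\le\mathrm{SL}(2,q)$ be a subgroup of order $q+1$, let $\mathfrak P$ be the set of Sylow $p$-subgroups of $\mathrm{SL}(2,q)$, and let $\mathcal D$ be a collection of subsets of $\mathrm{SL}(2,q)$, each containing the identity $\mathbb 1$ and of size $q+1$, such that (Q) for each $D\in\mathcal D$ the set $D^*=\{xy^{ -1}\mid x,y\in D,\ x\ne y\}$ has $q(q+1)$ elements, and (P) the sets $S\smallsetminus\{\mathbb 1\}$, $T\smallsetminus\{\mathbb 1\}$ ($T\in\mathfrak P$) and $D^*$ ($D\in\mathcal D$) partition $\mathrm{SL}(2,q)\smallsetminus\{\mathbb 1\}$. $\mathbb U_{S,\mathcal D}$ has point set $\mathrm{SL}(2,q)$, blocks $Sg$, $Tg$ ($T\in\mathfrak P$), $Dg$ ($D\in\mathcal D$), $g\in\mathrm{SL}(2,q)$, incidence containment. The parallelism $\flat$ partitions the short blocks $Tg$ into the $q+1$ classes $\{Tg\mid g\in\mathrm{SL}(2,q)\}$, $T\in\mathfrak P$ (the right cosets of a fixed Sylow $p$-subgroup). The $\mathrm{SL}(2,q)$-$\flat$-unital $\mathbb U^\flat_{S,\mathcal D}$ is the unital (a $2$-$(q^3+1,q+1,1)$ design) obtained by adding for each class of $\flat$ a new point incident with all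 blocks of that class, and a new block $[\infty]$ consisting of these $q+1$ new points. -}

module Defs where

open import Level using (Level; Lift) renaming (suc to lsuc; zero to lzero)
open import Data.Nat using (ℕ; suc; _^_) renaming (_*_ to _*ℕ_)
open import Data.Nat.Divisibility using (_∣_)
open import Data.Fin using (Fin)
open import Data.Product using (Σ; ∃; ∃-syntax; _×_; _,_; proj₁)
open import Data.Sum using (_⊎_; inj₁; inj₂)
open import Data.Unit using (⊤; tt)
open import Data.Empty using (⊥)
open import Relation.Nullary using (¬_)
open import Relation.Binary.PropositionalEquality using (_≡_; _≢_)
open import Function.Bundles using (_↔_)
open import Function.Definitions using (Injective)
open import Algebra.Core using (Op₁; Op₂)
open import Algebra.Structures using (IsCommutativeRing)

_⇔ₚ_ : ∀ {a b} → Set a → Set b → Set _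
A ⇔ₚ B = (A → B) × (B → A)

_≐_ : ∀ {a ℓ₁ ℓ₂} {A : Set a} → (A → Set ℓ₁) → (A → Set ℓ₂) → Set _
P ≐ Q = ∀ x → P x ⇔ₚ Q x

HasSize : ∀ {a ℓ} {A : Set a} → (A → Set ℓ) → ℕ → Set _
HasSize {A = A} P n =
  Σ (Fin n → A) λ f → Injective _≡_ _≡_ f × (∀ x → P x ⇔ₚ (∃[ i ] f i ≡ x))

record FiniteField (q : ℕ) : Set₁ where
  field
    Carrier : Set
    _+_ _*_ : Op₂ Carrier
    -_      : Op₁ Carrier
    0# 1#   : Carrier
    isCommutativeRing : IsCommutativeRing _≡_ _+_ _*_ -_ 0# 1#
    0≢1     : 0# ≢ 1#
    inverse : ∀ x → x ≢ 0# → ∃[ y ] (x * y ≡ 1#)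
    enum    : Fin q ↔ Carrier

module SL2 {q : ℕ} (F : FiniteField q) where
  open FiniteField F

  record Mat : Set where
    constructor mat
    field a b c d : Carrier

  _·_ : Mat → Mat → Mat
  mat a b c d · mat a' b' c' d' =
    mat ((a * a') + (b * c')) ((a * b') + (b * d'))
        ((c * a') + (d * c')) ((c * b') + (d * d'))

  det : Mat → Carrier
  det (mat a b c d) = (a * d) + (- (b * c))

  -- inverse of a determinant-one matrix
  inv : Mat → Mat
  inv (mat a b c d) = mat d (- b) (- c) a

  𝟙 : Mat
  𝟙 = mat 1# 0# 0# 1#

  InSL : Mat → Set
  InSL M = det M ≡ 1#

  -- subsets of SL(2,q) are predicates on matrices contained in InSL
  IsSubgroup : (Mat → Set) → Set
  IsSubgroup H = (∀ M → H M → InSL M) × H 𝟙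
               × (∀ x y → H x → H y → H (x · y)) × (∀ x → H x → H (inv x))

  IsSylow : ℕ → (Mat → Set) → Set
  IsSylow p H = IsSubgroup H × ∃[ k ] ∃[ N ]
    (HasSize InSL N × HasSize H (p ^ k) × ¬ ((p ^ suc k) ∣ N))

  Sylow : ℕ → Set₁
  Sylow p = Σ (Mat → Set) (IsSylow p)

  Star : (Mat → Set) → Mat → Set
  Star D g = ∃[ x ] ∃[ y ] (D x × D y × x ≢ y × g ≡ x · inv y)

  Coset : (Mat → Set) → Mat → Mat → Set
  Coset A g M = ∃[ x ] (A x × M ≡ x · g)

  module Unital (p : ℕ) (S : Mat → Set) (m : ℕ) (D : Fin m → Mat → Set) where

    IsDFamily : Set
    IsDFamily = ∀ i → (∀ M → D i M → InSL M) × D i 𝟙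
                    × HasSize (D i) (suc q) × HasSize (Star (D i)) (q *ℕ suc q)

    Part : Set₁
    Part = Lift (lsuc lzero) ⊤ ⊎ Sylow p ⊎ Lift (lsuc lzero) (Fin m)

    InPart : Part → Mat → Set
    InPart (inj₁ _) g = S g × g ≢ 𝟙
    InPart (inj₂ (inj₁ T)) g = proj₁ T g × g ≢ 𝟙
    InPart (inj₂ (inj₂ (Level.lift i))) g = Star (D i) g

    SamePart : Part → Part → Set
    SamePart (inj₁ _) (inj₁ _) = ⊤
    SamePart (inj₂ (inj₁ T)) (inj₂ (inj₁ T')) = proj₁ T ≐ proj₁ T'
    SamePart (inj₂ (inj₂ (Level.lift i))) (inj₂ (inj₂ (Level.lift j))) = i ≡ j
    SamePart _ _ = ⊥

    IsPartition : Set₁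
    IsPartition = ∀ g → InSL g → g ≢ 𝟙 →
      (∃[ π ] InPart π g) × (∀ π π' → InPart π g → InPart π' g → SamePart π π')

    -- points of U♭: elements of SL(2,q), plus one new point per class of ♭;
    -- the class {T g | g} is labelled by the Sylow p-subgroup T.
    Point : Set₁
    Point = Σ Mat InSL ⊎ Sylow p

    _≋_ : Point → Point → Set
    inj₁ (M , _) ≋ inj₁ (M' , _) = M ≡ M'
    inj₂ T ≋ inj₂ T' = proj₁ T ≐ proj₁ T'
    _ ≋ _ = ⊥

    PtSet : Set₂
    PtSet = Point → Set₁

    blockS : Mat → PtSet
    blockS g (inj₁ (M , _)) = Lift _ (Coset S g M)
    blockS g (inj₂ _) = Lift _ ⊥

    blockT : Sylow p → Mat → PtSet
    blockT T g (inj₁ (M , _)) = Lift _ (Coset (proj₁ T) g M)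
    blockT T g (inj₂ T') = Lift _ (proj₁ T ≐ proj₁ T')

    blockD : Fin m → Mat → PtSet
    blockD i g (inj₁ (M , _)) = Lift _ (Coset (D i) g M)
    blockD i g (inj₂ _) = Lift _ ⊥

    block∞ : PtSet
    block∞ (inj₁ _) = Lift _ ⊥
    block∞ (inj₂ _) = Lift _ ⊤

    IsBlock : PtSet → Set₁
    IsBlock B = (∃[ g ] (InSL g × B ≐ blockS g))
              ⊎ (Σ (Sylow p) λ T → ∃[ g ] (InSL g × B ≐ blockT T g))
              ⊎ (∃[ i ] ∃[ g ] (InSL g × B ≐ blockD i g))
              ⊎ (B ≐ block∞)

    image : (Point → Point) → PtSet → PtSet
    image φ B y = ∃[ x ] (B x × φ x ≋ y)

    record Automorphism : Set₂ where
      field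
        φ ψ    : Point → Point
        φ-cong : ∀ x y → x ≋ y → φ x ≋ φ y
        ψ-cong : ∀ x y → x ≋ y → ψ x ≋ ψ y
        φψ     : ∀ x → φ (ψ x) ≋ x
        ψφ     : ∀ x → ψ (φ x) ≋ x
        φ-blocks : ∀ B → IsBlock B → IsBlock (image φ B)
        ψ-blocks : ∀ B → IsBlock B → IsBlock (image ψ B)

{-# OPTIONS --safe #-}
module Submission where

-- Right multiplications fix [∞] pointwise and act regularly on SL(2,q); conversely, an automorphism fixing
-- [∞] pointwise and 𝟙 is trivial, because it respects the right cosets of all vector stabilizers. Hence an
-- automorphism fixing [∞] and 𝟙 is a group automorphism. If α moves [∞] to a block C, the conjugates of
-- the right multiplications under α fix C pointwise and act regularly off C.
--   C = T: some of these conjugates fix [∞] and 𝟙, and move points of [∞]. For q odd such a conjugate also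
-- fixes −𝟙 ∉ T. For q even they are involutions without fixed points on S ∖ {𝟙}; any two of them invert S,
-- so they agree at a point off C and are equal.
--   C = D: conjugating right multiplications by elements of D back leads to the first case, unless D is a
-- group, which contradicts |D*| = q(q + 1).
--   C = S: all automorphisms permute the blocks [∞] and S g. For q odd the conjugate of right multiplication
-- by −𝟙 ∈ S fixes all of them, so it is trivial on SL(2,q) modulo ±𝟙, hence on p-elements. For q even S is
-- abelian and sharply transitive on the Sylow subgroups, so left multiplications by S are automorphisms and
-- commute with all conjugates of right multiplications. Two of the latter that are involutions with different
-- fixed blocks and interchange 𝟙 with the same point of [∞] then have a product fixing 𝟙 and [∞] pointwise, so
-- they coincide.

open import Defs
open import Level using (Level; lift) renaming (zero to lzero)
open import Data.Nat as ℕ using (ℕ; zero; suc; _^_; _≤_; s≤s; z≤n; NonZero)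
import Data.Nat.Properties as ℕ
open import Data.Nat.Divisibility using (_∣_; _∣?_; divides; ∣m+n∣m⇒∣n; ∣1⇒≡1; m∣m*n; *-cancelˡ-∣; ∣m⇒∣m*n; ∣n⇒∣m*n)
open import Data.Nat.Primality using (Prime; prime[2]; prime⇒nonZero; prime⇒nonTrivial; prime⇒irreducible)
open import Data.Nat.Coprimality using (Coprime; prime⇒coprime; coprime-divisor)
open import Data.Fin using (Fin)
import Data.Fin.Properties as Fin
open import Data.Maybe using (Maybe; just; nothing)
open import Data.Product using (Σ; ∃; ∃-syntax; _×_; _,_; proj₁; proj₂)
open import Data.Product.Properties using (≡-dec; ,-injective)
open import Data.Sum using (_⊎_; inj₁; inj₂; [_,_]′)
open import Data.Unit using (⊤; tt)
open import Data.Empty using (⊥; ⊥-elim)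
open import Data.List using (List; []; _∷_; map; length)
open import Data.List.Relation.Unary.Any using (here; there; any?)
open import Data.List.Membership.Propositional using (_∈_; find; lose)
open import Data.List.Membership.Propositional.Properties using (∈-map⁺; ∈-map⁻)
open import Data.List.Membership.Propositional.Properties.WithK using (unique∧set⇒bag)
open import Data.List.Relation.Binary.BagAndSetEquality using (∼bag⇒↭)
open import Data.List.Relation.Binary.Permutation.Propositional as ↭ using (_↭_)
open import Relation.Nullary using (¬_; Dec; yes; no)
open import Relation.Nullary.Decidable using (map′; _×-dec_)
open import Relation.Binary.Definitions using (DecidableEquality)
open import Relation.Binary.PropositionalEquality
open import Function.Base using (_∘_; id)
open import Function.Bundles using (Inverse; mk⇔)
open import Algebra.Bundles using (CommutativeRing; Group)
open import Algebra.Structures using (IsCommutativeRing)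
import Algebra.Solver.Ring as RingSolver
open import Algebra.Solver.Ring.AlmostCommutativeRing using (_-Raw-AlmostCommutative⟶_; fromCommutativeRing)
open import Axiom.UniquenessOfIdentityProofs using (module Decidable⇒UIP)

-- Each case plays two facts against each other. A conjugate of a right multiplication is determined
-- by its value at one point off C, yet it can be prescribed by the images of points of [∞] off C.
-- Condition (P) makes these points concrete: distinct Sylow p-subgroups meet trivially, so a single
-- transvection in T identifies T with the stabilizer of a row vector v. Points of [∞] become
-- directions in the plane, and x, y lie in the same right coset of T exactly when v x = v y;
-- automorphisms that fix [∞] are then handled by linear algebra. The order of the cases matters. D
-- leads back to T, and only when T and D are excluded are [∞] and the blocks S g the only possible
-- images of [∞], so that automorphisms permute them. The parity split comes from involutions: -𝟙 is
-- the only one for q odd, while for q even they are the nontrivial elements of the Sylow subgroups.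
-- The bound q ≥ 3 supplies a scalar besides 0 and 1, hence two different nontrivial conjugates to
-- compare when q is even.

-- Counting with duplicate-free lists, and orbits of semiregular permutations

module FiniteSets where

  open import Data.Nat
  open import Data.Nat.Properties
  open import Data.Nat.Divisibility
  open import Data.Nat.Coprimality using (Coprime; coprime-Bézout)
  open import Data.Nat.GCD using (module Bézout)
  open import Data.List using (List; []; _∷_; _++_; length; filter; applyUpTo; tabulate; lookup; map; cartesianProduct)
  open import Data.List.Properties using (length-++; length-applyUpTo; length-tabulate; length-map)
  open import Data.List.Membership.Propositional using (_∈_; _∉_; find; lose)
  open import Data.List.Membership.Propositional.Properties
  open import Data.List.Relation.Unary.Any using (here; there; index; any?)
  open import Data.List.Relation.Unary.Any.Properties using (lookup-index)
  open import Data.List.Relation.Unary.All as All using (All; []; _∷_)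
  open import Data.List.Relation.Unary.AllPairs using ([]; _∷_)
  open import Data.List.Relation.Unary.Unique.Propositional using (Unique)
  import Data.List.Relation.Unary.Unique.Propositional.Properties as Uniq
  open import Data.List.Relation.Binary.Subset.Propositional using (_⊆_)
  open import Relation.Nullary.Decidable using (¬?; map′)


  private variable
    a : Level
    A : Set a

  unique-⊆⇒length-≤ : {xs ys : List A} → Unique xs → xs ⊆ ys → length xs ≤ length ys
  unique-⊆⇒length-≤ {xs = []} _ _ = z≤n
  unique-⊆⇒length-≤ {xs = x ∷ xs} {ys} (x∉ ∷ u) sub with ∈-∃++ (sub (here refl))
  ... | as , bs , refl = begin
    suc (length xs)                ≤⟨ s≤s (unique-⊆⇒length-≤ u sub′) ⟩
    suc (length (as ++ bs))        ≡⟨ cong suc (length-++ as) ⟩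
    suc (length as + length bs)    ≡⟨ +-suc (length as) (length bs) ⟨
    length as + length (x ∷ bs)    ≡⟨ length-++ as ⟨
    length (as ++ x ∷ bs)          ∎
    where
    open ≤-Reasoning
    sub′ : xs ⊆ as ++ bs
    sub′ {y} y∈ with ∈-++⁻ as (sub (there y∈))
    ... | inj₁ y∈as = ∈-++⁺ˡ y∈as
    ... | inj₂ (here refl) = ⊥-elim (All.lookup x∉ y∈ refl)
    ... | inj₂ (there y∈bs) = ∈-++⁺ʳ as y∈bs

  module _ (f : A → A) where

    iter : ℕ → A → A
    iter zero x = x
    iter (suc n) x = f (iter n x)

    iter-+ : ∀ m n x → iter (m + n) x ≡ iter m (iter n x)
    iter-+ zero n x = refl
    iter-+ (suc m) n x = cong f (iter-+ m n x)

    iter-f : ∀ n x → iter n (f x) ≡ f (iter n x)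
    iter-f zero x = refl
    iter-f (suc n) x = cong f (iter-f n x)

    iter-* : ∀ m {n x} → iter n x ≡ x → iter (m * n) x ≡ x
    iter-* zero eq = refl
    iter-* (suc m) {n} {x} eq = trans (iter-+ n (m * n) x) (trans (cong (iter n) (iter-* m eq)) eq)

    -- Bézout without subtraction: if 1 + l n = k m, then f x = f (iter f (l n) x) = iter f (k m) x
    -- = x, and symmetrically for the other sign.
    iter-coprime : ∀ {m n x} → Coprime m n → iter m x ≡ x → iter n x ≡ x → f x ≡ x
    iter-coprime {m} {n} {x} c eqm eqn with coprime-Bézout c
    ... | Bézout.+- k l eq = trans (cong f (sym (iter-* l eqn))) (trans (cong (λ i → iter i x) eq) (iter-* k eqm))
    ... | Bézout.-+ k l eq = trans (cong f (sym (iter-* k eqm))) (trans (cong (λ i → iter i x) eq) (iter-* l eqn))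

  module Finite {A : Set a} (_≟_ : DecidableEquality A) where

    open import Data.List.Membership.DecPropositional _≟_ using (_∈?_)

    unique-⊆-long⇒⊇ : {xs ys : List A} → Unique xs → xs ⊆ ys → length ys ≤ length xs → ys ⊆ xs
    unique-⊆-long⇒⊇ {xs} {ys} u sub len {y} y∈ with y ∈? xs
    ... | yes y∈xs = y∈xs
    ... | no y∉xs = ⊥-elim (1+n≰n (≤-trans (unique-⊆⇒length-≤ u′ sub′) len))
      where
      u′ : Unique (y ∷ xs)
      u′ = All.tabulate (λ z∈ y≡z → y∉xs (subst (_∈ xs) (sym y≡z) z∈)) ∷ u
      sub′ : y ∷ xs ⊆ ys
      sub′ (here refl) = y∈
      sub′ (there z∈) = sub z∈

    length-split : (zs xs : List A) →
      length xs ≡ length (filter (_∈? zs) xs) + length (filter (¬? ∘ (_∈? zs)) xs)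
    length-split zs [] = refl
    length-split zs (x ∷ xs) with x ∈? zs
    ... | yes _ = cong suc (length-split zs xs)
    ... | no _ = trans (cong suc (length-split zs xs)) (sym (+-suc _ _))

    module _ (f : A → A) where

      record Semiregular (r : ℕ) (xs : List A) : Set a where
        field
          closed : ∀ {x} → x ∈ xs → f x ∈ xs
          period : ∀ {x} → x ∈ xs → iter f r x ≡ x
          free   : ∀ {x i} → x ∈ xs → 0 < i → i < r → iter f i x ≢ x

      -- Orbits of exactly r elements are removed one at a time. The number n in `go` only bounds
      -- the length, so that the recursion is structural.
      semiregular⇒∣length : ∀ r .{{_ : NonZero r}} {xs} → Unique xs → Semiregular r xs → r ∣ length xs
      semiregular⇒∣length r {xs} uniq sr = go (length xs) xs ≤-refl uniq sr
        where
        go : ∀ n xs → length xs ≤ n → Unique xs → Semiregular r xs → r ∣ length xs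
        go _ [] _ _ _ = r ∣0
        go (suc n) xs@(x ∷ xs′) (s≤s len) u sr =
          subst (r ∣_) (sym split) (∣m∣n⇒∣m+n ∣-refl (go n rest shorter (Uniq.filter⁺ (¬? ∘ (_∈? orbit)) u) sr′))
          where
          open Semiregular sr
          orbit = applyUpTo (λ i → iter f i x) r
          rest = filter (¬? ∘ (_∈? orbit)) xs
          x∈ : x ∈ xs
          x∈ = here refl
          iter∈ : ∀ i → iter f i x ∈ xs
          iter∈ zero = x∈
          iter∈ (suc i) = closed (iter∈ i)
          orbit-uniq : Unique orbit
          orbit-uniq = Uniq.applyUpTo⁺₁ _ r λ {i} {j} i<j j<r eq →
            free (iter∈ i) (m<n⇒0<n∸m i<j) (≤-<-trans (m∸n≤m j i) j<r)
              (trans (sym (iter-+ f (j ∸ i) i x)) (trans (cong (λ k → iter f k x) (m∸n+n≡m (<⇒≤ i<j))) (sym eq)))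
          inOrbit = filter (_∈? orbit) xs
          inOrbit⊆ : inOrbit ⊆ orbit
          inOrbit⊆ y∈ = proj₂ (∈-filter⁻ (_∈? orbit) {xs = xs} y∈)
          orbit⊆ : orbit ⊆ inOrbit
          orbit⊆ y∈ with ∈-applyUpTo⁻ (λ i → iter f i x) y∈
          ... | i , i<r , refl = ∈-filter⁺ (_∈? orbit) (iter∈ i) y∈
          length-inOrbit : length inOrbit ≡ r
          length-inOrbit = trans (≤-antisym (unique-⊆⇒length-≤ (Uniq.filter⁺ (_∈? orbit) u) inOrbit⊆)
                                            (unique-⊆⇒length-≤ orbit-uniq orbit⊆))
                                 (length-applyUpTo _ r)
          split : length xs ≡ r + length rest
          split = trans (length-split orbit xs) (cong (_+ length rest) length-inOrbit)
          shorter : length rest ≤ n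
          shorter = ≤-pred (≤-trans (≤-trans (+-monoˡ-≤ (length rest) (>-nonZero⁻¹ r)) (≤-reflexive (sym split))) (s≤s len))
          -- What remains after removing an orbit is closed under f because f is invertible on xs:
          -- the iterate with exponent r - 1 is its inverse.
          orbit-back : ∀ {y} → y ∈ xs → f y ∈ orbit → y ∈ orbit
          orbit-back {y} y∈ fy∈ with ∈-applyUpTo⁻ (λ i → iter f i x) fy∈
          ... | zero , _ , fy≡x = subst (_∈ orbit) (y≡ r refl) (∈-applyUpTo⁺ (λ i → iter f i x) (pred<r r))
            where
            pred<r : ∀ k .{{_ : NonZero k}} → pred k < k
            pred<r (suc k) = ≤-refl
            y≡ : ∀ k → k ≡ r → iter f (pred k) x ≡ y
            y≡ zero eq = ⊥-elim (<⇒≢ (>-nonZero⁻¹ r) eq)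
            y≡ (suc k) eq = trans (cong (iter f k) (sym fy≡x))
              (trans (iter-f f k y) (trans (cong (λ j → iter f j y) eq) (period y∈)))
          ... | suc i , si<r , fy≡ = subst (_∈ orbit) (y≡ r refl) (∈-applyUpTo⁺ (λ i → iter f i x) (<-trans ≤-refl si<r))
            where
            y≡ : ∀ k → k ≡ r → iter f i x ≡ y
            y≡ zero eq = ⊥-elim (<⇒≢ (>-nonZero⁻¹ r) eq)
            y≡ (suc k) eq = trans (sym (inv (iter∈ i))) (trans (cong (iter f k) (sym fy≡)) (inv y∈))
              where
              inv : ∀ {z} → z ∈ xs → iter f k (f z) ≡ z
              inv {z} z∈ = trans (iter-f f k z) (trans (cong (λ j → iter f j z) eq) (period z∈))
          rest⊆ : ∀ {y} → y ∈ rest → y ∈ xs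
          rest⊆ y∈ = proj₁ (∈-filter⁻ (¬? ∘ (_∈? orbit)) {xs = xs} y∈)
          sr′ : Semiregular r rest
          sr′ = record
            { closed = λ y∈ → ∈-filter⁺ (¬? ∘ (_∈? orbit)) (closed (rest⊆ y∈))
                (λ fy∈ → proj₂ (∈-filter⁻ (¬? ∘ (_∈? orbit)) {xs = xs} y∈) (orbit-back (rest⊆ y∈) fy∈))
            ; period = λ y∈ → period (rest⊆ y∈)
            ; free = λ y∈ → free (rest⊆ y∈)
            }

  unique⇒lookup-injective : {xs : List A} → Unique xs → ∀ {i j} → lookup xs i ≡ lookup xs j → i ≡ j
  unique⇒lookup-injective {xs = _ ∷ _} (_ ∷ _) {Fin.zero} {Fin.zero} _ = refl
  unique⇒lookup-injective {xs = _ ∷ _} (n ∷ _) {Fin.zero} {Fin.suc j} eq = ⊥-elim (All.lookup n (∈-lookup j) eq)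
  unique⇒lookup-injective {xs = _ ∷ _} (n ∷ _) {Fin.suc i} {Fin.zero} eq = ⊥-elim (All.lookup n (∈-lookup i) (sym eq))
  unique⇒lookup-injective {xs = _ ∷ _} (_ ∷ u) {Fin.suc i} {Fin.suc j} eq = cong Fin.suc (unique⇒lookup-injective u eq)

  -- The list form of `HasSize`: comparing sizes becomes comparing lengths of duplicate-free lists
  -- under inclusion.
  record Listing {ℓ} {A : Set a} (P : A → Set ℓ) (n : ℕ) : Set (a Level.⊔ ℓ) where
    field
      list   : List A
      unique : Unique list
      size   : length list ≡ n
      sound  : ∀ {x} → x ∈ list → P x
      complete : ∀ {x} → P x → x ∈ list

  fromHasSize : ∀ {ℓ} {P : A → Set ℓ} {n} → HasSize P n → Listing P n
  fromHasSize (f , inj , iff) = record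
    { list = tabulate f
    ; unique = Uniq.tabulate⁺ inj
    ; size = length-tabulate f
    ; sound = λ x∈ → let i , eq = ∈-tabulate⁻ x∈ in proj₂ (iff _) (i , sym eq)
    ; complete = λ Px → let i , eq = proj₁ (iff _) Px in subst (_∈ tabulate f) eq (∈-tabulate⁺ i)
    }

  toHasSize : ∀ {ℓ} {P : A → Set ℓ} {n} → Listing P n → HasSize P n
  toHasSize {A = A} {P = P} L = subst (HasSize P) size
    (lookup list , unique⇒lookup-injective unique ,
     λ x → (λ Px → index (complete Px) , sym (lookup-index (complete Px))) ,
           λ (i , eq) → sound (subst (_∈ list) eq (∈-lookup i)))
    where open Listing L

  Listing-≤ : ∀ {ℓ ℓ′} {P : A → Set ℓ} {Q : A → Set ℓ′} {m n} →
    Listing P m → Listing Q n → (∀ {x} → P x → Q x) → m ≤ n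
  Listing-≤ L K sub = subst₂ _≤_ L.size K.size
    (unique-⊆⇒length-≤ L.unique (λ x∈ → K.complete (sub (L.sound x∈))))
    where
    module L = Listing L
    module K = Listing K

  Listing-size-unique : ∀ {ℓ} {P : A → Set ℓ} {m n} → Listing P m → Listing P n → m ≡ n
  Listing-size-unique L K = ≤-antisym (Listing-≤ L K id) (Listing-≤ K L id)

  module _ {A : Set a} where
    map-unique : ∀ {b} {B : Set b} (f : A → B) {xs} → (∀ {x y} → x ∈ xs → y ∈ xs → f x ≡ f y → x ≡ y) →
      Unique xs → Unique (map f xs)
    map-unique f {[]} inj [] = []
    map-unique f {x ∷ xs} inj (n ∷ u) =
      All.tabulate (λ fy∈ fx≡ → let y , y∈ , eq = ∈-map⁻ f fy∈ in
        All.lookup n y∈ (inj (here refl) (there y∈) (trans fx≡ eq)))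
      ∷ map-unique f (λ x∈ y∈ → inj (there x∈) (there y∈)) u

  private variable
    ℓ ℓ′ : Level
    P Q : A → Set ℓ
    m n : ℕ

  Listing-resp : {P : A → Set ℓ} {Q : A → Set ℓ′} → (∀ x → P x ⇔ₚ Q x) → Listing P n → Listing Q n
  Listing-resp iff L = record
    { list = list ; unique = unique ; size = size
    ; sound = λ x∈ → proj₁ (iff _) (sound x∈) ; complete = λ Qx → complete (proj₂ (iff _) Qx) }
    where open Listing L

  Listing-map : ∀ {b} {B : Set b} {P : A → Set ℓ} (f : A → B) → (∀ {x y} → P x → P y → f x ≡ f y → x ≡ y) →
    Listing P n → Listing (λ y → ∃[ x ] (P x × y ≡ f x)) n
  Listing-map f inj L = record
    { list = map f list
    ; unique = map-unique f (λ x∈ y∈ → inj (sound x∈) (sound y∈)) unique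
    ; size = trans (length-map f list) size
    ; sound = λ y∈ → let x , x∈ , eq = ∈-map⁻ f y∈ in x , sound x∈ , eq
    ; complete = λ { (x , Px , refl) → ∈-map⁺ f (complete Px) }
    }
    where open Listing L

  length-cartesianProduct : ∀ {b} {B : Set b} (xs : List A) (ys : List B) → length (cartesianProduct xs ys) ≡ length xs * length ys
  length-cartesianProduct [] ys = refl
  length-cartesianProduct (x ∷ xs) ys = trans (length-++ (map (x ,_) ys))
    (cong₂ _+_ (length-map (x ,_) ys) (length-cartesianProduct xs ys))

  Listing-× : ∀ {b} {B : Set b} {P : A → Set ℓ} {Q : B → Set ℓ′} →
    Listing P m → Listing Q n → Listing (λ (x , y) → P x × Q y) (m * n)
  Listing-× L K = record
    { list = cartesianProduct L.list K.list
    ; unique = Uniq.cartesianProduct⁺ L.unique K.unique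
    ; size = trans (length-cartesianProduct L.list K.list) (cong₂ _*_ L.size K.size)
    ; sound = λ xy∈ → let x∈ , y∈ = ∈-cartesianProduct⁻ L.list K.list xy∈ in L.sound x∈ , K.sound y∈
    ; complete = λ (Px , Qy) → ∈-cartesianProduct⁺ (L.complete Px) (K.complete Qy)
    }
    where
    module L = Listing L
    module K = Listing K

  Listing-⊎ : {P : A → Set ℓ} {Q : A → Set ℓ′} → (∀ {x} → P x → Q x → ⊥) →
    Listing P m → Listing Q n → Listing (λ x → P x ⊎ Q x) (m + n)
  Listing-⊎ disj L K = record
    { list = L.list ++ K.list
    ; unique = Uniq.++⁺ L.unique K.unique (λ (x∈ , x∈′) → disj (L.sound x∈) (K.sound x∈′))
    ; size = trans (length-++ L.list) (cong₂ _+_ L.size K.size)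
    ; sound = λ x∈ → Data.Sum.map L.sound K.sound (∈-++⁻ L.list x∈)
    ; complete = λ { (inj₁ Px) → ∈-++⁺ˡ (L.complete Px) ; (inj₂ Qx) → ∈-++⁺ʳ L.list (K.complete Qx) }
    }
    where
    module L = Listing L
    module K = Listing K

  module FiniteListing {A : Set a} (_≟_ : DecidableEquality A) where
    open Finite _≟_
    open import Data.List.Membership.DecPropositional _≟_ using (_∈?_)

    Listing-dec : Listing {A = A} P n → ∀ x → Dec (P x)
    Listing-dec L x = map′ sound complete (x ∈? list)
      where open Listing L

    abstract
      Listing-avoid : Listing {A = A} P n → ∀ zs → length zs < n → ∃[ x ] (P x × x ∉ zs)
      Listing-avoid L zs zs<n with any? (λ x → ¬? (x ∈? zs)) list
        where open Listing L
      ... | yes found = let x , x∈ , x∉ = find found in x , Listing.sound L x∈ , x∉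
      ... | no none = ⊥-elim (<⇒≱ zs<n (subst (_≤ length zs) size (unique-⊆⇒length-≤ unique sub)))
        where
        open Listing L
        sub : list ⊆ zs
        sub {x} x∈ with x ∈? zs
        ... | yes x∈zs = x∈zs
        ... | no x∉zs = ⊥-elim (none (lose x∈ x∉zs))

    Listing-remove : ∀ {z} → P z → Listing {A = A} P (suc n) → Listing (λ x → P x × x ≢ z) n
    Listing-remove {n = n} {z = z} Pz L = record
      { list = filter (¬? ∘ (_∈? (z ∷ []))) list
      ; unique = Uniq.filter⁺ (¬? ∘ (_∈? (z ∷ []))) unique
      ; size = suc-injective (begin
          suc (length (filter (¬? ∘ (_∈? (z ∷ []))) list)) ≡⟨ cong (_+ length (filter (¬? ∘ (_∈? (z ∷ []))) list)) one ⟨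
          length (filter (_∈? (z ∷ [])) list) + length (filter (¬? ∘ (_∈? (z ∷ []))) list) ≡⟨ length-split (z ∷ []) list ⟨
          length list ≡⟨ size ⟩
          suc n ∎)
      ; sound = λ x∈ → let x∈′ , x∉ = ∈-filter⁻ (¬? ∘ (_∈? (z ∷ []))) {xs = list} x∈ in sound x∈′ , x∉ ∘ here
      ; complete = λ (Px , x≢z) → ∈-filter⁺ (¬? ∘ (_∈? (z ∷ []))) (complete Px) (λ { (here eq) → x≢z eq })
      }
      where
      open Listing L
      open ≡-Reasoning
      one : length (filter (_∈? (z ∷ [])) list) ≡ 1
      one = ≤-antisym
        (unique-⊆⇒length-≤ (Uniq.filter⁺ (_∈? (z ∷ [])) unique) (λ x∈ → proj₂ (∈-filter⁻ (_∈? (z ∷ [])) {xs = list} x∈)))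
        (unique-⊆⇒length-≤ {xs = z ∷ []} ([] ∷ []) λ { (here refl) → ∈-filter⁺ (_∈? (z ∷ [])) (complete Pz) (here refl) })

    Listing-⊆-long⇒⊇ : Listing {A = A} P m → Listing {A = A} Q n → (∀ {x} → P x → Q x) → n ≤ m → ∀ {x} → Q x → P x
    Listing-⊆-long⇒⊇ L K sub n≤m Qx = L.sound
      (unique-⊆-long⇒⊇ L.unique (λ x∈ → K.complete (sub (L.sound x∈))) (subst₂ _≤_ (sym K.size) (sym L.size) n≤m) (K.complete Qx))
      where
      module L = Listing L
      module K = Listing K

    module _ (f : A → A) where

      least-period : ∀ x n →
        (∃[ r ] (0 < r × r ≤ n × iter f r x ≡ x × (∀ i → 0 < i → i < r → iter f i x ≢ x)))
        ⊎ (∀ i → 0 < i → i ≤ n → iter f i x ≢ x)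
      least-period x zero = inj₂ λ i 0<i i≤0 → ⊥-elim (<⇒≱ 0<i i≤0)
      least-period x (suc n) with least-period x n
      ... | inj₁ (r , 0<r , r≤n , rest) = inj₁ (r , 0<r , m≤n⇒m≤1+n r≤n , rest)
      ... | inj₂ none with iter f (suc n) x ≟ x
      ...   | yes eq = inj₁ (suc n , z<s , ≤-refl , eq , λ i 0<i i<r → none i 0<i (≤-pred i<r))
      ...   | no ne = inj₂ λ i 0<i i≤1+n eq → [ (λ i<1+n → none i 0<i (≤-pred i<1+n) eq) , (λ { refl → ne eq }) ]′ (m≤n⇒m<n∨m≡n i≤1+n)

      -- All cycles of f have the same length as soon as f^i has either no fixed point or only fixed points.
      abstract
        semiregular-period : Listing P n → (∀ {x} → P x → P (f x)) → (∀ {x y} → P x → P y → f x ≡ f y → x ≡ y) →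
          (∀ i {x y} → P x → P y → iter f i x ≡ x → iter f i y ≡ y) → ∃ P →
          ∃[ r ] (0 < r × r ∣ n × (∀ {x} → P x → iter f r x ≡ x) × (∀ {x} i → P x → 0 < i → i < r → iter f i x ≢ x))
        semiregular-period {P = P} {n = n} L closed inj uniform (x , Px) with least-period x n
        ... | inj₁ (r , 0<r , r≤n , eq , least) = r , 0<r , r∣n , (λ Py → uniform r Px Py eq) , free
          where
          open Listing L
          free : ∀ {y} i → P y → 0 < i → i < r → iter f i y ≢ y
          free i Py 0<i i<r eq′ = least i 0<i i<r (uniform i Py Px eq′)
          r∣n : r ∣ n
          r∣n = subst (r ∣_) size (semiregular⇒∣length f r {{>-nonZero 0<r}} unique record
            { closed = λ y∈ → complete (closed (sound y∈))
            ; period = λ y∈ → uniform r Px (sound y∈) eq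
            ; free = λ y∈ → free _ (sound y∈) })
        ... | inj₂ none = ⊥-elim (1+n≰n (subst₂ _≤_ (length-applyUpTo (λ i → iter f i x) (suc n)) size (unique-⊆⇒length-≤ uniq sub)))
          where
          open Listing L
          P-iter : ∀ i → P (iter f i x)
          P-iter zero = Px
          P-iter (suc i) = closed (P-iter i)
          cancel : ∀ i k → iter f (i + k) x ≡ iter f i x → iter f k x ≡ x
          cancel zero k eq = eq
          cancel (suc i) k eq = cancel i k (inj (P-iter (i + k)) (P-iter i) eq)
          uniq : Unique (applyUpTo (λ i → iter f i x) (suc n))
          uniq = Uniq.applyUpTo⁺₁ _ (suc n) λ {i} {j} i<j j<1+n eq → none (j ∸ i) (m<n⇒0<n∸m i<j) (≤-trans (m∸n≤m j i) (≤-pred j<1+n))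
            (cancel i (j ∸ i) (trans (cong (λ k → iter f k x) (m+[n∸m]≡n (<⇒≤ i<j))) (sym eq)))
          sub : applyUpTo (λ i → iter f i x) (suc n) ⊆ list
          sub y∈ with ∈-applyUpTo⁻ (λ i → iter f i x) y∈
          ... | i , _ , refl = complete (P-iter i)

open FiniteSets

-- Polynomial identities over a commutative ring, with integer coefficients

module IntegerSolver {c} {A : Set c} {add mul : A → A → A} {neg : A → A} {z o : A}
  (isCR : IsCommutativeRing _≡_ add mul neg z o) where

  open import Data.Integer as ℤ using (ℤ; +_; -[1+_])
  import Data.Integer.Properties as ℤ

  R : CommutativeRing c c
  R = record { isCommutativeRing = isCR }

  open CommutativeRing R using (_+_; _*_; -_; 0#; 1#; ring; semiring; -‿inverseʳ; +-assoc; +-comm; +-identityˡ; +-identityʳ; +-abelianGroup)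
  open import Algebra.Properties.Ring ring using (-‿distribˡ-*; -‿distribʳ-*; -0#≈0#; -‿involutive)
  open import Algebra.Properties.AbelianGroup +-abelianGroup using (⁻¹-∙-comm)
  open import Algebra.Properties.Semiring.Mult semiring using (×-homo-+; ×1-homo-*) renaming (_×_ to _⋆_)

  ⟦_⟧ℤ : ℤ → A
  ⟦ + n ⟧ℤ = n ⋆ 1#
  ⟦ -[1+ n ] ⟧ℤ = - (suc n ⋆ 1#)

  ⟦⊖⟧ : ∀ m n → ⟦ m ℤ.⊖ n ⟧ℤ ≡ m ⋆ 1# + - (n ⋆ 1#)
  ⟦⊖⟧ m zero = sym (trans (cong (λ t → m ⋆ 1# + t) -0#≈0#) (+-identityʳ _))
  ⟦⊖⟧ zero (suc n) = sym (+-identityˡ _)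
  ⟦⊖⟧ (suc m) (suc n) = begin
    ⟦ suc m ℤ.⊖ suc n ⟧ℤ                        ≡⟨ cong ⟦_⟧ℤ (ℤ.[1+m]⊖[1+n]≡m⊖n m n) ⟩
    ⟦ m ℤ.⊖ n ⟧ℤ                                ≡⟨ ⟦⊖⟧ m n ⟩
    m ⋆ 1# + - (n ⋆ 1#)                         ≡⟨ cong (_+ - (n ⋆ 1#)) (+-identityʳ _) ⟨
    (m ⋆ 1# + 0#) + - (n ⋆ 1#)                  ≡⟨ cong (λ t → (m ⋆ 1# + t) + - (n ⋆ 1#)) (-‿inverseʳ 1#) ⟨
    (m ⋆ 1# + (1# + - 1#)) + - (n ⋆ 1#)         ≡⟨ cong (_+ - (n ⋆ 1#)) (+-assoc _ _ _) ⟨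
    ((m ⋆ 1# + 1#) + - 1#) + - (n ⋆ 1#)         ≡⟨ +-assoc _ _ _ ⟩
    (m ⋆ 1# + 1#) + (- 1# + - (n ⋆ 1#))         ≡⟨ cong₂ _+_ (+-comm _ _) (⁻¹-∙-comm _ _) ⟩
    suc m ⋆ 1# + - (suc n ⋆ 1#)                 ∎
    where open ≡-Reasoning

  ⟦⟧-+ : ∀ i j → ⟦ i ℤ.+ j ⟧ℤ ≡ ⟦ i ⟧ℤ + ⟦ j ⟧ℤ
  ⟦⟧-+ (+ m) (+ n) = ×-homo-+ 1# m n
  ⟦⟧-+ (+ m) -[1+ n ] = ⟦⊖⟧ m (suc n)
  ⟦⟧-+ -[1+ m ] (+ n) = trans (⟦⊖⟧ n (suc m)) (+-comm _ _)
  ⟦⟧-+ -[1+ m ] -[1+ n ] = trans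
    (cong -_ (trans (cong (_⋆ 1#) (cong suc (sym (ℕ.+-suc m n)))) (×-homo-+ 1# (suc m) (suc n))))
    (sym (⁻¹-∙-comm _ _))

  ⟦⟧-neg : ∀ i → ⟦ ℤ.- i ⟧ℤ ≡ - ⟦ i ⟧ℤ
  ⟦⟧-neg (+ zero) = sym -0#≈0#
  ⟦⟧-neg (+ suc n) = refl
  ⟦⟧-neg -[1+ n ] = sym (-‿involutive _)

  ⟦⟧-*⁺ : ∀ m j → ⟦ + m ℤ.* j ⟧ℤ ≡ m ⋆ 1# * ⟦ j ⟧ℤ
  ⟦⟧-*⁺ m (+ n) = trans (cong ⟦_⟧ℤ (sym (ℤ.pos-* m n))) (×1-homo-* m n)
  ⟦⟧-*⁺ m -[1+ n ] = begin
    ⟦ + m ℤ.* -[1+ n ] ⟧ℤ         ≡⟨ cong ⟦_⟧ℤ (ℤ.neg-distribʳ-* (+ m) (+ suc n)) ⟨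
    ⟦ ℤ.- (+ m ℤ.* + suc n) ⟧ℤ    ≡⟨ ⟦⟧-neg (+ m ℤ.* + suc n) ⟩
    - ⟦ + m ℤ.* + suc n ⟧ℤ        ≡⟨ cong -_ (⟦⟧-*⁺ m (+ suc n)) ⟩
    - (m ⋆ 1# * suc n ⋆ 1#)       ≡⟨ -‿distribʳ-* _ _ ⟩
    m ⋆ 1# * - (suc n ⋆ 1#)       ∎
    where open ≡-Reasoning

  ⟦⟧-* : ∀ i j → ⟦ i ℤ.* j ⟧ℤ ≡ ⟦ i ⟧ℤ * ⟦ j ⟧ℤ
  ⟦⟧-* (+ m) j = ⟦⟧-*⁺ m j
  ⟦⟧-* -[1+ m ] j = begin
    ⟦ -[1+ m ] ℤ.* j ⟧ℤ           ≡⟨ cong ⟦_⟧ℤ (ℤ.neg-distribˡ-* (+ suc m) j) ⟨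
    ⟦ ℤ.- (+ suc m ℤ.* j) ⟧ℤ      ≡⟨ ⟦⟧-neg (+ suc m ℤ.* j) ⟩
    - ⟦ + suc m ℤ.* j ⟧ℤ          ≡⟨ cong -_ (⟦⟧-*⁺ (suc m) j) ⟩
    - (suc m ⋆ 1# * ⟦ j ⟧ℤ)       ≡⟨ -‿distribˡ-* _ _ ⟩
    - (suc m ⋆ 1#) * ⟦ j ⟧ℤ       ∎
    where open ≡-Reasoning

  -- A copy of ⟦_⟧ℤ with ⟦ + 1 ⟧ definitionally 1#, so that solver goals may mention 1#.
  ⟦_⟧₁ : ℤ → A
  ⟦ + 1 ⟧₁ = 1#
  ⟦ i ⟧₁ = ⟦ i ⟧ℤ

  ⟦⟧₁≡⟦⟧ℤ : ∀ i → ⟦ i ⟧₁ ≡ ⟦ i ⟧ℤ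
  ⟦⟧₁≡⟦⟧ℤ (+ 0) = refl
  ⟦⟧₁≡⟦⟧ℤ (+ 1) = sym (+-identityʳ 1#)
  ⟦⟧₁≡⟦⟧ℤ (+ suc (suc n)) = refl
  ⟦⟧₁≡⟦⟧ℤ -[1+ n ] = refl

  morphism : ℤ.+-*-rawRing -Raw-AlmostCommutative⟶ fromCommutativeRing R
  morphism = record
    { ⟦_⟧ = ⟦_⟧₁
    ; +-homo = λ i j → trans (⟦⟧₁≡⟦⟧ℤ (i ℤ.+ j)) (trans (⟦⟧-+ i j) (sym (cong₂ _+_ (⟦⟧₁≡⟦⟧ℤ i) (⟦⟧₁≡⟦⟧ℤ j))))
    ; *-homo = λ i j → trans (⟦⟧₁≡⟦⟧ℤ (i ℤ.* j)) (trans (⟦⟧-* i j) (sym (cong₂ _*_ (⟦⟧₁≡⟦⟧ℤ i) (⟦⟧₁≡⟦⟧ℤ j))))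
    ; -‿homo = λ i → trans (⟦⟧₁≡⟦⟧ℤ (ℤ.- i)) (trans (⟦⟧-neg i) (sym (cong -_ (⟦⟧₁≡⟦⟧ℤ i))))
    ; 0-homo = refl
    ; 1-homo = refl
    }

  coeff≟ : ∀ i j → Maybe (⟦ i ⟧₁ ≡ ⟦ j ⟧₁)
  coeff≟ i j with i ℤ.≟ j
  ... | yes eq = just (cong ⟦_⟧₁ eq)
  ... | no _ = nothing

  open RingSolver ℤ.+-*-rawRing (fromCommutativeRing R) morphism coeff≟ public
    using (solve; _:=_; _:+_; _:*_; :-_; con; Polynomial)

  :1 :0 : ∀ {n} → Polynomial n
  :1 = con (+ 1)
  :0 = con (+ 0)

-- Arithmetic in the finite field

module Field {q : ℕ} (F : FiniteField q) where
  open FiniteField F public using (Carrier; isCommutativeRing; 0≢1; inverse; enum)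
  open IntegerSolver isCommutativeRing public
  open CommutativeRing R public
    using (_+_; _*_; -_; 0#; 1#; +-identityˡ; +-identityʳ; *-identityˡ; *-identityʳ; zeroˡ; zeroʳ; *-assoc; *-comm; +-comm; +-assoc; -‿inverseʳ)
  open SL2 F public

  open Inverse enum using (to; from; strictlyInverseˡ; strictlyInverseʳ)

  from-injective : ∀ {x y} → from x ≡ from y → x ≡ y
  from-injective {x} {y} eq = trans (sym (strictlyInverseˡ x)) (trans (cong to eq) (strictlyInverseˡ y))

  to-injective : ∀ {i j} → to i ≡ to j → i ≡ j
  to-injective {i} {j} eq = trans (sym (strictlyInverseʳ i)) (trans (cong from eq) (strictlyInverseʳ j))

  _≟_ : DecidableEquality Carrier
  x ≟ y with from x Fin.≟ from y
  ... | yes eq = yes (from-injective eq)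
  ... | no ne = no (ne ∘ cong from)

  abstract
    elements : Listing (λ (_ : Carrier) → ⊤) q
    elements = fromHasSize (to , to-injective , λ x → (λ _ → from x , strictlyInverseˡ x) , _)

  x-y≡0⇒x≡y : ∀ {x y} → x + - y ≡ 0# → x ≡ y
  x-y≡0⇒x≡y {x} {y} eq = trans (solve 2 (λ x y → x := (x :+ :- y) :+ y) refl x y) (trans (cong (_+ y) eq) (+-identityˡ y))

  x≡y⇒x-y≡0 : ∀ {x y} → x ≡ y → x + - y ≡ 0#
  x≡y⇒x-y≡0 {x} refl = -‿inverseʳ x

  -- Deriving x ≡ y from hypotheses aᵢ ≡ bᵢ through a certificate x − y = Σ kᵢ (aᵢ − bᵢ).
  by-combination₁ : ∀ {x y a b} k → a ≡ b → x + - y ≡ k * (a + - b) → x ≡ y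
  by-combination₁ k h cert = x-y≡0⇒x≡y (trans cert (trans (cong (k *_) (x≡y⇒x-y≡0 h)) (zeroʳ k)))

  by-combination₂ : ∀ {x y a b c d} k l → a ≡ b → c ≡ d → x + - y ≡ k * (a + - b) + l * (c + - d) → x ≡ y
  by-combination₂ k l h h′ cert = x-y≡0⇒x≡y (trans cert (trans
    (cong₂ (λ s t → k * s + l * t) (x≡y⇒x-y≡0 h) (x≡y⇒x-y≡0 h′)) (trans (cong₂ _+_ (zeroʳ k) (zeroʳ l)) (+-identityʳ 0#))))

  by-combination₃ : ∀ {x y a b c d e f} k l m → a ≡ b → c ≡ d → e ≡ f →
    x + - y ≡ k * (a + - b) + l * (c + - d) + m * (e + - f) → x ≡ y
  by-combination₃ k l m h h′ h″ cert = x-y≡0⇒x≡y (trans cert (trans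
    (cong₂ (λ s t → k * s + l * t + _) (x≡y⇒x-y≡0 h) (x≡y⇒x-y≡0 h′)) (trans (cong (λ t → k * 0# + l * 0# + m * t) (x≡y⇒x-y≡0 h″))
      (solve 3 (λ k l m → k :* :0 :+ l :* :0 :+ m :* :0 := :0) refl k l m))))

  *-cancelˡ : ∀ {x y z} → x ≢ 0# → x * y ≡ x * z → y ≡ z
  *-cancelˡ {x} {y} {z} x≢0 eq with inverse x x≢0
  ... | i , xi≡1 = by-combination₂ i (z + - y) eq xi≡1
    (solve 4 (λ x y z i → y :+ :- z := i :* (x :* y :+ :- (x :* z)) :+ (z :+ :- y) :* (x :* i :+ :- :1)) refl x y z i)

  no-zero-divisors : ∀ {x y} → x ≢ 0# → x * y ≡ 0# → y ≡ 0#
  no-zero-divisors {x} x≢0 eq = *-cancelˡ x≢0 (trans eq (sym (zeroʳ x)))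

-- The group SL(2,q), its action on row vectors, and rigidity

module Matrices {q : ℕ} (F : FiniteField q) where
  open Field F public

  mat-≡ : ∀ {a b c d a' b' c' d'} → a ≡ a' → b ≡ b' → c ≡ c' → d ≡ d' → mat a b c d ≡ mat a' b' c' d'
  mat-≡ refl refl refl refl = refl

  _≟ᴹ_ : DecidableEquality Mat
  mat a b c d ≟ᴹ mat a' b' c' d' = map′
    (λ (e₁ , e₂ , e₃ , e₄) → mat-≡ e₁ e₂ e₃ e₄) (λ { refl → refl , refl , refl , refl })
    (a ≟ a' ×-dec b ≟ b' ×-dec c ≟ c' ×-dec d ≟ d')

  private
    lemma-assoc : ∀ a b a' b' c' d' x y →
      (a * a' + b * c') * x + (a * b' + b * d') * y ≡ a * (a' * x + b' * y) + b * (c' * x + d' * y)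
    lemma-assoc = solve 8 (λ a b a' b' c' d' x y →
      (a :* a' :+ b :* c') :* x :+ (a :* b' :+ b :* d') :* y := a :* (a' :* x :+ b' :* y) :+ b :* (c' :* x :+ d' :* y)) refl

    lemma-1x+0y : ∀ x y → 1# * x + 0# * y ≡ x
    lemma-1x+0y = solve 2 (λ x y → :1 :* x :+ :0 :* y := x) refl

    lemma-0x+1y : ∀ x y → 0# * x + 1# * y ≡ y
    lemma-0x+1y = solve 2 (λ x y → :0 :* x :+ :1 :* y := y) refl

    lemma-x1+y0 : ∀ x y → x * 1# + y * 0# ≡ x
    lemma-x1+y0 = solve 2 (λ x y → x :* :1 :+ y :* :0 := x) refl

    lemma-x0+y1 : ∀ x y → x * 0# + y * 1# ≡ y
    lemma-x0+y1 = solve 2 (λ x y → x :* :0 :+ y :* :1 := y) refl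

  ·-assoc : ∀ L M N → (L · M) · N ≡ L · (M · N)
  ·-assoc (mat a b c d) (mat a' b' c' d') (mat x y z w) = mat-≡
    (lemma-assoc a b a' b' c' d' x z) (lemma-assoc a b a' b' c' d' y w)
    (lemma-assoc c d a' b' c' d' x z) (lemma-assoc c d a' b' c' d' y w)

  ·-identityˡ : ∀ M → 𝟙 · M ≡ M
  ·-identityˡ (mat a b c d) = mat-≡ (lemma-1x+0y a c) (lemma-1x+0y b d) (lemma-0x+1y a c) (lemma-0x+1y b d)

  ·-identityʳ : ∀ M → M · 𝟙 ≡ M
  ·-identityʳ (mat a b c d) = mat-≡ (lemma-x1+y0 a b) (lemma-x0+y1 a b) (lemma-x1+y0 c d) (lemma-x0+y1 c d)

  inv-·-inverseˡ : ∀ M → InSL M → inv M · M ≡ 𝟙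
  inv-·-inverseˡ (mat a b c d) det≡1 = mat-≡
    (trans (solve 4 (λ a b c d → d :* a :+ :- b :* c := a :* d :+ :- (b :* c)) refl a b c d) det≡1)
    (solve 4 (λ a b c d → d :* b :+ :- b :* d := :0) refl a b c d)
    (solve 4 (λ a b c d → :- c :* a :+ a :* c := :0) refl a b c d)
    (trans (solve 4 (λ a b c d → :- c :* b :+ a :* d := a :* d :+ :- (b :* c)) refl a b c d) det≡1)

  inv-·-inverseʳ : ∀ M → InSL M → M · inv M ≡ 𝟙
  inv-·-inverseʳ (mat a b c d) det≡1 = mat-≡
    (trans (solve 4 (λ a b c d → a :* d :+ b :* :- c := a :* d :+ :- (b :* c)) refl a b c d) det≡1)
    (solve 4 (λ a b c d → a :* :- b :+ b :* a := :0) refl a b c d)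
    (solve 4 (λ a b c d → c :* d :+ d :* :- c := :0) refl a b c d)
    (trans (solve 4 (λ a b c d → c :* :- b :+ d :* a := a :* d :+ :- (b :* c)) refl a b c d) det≡1)

  det-· : ∀ M N → det (M · N) ≡ det M * det N
  det-· (mat a b c d) (mat a' b' c' d') = solve 8 (λ a b c d a' b' c' d' →
    (a :* a' :+ b :* c') :* (c :* b' :+ d :* d') :+ :- ((a :* b' :+ b :* d') :* (c :* a' :+ d :* c'))
      := (a :* d :+ :- (b :* c)) :* (a' :* d' :+ :- (b' :* c'))) refl a b c d a' b' c' d'

  det-𝟙 : InSL 𝟙
  det-𝟙 = solve 0 (:1 :* :1 :+ :- (:0 :* :0) := :1) refl

  det-inv : ∀ M → det (inv M) ≡ det M
  det-inv (mat a b c d) = solve 4 (λ a b c d → d :* a :+ :- (:- b :* :- c) := a :* d :+ :- (b :* c)) refl a b c d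

  SL : Set
  SL = Σ Mat InSL

  -- Determinant proofs are equations in a type with decidable equality, hence unique.
  SL-≡ : {x y : SL} → proj₁ x ≡ proj₁ y → x ≡ y
  SL-≡ {x , p} {.x , p'} refl = cong (x ,_) (Decidable⇒UIP.≡-irrelevant _≟_ p p')

  abstract
    InSL-𝟙 : InSL 𝟙
    InSL-𝟙 = det-𝟙

    InSL-· : ∀ {M N} → InSL M → InSL N → InSL (M · N)
    InSL-· {M} {N} p p' = trans (det-· M N) (trans (cong₂ _*_ p p') (*-identityˡ 1#))

    InSL-inv : ∀ {M} → InSL M → InSL (inv M)
    InSL-inv {M} p = trans (det-inv M) p

  infixl 7 _∙_
  infix 8 _⁻¹

  _∙_ : SL → SL → SL
  (M , p) ∙ (N , p') = M · N , InSL-· {M} {N} p p'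

  ε : SL
  ε = 𝟙 , InSL-𝟙

  _⁻¹ : SL → SL
  (M , p) ⁻¹ = inv M , InSL-inv {M} p

  assoc : ∀ x y z → (x ∙ y) ∙ z ≡ x ∙ (y ∙ z)
  assoc (L , _) (M , _) (N , _) = SL-≡ (·-assoc L M N)

  identityˡ : ∀ x → ε ∙ x ≡ x
  identityˡ (M , _) = SL-≡ (·-identityˡ M)

  identityʳ : ∀ x → x ∙ ε ≡ x
  identityʳ (M , _) = SL-≡ (·-identityʳ M)

  inverseˡ : ∀ x → x ⁻¹ ∙ x ≡ ε
  inverseˡ (M , p) = SL-≡ (inv-·-inverseˡ M p)

  inverseʳ : ∀ x → x ∙ x ⁻¹ ≡ ε
  inverseʳ (M , p) = SL-≡ (inv-·-inverseʳ M p)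

  SL-group : Group lzero lzero
  SL-group = record
    { Carrier = SL ; _≈_ = _≡_ ; _∙_ = _∙_ ; ε = ε ; _⁻¹ = _⁻¹
    ; isGroup = record
      { isMonoid = record
        { isSemigroup = record
          { isMagma = record { isEquivalence = isEquivalence ; ∙-cong = cong₂ _∙_ }
          ; assoc = assoc }
        ; identity = identityˡ , identityʳ }
      ; inverse = inverseˡ , inverseʳ
      ; ⁻¹-cong = cong _⁻¹ } }

  open import Algebra.Properties.Group SL-group public
    using (∙-cancelˡ; ∙-cancelʳ; ⁻¹-involutive; ⁻¹-anti-homo-∙; ε⁻¹≈ε; inverseˡ-unique; inverseʳ-unique; ⁻¹-injective)

  _≟ˢ_ : DecidableEquality SL
  x ≟ˢ y = map′ SL-≡ (cong proj₁) (proj₁ x ≟ᴹ proj₁ y)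

  xy⁻¹y : ∀ x y → x ∙ y ⁻¹ ∙ y ≡ x
  xy⁻¹y x y = trans (assoc x (y ⁻¹) y) (trans (cong (x ∙_) (inverseˡ y)) (identityʳ x))

  xyy⁻¹ : ∀ x y → x ∙ y ∙ y ⁻¹ ≡ x
  xyy⁻¹ x y = trans (assoc x y (y ⁻¹)) (trans (cong (x ∙_) (inverseʳ y)) (identityʳ x))

  xx⁻¹y : ∀ x y → x ∙ (x ⁻¹ ∙ y) ≡ y
  xx⁻¹y x y = trans (sym (assoc x (x ⁻¹) y)) (trans (cong (_∙ y) (inverseʳ x)) (identityˡ y))

  xy⁻¹≡ε⇒x≡y : ∀ {x y} → x ∙ y ⁻¹ ≡ ε → x ≡ y
  xy⁻¹≡ε⇒x≡y {x} {y} eq = trans (sym (xy⁻¹y x y)) (trans (cong (_∙ y) eq) (identityˡ y))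

  infixl 7 _⊙_
  V : Set
  V = Carrier × Carrier

  _⊙_ : V → Mat → V
  (x , y) ⊙ mat a b c d = x * a + y * c , x * b + y * d

  𝟎 e₁ e₂ : V
  𝟎 = 0# , 0#
  e₁ = 1# , 0#
  e₂ = 0# , 1#

  _≟ⱽ_ : DecidableEquality V
  _≟ⱽ_ = ≡-dec _≟_ _≟_

  ⊙-· : ∀ v M N → v ⊙ (M · N) ≡ v ⊙ M ⊙ N
  ⊙-· (x , y) (mat a b c d) (mat a' b' c' d') = sym (cong₂ _,_ (lemma-assoc x y a b c d a' c') (lemma-assoc x y a b c d b' d'))

  ⊙-𝟙 : ∀ v → v ⊙ 𝟙 ≡ v
  ⊙-𝟙 (x , y) = cong₂ _,_ (lemma-x1+y0 x y) (lemma-x0+y1 x y)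

  e₁-⊙ : ∀ {a b c d} → e₁ ⊙ mat a b c d ≡ (a , b)
  e₁-⊙ {a} {b} {c} {d} = cong₂ _,_ (lemma-1x+0y a c) (lemma-1x+0y b d)

  e₂-⊙ : ∀ {a b c d} → e₂ ⊙ mat a b c d ≡ (c , d)
  e₂-⊙ {a} {b} {c} {d} = cong₂ _,_ (lemma-0x+1y a c) (lemma-0x+1y b d)

  𝟎-⊙ : ∀ M → 𝟎 ⊙ M ≡ 𝟎
  𝟎-⊙ (mat a b c d) = cong₂ _,_ (l a c) (l b d)
    where
    l : ∀ x y → 0# * x + 0# * y ≡ 0#
    l = solve 2 (λ x y → :0 :* x :+ :0 :* y := :0) refl

  e₁≢𝟎 : e₁ ≢ 𝟎
  e₁≢𝟎 eq = 0≢1 (sym (cong proj₁ eq))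

  e₂≢𝟎 : e₂ ≢ 𝟎
  e₂≢𝟎 eq = 0≢1 (sym (cong proj₂ eq))

  ⊙-⁻¹ : ∀ {v w} (x : SL) → v ⊙ proj₁ x ≡ w → w ⊙ proj₁ (x ⁻¹) ≡ v
  ⊙-⁻¹ {v} x refl = trans (sym (⊙-· v (proj₁ x) (proj₁ (x ⁻¹)))) (trans (cong (λ y → v ⊙ proj₁ y) (inverseʳ x)) (⊙-𝟙 v))

  ⊙-≢𝟎 : ∀ {v} (x : SL) → v ≢ 𝟎 → v ⊙ proj₁ x ≢ 𝟎
  ⊙-≢𝟎 x v≢0 eq = v≢0 (trans (sym (⊙-⁻¹ x eq)) (𝟎-⊙ _))

  x≢0⇒-x≢0 : ∀ {x} → x ≢ 0# → - x ≢ 0#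
  x≢0⇒-x≢0 {x} x≢0 eq = x≢0 (by-combination₁ (- 1#) eq (solve 1 (λ x → x :+ :- :0 := :- :1 :* (:- x :+ :- :0)) refl x))

  sl : ∀ a b c d → a * d + - (b * c) ≡ 1# → SL
  sl a b c d p = mat a b c d , p

  abstract
    det-upper : ∀ σ → 1# * 1# + - (σ * 0#) ≡ 1#
    det-upper = solve 1 (λ σ → :1 :* :1 :+ :- (σ :* :0) := :1) refl

    det-lower : ∀ τ → 1# * 1# + - (0# * τ) ≡ 1#
    det-lower = solve 1 (λ τ → :1 :* :1 :+ :- (:0 :* τ) := :1) refl

  upper lower : Carrier → SL
  upper σ = sl 1# σ 0# 1# (det-upper σ)
  lower τ = sl 1# 0# τ 1# (det-lower τ)

  -- A permutation of SL(2,q) that respects the right cosets of every vector stabilizer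
  -- is determined by the image of ε.
  module Rigidity (f : SL → SL) (f-injective : ∀ {x y} → f x ≡ f y → x ≡ y) (f-ε : f ε ≡ ε)
    (resp : ∀ v x y → v ≢ 𝟎 → v ⊙ proj₁ x ≡ v ⊙ proj₁ y → v ⊙ proj₁ (f x) ≡ v ⊙ proj₁ (f y)) where

    open Mat

    A B C D : SL → Carrier
    A = a ∘ proj₁
    B = b ∘ proj₁
    C = c ∘ proj₁
    D = d ∘ proj₁

    -- The product of e₁ with a matrix is its first row, so `resp` at e₁ is a statement about first
    -- rows.
    row₁ : ∀ x y → A x ≡ A y → B x ≡ B y → A (f x) ≡ A (f y) × B (f x) ≡ B (f y)
    row₁ x y p p' = ,-injective (trans (sym e₁-⊙) (trans
      (resp e₁ x y e₁≢𝟎 (trans e₁-⊙ (trans (cong₂ _,_ p p') (sym e₁-⊙)))) e₁-⊙))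

    row₂ : ∀ x y → C x ≡ C y → D x ≡ D y → C (f x) ≡ C (f y) × D (f x) ≡ D (f y)
    row₂ x y p p' = ,-injective (trans (sym e₂-⊙) (trans
      (resp e₂ x y e₂≢𝟎 (trans e₂-⊙ (trans (cong₂ _,_ p p') (sym e₂-⊙)))) e₂-⊙))

    f-ε-entries : A (f ε) ≡ 1# × B (f ε) ≡ 0# × C (f ε) ≡ 0# × D (f ε) ≡ 1#
    f-ε-entries rewrite f-ε = refl , refl , refl , refl

    row₂-upper : ∀ σ → C (f (upper σ)) ≡ 0# × D (f (upper σ)) ≡ 1#
    row₂-upper σ = let p , p' = row₂ (upper σ) ε refl refl ; _ , _ , r , r' = f-ε-entries in trans p r , trans p' r'

    row₁-lower : ∀ τ → A (f (lower τ)) ≡ 1# × B (f (lower τ)) ≡ 0#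
    row₁-lower τ = let p , p' = row₁ (lower τ) ε refl refl ; r , r' , _ = f-ε-entries in trans p r , trans p' r'

    A-upper : ∀ σ → A (f (upper σ)) ≡ 1#
    A-upper σ = let c≡0 , d≡1 = row₂-upper σ in go (f (upper σ)) c≡0 d≡1
      where
      go : ∀ y → C y ≡ 0# → D y ≡ 1# → A y ≡ 1#
      go (mat a b c d , p) c≡0 d≡1 = by-combination₃ 1# b (- a) p c≡0 d≡1
        (solve 4 (λ a b c d → a :+ :- :1 := :1 :* (a :* d :+ :- (b :* c) :+ :- :1) :+ b :* (c :+ :- :0) :+ (:- a) :* (d :+ :- :1)) refl a b c d)

    D-lower : ∀ τ → D (f (lower τ)) ≡ 1#
    D-lower τ = let a≡1 , b≡0 = row₁-lower τ in go (f (lower τ)) a≡1 b≡0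
      where
      go : ∀ y → A y ≡ 1# → B y ≡ 0# → D y ≡ 1#
      go (mat a b c d , p) a≡1 b≡0 = by-combination₃ 1# c (- d) p b≡0 a≡1
        (solve 4 (λ a b c d → d :+ :- :1 := :1 :* (a :* d :+ :- (b :* c) :+ :- :1) :+ c :* (b :+ :- :0) :+ (:- d) :* (a :+ :- :1)) refl a b c d)

    κ ρ : Carrier → Carrier
    κ σ = B (f (upper σ))
    ρ τ = C (f (lower τ))

    -- Injectivity enters here: otherwise f (lower 1#) would equal ε = f ε.
    ρ1≢0 : ρ 1# ≢ 0#
    ρ1≢0 eq = 0≢1 (sym (cong C (f-injective {lower 1#} {ε} (trans (SL-≡ (mat-≡ (proj₁ (row₁-lower 1#)) (proj₂ (row₁-lower 1#)) eq (D-lower 1#))) (sym f-ε)))))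

    -- The products `upper σ ∙ lower τ` and `lower τ ∙ upper σ`, multiplied out. Each shares a row
    -- with one factor and a stabilizer coset with the other.
    X Y : Carrier → Carrier → SL
    X σ τ = sl (1# + σ * τ) σ τ 1# (solve 2 (λ σ τ → (:1 :+ σ :* τ) :* :1 :+ :- (σ :* τ) := :1) refl σ τ)
    Y σ τ = sl 1# σ τ (1# + σ * τ) (solve 2 (λ σ τ → :1 :* (:1 :+ σ :* τ) :+ :- (σ :* τ) := :1) refl σ τ)

    -- The second row is that of `lower τ`. The vector (1, -σ) has the same product with `X σ τ` and
    -- with `upper σ`, and this determines the first row of the image.
    X-entries : ∀ σ τ → A (f (X σ τ)) ≡ 1# + σ * ρ τ × B (f (X σ τ)) ≡ κ σ × C (f (X σ τ)) ≡ ρ τ × D (f (X σ τ)) ≡ 1#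
    X-entries σ τ = go (f (X σ τ)) (f (upper σ)) (proj₁ r2) (trans (proj₂ r2) (D-lower τ)) (A-upper σ) (proj₁ (row₂-upper σ)) (proj₂ (row₂-upper σ)) comb
      where
      r2 = row₂ (X σ τ) (lower τ) refl refl
      comb : (1# , - σ) ⊙ proj₁ (f (X σ τ)) ≡ (1# , - σ) ⊙ proj₁ (f (upper σ))
      comb = resp (1# , - σ) (X σ τ) (upper σ) (λ eq → 0≢1 (sym (cong proj₁ eq))) (cong₂ _,_
        (solve 2 (λ σ τ → :1 :* (:1 :+ σ :* τ) :+ :- σ :* τ := :1 :* :1 :+ :- σ :* :0) refl σ τ)
        refl)
      go : ∀ y u → C y ≡ ρ τ → D y ≡ 1# → A u ≡ 1# → C u ≡ 0# → D u ≡ 1# →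
        (1# , - σ) ⊙ proj₁ y ≡ (1# , - σ) ⊙ proj₁ u → A y ≡ 1# + σ * ρ τ × B y ≡ B u × C y ≡ ρ τ × D y ≡ 1#
      go (mat a b c d , _) (mat _ b' _ _ , _) refl refl refl refl refl eq with ,-injective eq
      ... | eq₁ , eq₂ =
        by-combination₁ 1# eq₁ (solve 3 (λ a c σ → a :+ :- (:1 :+ σ :* c) := :1 :* (:1 :* a :+ :- σ :* c :+ :- (:1 :* :1 :+ :- σ :* :0))) refl a c σ) ,
        by-combination₁ 1# eq₂ (solve 3 (λ b b' σ → b :+ :- b' := :1 :* (:1 :* b :+ :- σ :* :1 :+ :- (:1 :* b' :+ :- σ :* :1))) refl b b' σ) , refl , refl

    -- The determinant of f (X σ 1#) is 1 + σ ρ(1) - κ(σ) ρ(1), and it equals 1.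
    κ≡id : ∀ σ → κ σ ≡ σ
    κ≡id σ = let p₁ , p₂ , p₃ , p₄ = X-entries σ 1# in go (f (X σ 1#)) p₁ p₂ p₃ p₄
      where
      go : ∀ y → A y ≡ 1# + σ * ρ 1# → B y ≡ κ σ → C y ≡ ρ 1# → D y ≡ 1# → κ σ ≡ σ
      go (mat _ _ _ _ , p) refl refl refl refl = *-cancelˡ ρ1≢0 (by-combination₁ (- 1#) p
        (solve 3 (λ σ κ ρ → ρ :* κ :+ :- (ρ :* σ) := :- :1 :* ((:1 :+ σ :* ρ) :* :1 :+ :- (κ :* ρ) :+ :- :1)) refl σ (κ σ) (ρ 1#)))

    -- Mirror image of `X-entries`: the first row comes from `upper σ`, and the vector (-τ, 1) ties
    -- the second row to `lower τ`.
    Y-entries : ∀ σ τ → A (f (Y σ τ)) ≡ 1# × B (f (Y σ τ)) ≡ σ × C (f (Y σ τ)) ≡ ρ τ × D (f (Y σ τ)) ≡ 1# + σ * τ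
    Y-entries σ τ = go (f (Y σ τ)) (f (lower τ)) (trans (proj₁ r1) (A-upper σ)) (trans (proj₂ r1) (κ≡id σ)) (proj₁ (row₁-lower τ)) (proj₂ (row₁-lower τ)) (D-lower τ) comb
      where
      r1 = row₁ (Y σ τ) (upper σ) refl refl
      comb : (- τ , 1#) ⊙ proj₁ (f (Y σ τ)) ≡ (- τ , 1#) ⊙ proj₁ (f (lower τ))
      comb = resp (- τ , 1#) (Y σ τ) (lower τ) (λ eq → 0≢1 (sym (cong proj₂ eq))) (cong₂ _,_
        refl
        (solve 2 (λ σ τ → :- τ :* σ :+ :1 :* (:1 :+ σ :* τ) := :- τ :* :0 :+ :1 :* :1) refl σ τ))
      go : ∀ y l → A y ≡ 1# → B y ≡ σ → A l ≡ 1# → B l ≡ 0# → D l ≡ 1# →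
        (- τ , 1#) ⊙ proj₁ y ≡ (- τ , 1#) ⊙ proj₁ l → A y ≡ 1# × B y ≡ σ × C y ≡ C l × D y ≡ 1# + σ * τ
      go (mat a b c d , _) (mat _ _ c' _ , _) refl refl refl refl refl eq with ,-injective eq
      ... | eq₁ , eq₂ = refl , refl ,
        by-combination₁ 1# eq₁ (solve 3 (λ c c' τ → c :+ :- c' := :1 :* (:- τ :* :1 :+ :1 :* c :+ :- (:- τ :* :1 :+ :1 :* c'))) refl c c' τ) ,
        by-combination₁ 1# eq₂ (solve 3 (λ σ d τ → d :+ :- (:1 :+ σ :* τ) := :1 :* (:- τ :* σ :+ :1 :* d :+ :- (:- τ :* :0 :+ :1 :* :1))) refl σ d τ)

    ρ≡id : ∀ τ → ρ τ ≡ τ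
    ρ≡id τ = let p₁ , p₂ , p₃ , p₄ = Y-entries 1# τ in go (f (Y 1# τ)) p₁ p₂ p₃ p₄
      where
      go : ∀ y → A y ≡ 1# → B y ≡ 1# → C y ≡ ρ τ → D y ≡ 1# + 1# * τ → ρ τ ≡ τ
      go (mat _ _ _ _ , p) refl refl refl refl = by-combination₁ (- 1#) p
        (solve 2 (λ τ ρ → ρ :+ :- τ := :- :1 :* (:1 :* (:1 :+ :1 :* τ) :+ :- (:1 :* ρ) :+ :- :1)) refl τ (ρ τ))

    -- A row (a, b) with b ≠ 0 is the first row of X b ((a - 1) / b), whose image is already known.
    row₁-fixed-B≢0 : ∀ x → B x ≢ 0# → A (f x) ≡ A x × B (f x) ≡ B x
    row₁-fixed-B≢0 x b≢0 with inverse (B x) b≢0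
    ... | i , bi≡1 = trans (proj₁ r) (trans (proj₁ e) (trans (cong (λ t → 1# + B x * t) (ρ≡id τ)) (sym A≡))) , trans (proj₂ r) (trans (proj₁ (proj₂ e)) (κ≡id (B x)))
      where
      τ = i * (A x + - 1#)
      A≡ : A x ≡ 1# + B x * τ
      A≡ = by-combination₁ (1# + - A x) bi≡1 (solve 3 (λ a b i → a :+ :- (:1 :+ b :* (i :* (a :+ :- :1))) := (:1 :+ :- a) :* (b :* i :+ :- :1)) refl (A x) (B x) i)
      r = row₁ x (X (B x) τ) A≡ refl
      e = X-entries (B x) τ

    row₂-fixed-C≢0 : ∀ x → C x ≢ 0# → C (f x) ≡ C x × D (f x) ≡ D x
    row₂-fixed-C≢0 x c≢0 with inverse (C x) c≢0
    ... | i , ci≡1 = trans (proj₁ r) (trans (proj₁ (proj₂ (proj₂ e))) (ρ≡id (C x))) , trans (proj₂ r) (trans (proj₂ (proj₂ (proj₂ e))) (sym D≡))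
      where
      σ = i * (D x + - 1#)
      D≡ : D x ≡ 1# + σ * C x
      D≡ = by-combination₁ (1# + - D x) ci≡1 (solve 3 (λ d c i → d :+ :- (:1 :+ (i :* (d :+ :- :1)) :* c) := (:1 :+ :- d) :* (c :* i :+ :- :1)) refl (D x) (C x) i)
      r = row₂ x (Y σ (C x)) refl D≡
      e = Y-entries σ (C x)

    -- The vector (1, 1) picks out the sum of the two rows. This reaches the rows (a, 0) and (0, d),
    -- which the two preceding lemmas miss.
    sum-fixed : ∀ x y → B y ≢ 0# → C y ≢ 0# → (1# , 1#) ⊙ proj₁ x ≡ (1# , 1#) ⊙ proj₁ y →
      (1# , 1#) ⊙ proj₁ (f x) ≡ (1# , 1#) ⊙ proj₁ x
    sum-fixed x y b≢0 c≢0 eq = trans (resp (1# , 1#) x y (λ eq → 0≢1 (sym (cong proj₁ eq))) eq)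
      (trans (cong ((1# , 1#) ⊙_) (mat-≡ (proj₁ r) (proj₂ r) (proj₁ s) (proj₂ s))) (sym eq))
      where
      r = row₁-fixed-B≢0 y b≢0
      s = row₂-fixed-C≢0 y c≢0

    module _ (a d : Carrier) (ad≡1 : a * d ≡ 1#) where

      private
        a≢0 : a ≢ 0#
        a≢0 refl = 0≢1 (trans (sym (zeroˡ d)) ad≡1)
        d≢0 : d ≢ 0#
        d≢0 refl = 0≢1 (trans (sym (zeroʳ a)) ad≡1)

      row₁-fixed-diagonal : ∀ x → A x ≡ a → B x ≡ 0# → A (f x) ≡ a × B (f x) ≡ 0#
      row₁-fixed-diagonal x A≡ B≡ = let r = row₁ x g A≡ B≡ ; r' = fixed in trans (proj₁ r) (proj₁ r') , trans (proj₂ r) (proj₂ r')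
        where
        -- `g` has the wanted first row (a, 0) and a second row already known to be fixed; `g'` has
        -- the same row sum as `g`, but both of its off-diagonal entries are nonzero, as `sum-fixed`
        -- requires.
        g g' : SL
        g = sl a 0# 1# d (trans (solve 2 (λ a d → a :* d :+ :- (:0 :* :1) := a :* d) refl a d) ad≡1)
        g' = sl (a + a + 1#) d (- a) 0# (trans (solve 2 (λ a d → (a :+ a :+ :1) :* :0 :+ :- (d :* :- a) := a :* d) refl a d) ad≡1)
        fixed : A (f g) ≡ a × B (f g) ≡ 0#
        fixed = go (f g) (row₂-fixed-C≢0 g (0≢1 ∘ sym)) (sum-fixed g g' d≢0 (x≢0⇒-x≢0 a≢0) (cong₂ _,_
            (solve 1 (λ a → :1 :* a :+ :1 :* :1 := :1 :* (a :+ a :+ :1) :+ :1 :* :- a) refl a)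
            (solve 1 (λ d → :1 :* :0 :+ :1 :* d := :1 :* d :+ :1 :* :0) refl d)))
          where
          go : ∀ y → C y ≡ 1# × D y ≡ d → (1# , 1#) ⊙ proj₁ y ≡ (1# , 1#) ⊙ proj₁ g → A y ≡ a × B y ≡ 0#
          go (mat u v _ _ , _) (refl , refl) eq with ,-injective eq
          ... | eq₁ , eq₂ =
            by-combination₁ 1# eq₁ (solve 2 (λ u a → u :+ :- a := :1 :* (:1 :* u :+ :1 :* :1 :+ :- (:1 :* a :+ :1 :* :1))) refl u a) ,
            by-combination₁ 1# eq₂ (solve 2 (λ v d → v :+ :- :0 := :1 :* (:1 :* v :+ :1 :* d :+ :- (:1 :* :0 :+ :1 :* d))) refl v d)

      row₂-fixed-diagonal : ∀ x → C x ≡ 0# → D x ≡ d → C (f x) ≡ 0# × D (f x) ≡ d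
      row₂-fixed-diagonal x C≡ D≡ = let r = row₂ x g C≡ D≡ ; r' = fixed in trans (proj₁ r) (proj₁ r') , trans (proj₂ r) (proj₂ r')
        where
        g g' : SL
        g = sl a 1# 0# d (trans (solve 2 (λ a d → a :* d :+ :- (:1 :* :0) := a :* d) refl a d) ad≡1)
        g' = sl 0# (- d) a (1# + d + d) (trans (solve 2 (λ a d → :0 :* (:1 :+ d :+ d) :+ :- (:- d :* a) := a :* d) refl a d) ad≡1)
        fixed : C (f g) ≡ 0# × D (f g) ≡ d
        fixed = go (f g) (row₁-fixed-B≢0 g (0≢1 ∘ sym)) (sum-fixed g g' (x≢0⇒-x≢0 d≢0) a≢0 (cong₂ _,_
            (solve 1 (λ a → :1 :* a :+ :1 :* :0 := :1 :* :0 :+ :1 :* a) refl a)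
            (solve 1 (λ d → :1 :* :1 :+ :1 :* d := :1 :* :- d :+ :1 :* (:1 :+ d :+ d)) refl d)))
          where
          go : ∀ y → A y ≡ a × B y ≡ 1# → (1# , 1#) ⊙ proj₁ y ≡ (1# , 1#) ⊙ proj₁ g → C y ≡ 0# × D y ≡ d
          go (mat _ _ u v , _) (refl , refl) eq with ,-injective eq
          ... | eq₁ , eq₂ =
            by-combination₁ 1# eq₁ (solve 2 (λ u a → u :+ :- :0 := :1 :* (:1 :* a :+ :1 :* u :+ :- (:1 :* a :+ :1 :* :0))) refl u a) ,
            by-combination₁ 1# eq₂ (solve 2 (λ v d → v :+ :- d := :1 :* (:1 :* :1 :+ :1 :* v :+ :- (:1 :* :1 :+ :1 :* d))) refl v d)

    f≡id : ∀ x → f x ≡ x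
    f≡id x@(mat a b c d , p) = SL-≡ (mat-≡ (proj₁ r1) (proj₂ r1) (proj₁ r2) (proj₂ r2))
      where
      r1 : A (f x) ≡ a × B (f x) ≡ b
      r1 with b ≟ 0#
      ... | no b≢0 = row₁-fixed-B≢0 x b≢0
      ... | yes refl = row₁-fixed-diagonal a d (trans (solve 3 (λ a c d → a :* d := a :* d :+ :- (:0 :* c)) refl a c d) p) x refl refl
      r2 : C (f x) ≡ c × D (f x) ≡ d
      r2 with c ≟ 0#
      ... | no c≢0 = row₂-fixed-C≢0 x c≢0
      ... | yes refl = row₂-fixed-diagonal a d (trans (solve 3 (λ a b d → a :* d := a :* d :+ :- (b :* :0)) refl a b d) p) x refl refl

-- The order of SL(2,q), and transvections in its Sylow p-subgroups

prime-∣-divisor-of-power : ∀ {p} → Prime p → ∀ k {r} → r ∣ p ℕ.^ k → r ≢ 1 → p ∣ r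
prime-∣-divisor-of-power pr zero r∣1 r≢1 = ⊥-elim (r≢1 (∣1⇒≡1 r∣1))
prime-∣-divisor-of-power {p} pr (suc k) {r} r∣ r≢1 with p ∣? r
... | yes p∣r = p∣r
... | no p∤r = prime-∣-divisor-of-power pr k (coprime-divisor coprime r∣) r≢1
  where
  coprime : Coprime r p
  coprime (d∣r , d∣p) with prime⇒irreducible pr d∣p
  ... | inj₁ d≡1 = d≡1
  ... | inj₂ refl = ⊥-elim (p∤r d∣r)

module Sylows {q : ℕ} (F : FiniteField q) {p e : ℕ} (p-prime : Prime p) (q≡p^e : q ≡ p ℕ.^ e) (3≤q : 3 ℕ.≤ q) where
  open Matrices F public

  instance
    p-nonZero : NonZero p
    p-nonZero = prime⇒nonZero p-prime

  p∣q : p ∣ q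
  p∣q = go e q≡p^e
    where
    go : ∀ e → q ≡ p ℕ.^ e → p ∣ q
    go zero eq = ⊥-elim (ℕ.<⇒≱ (s≤s (s≤s z≤n)) (subst (3 ℕ.≤_) eq 3≤q))
    go (suc e) eq = subst (p ∣_) (sym eq) (m∣m*n (p ℕ.^ e))

  p∤1 : ¬ p ∣ 1
  p∤1 p∣1 = ℕ.<⇒≢ (ℕ.nonTrivial⇒n>1 p {{prime⇒nonTrivial p-prime}}) (sym (∣1⇒≡1 p∣1))

  q-1 : ℕ
  q-1 = ℕ.pred q

  q≡1+q-1 : q ≡ suc q-1
  q≡1+q-1 = go q 3≤q
    where
    go : ∀ n → 3 ℕ.≤ n → n ≡ suc (ℕ.pred n)
    go (suc n) _ = refl

  p∤q-1 : ¬ p ∣ q-1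
  p∤q-1 p∣ = p∤1 (∣m+n∣m⇒∣n (subst (p ∣_) (trans q≡1+q-1 (sym (ℕ.+-comm q-1 1))) p∣q) p∣)

  module Fl = FiniteListing _≟_
  module Ml = FiniteListing _≟ᴹ_
  module Vl = FiniteListing _≟ⱽ_

  abstract
    -- The bound `3≤q` is what leaves room for a third scalar.
    avoid₂ : (x y : Carrier) → ∃[ z ] (z ≢ x × z ≢ y)
    avoid₂ x y = let z , _ , z∉ = Fl.Listing-avoid elements (x ∷ y ∷ []) 3≤q in z , z∉ ∘ here , z∉ ∘ there ∘ here

  abstract
    units : Listing (λ x → ⊤ × x ≢ 0#) q-1
    units = Fl.Listing-remove tt (subst (Listing _) q≡1+q-1 elements)

  -- Total, with the default value 0# at 0#, so that matrices can be parametrized by plain scalars.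
  recip : Carrier → Carrier
  recip x with x ≟ 0#
  ... | yes _ = 0#
  ... | no x≢0 = proj₁ (inverse x x≢0)

  *-recip : ∀ {x} → x ≢ 0# → x * recip x ≡ 1#
  *-recip {x} x≢0 with x ≟ 0#
  ... | yes x≡0 = ⊥-elim (x≢0 x≡0)
  ... | no x≢0 = proj₂ (inverse x x≢0)

  -- The first summand counts the matrices with lower left entry c ≠ 0 (then a, d are free and b is
  -- determined), the second those with c = 0 (then a is a unit and b is free).
  ∣SL∣ : ℕ
  ∣SL∣ = q-1 ℕ.* (q ℕ.* q) ℕ.+ q-1 ℕ.* q

  abstract
    SL-listing : Listing InSL ∣SL∣
    SL-listing = Listing-resp iff (Listing-⊎ disjoint
      (Listing-map big (λ _ _ eq → cong₂ _,_ (cong Mat.c eq) (cong₂ _,_ (cong Mat.a eq) (cong Mat.d eq))) (Listing-× units (Listing-× elements elements)))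
      (Listing-map triangular (λ _ _ eq → cong₂ _,_ (cong Mat.a eq) (cong Mat.b eq)) (Listing-× units elements)))
      where
      big : Carrier × (Carrier × Carrier) → Mat
      big (c , a , d) = mat a ((a * d + - 1#) * recip c) c d
      triangular : Carrier × Carrier → Mat
      triangular (a , b) = mat a b 0# (recip a)
      InBig InTri : Mat → Set
      InBig M = ∃[ x ] (((⊤ × proj₁ x ≢ 0#) × (⊤ × ⊤)) × M ≡ big x)
      InTri M = ∃[ x ] (((⊤ × proj₁ x ≢ 0#) × ⊤) × M ≡ triangular x)
      disjoint : ∀ {M} → InBig M → InTri M → ⊥
      disjoint (_ , ((_ , c≢0) , _) , refl) (_ , _ , eq) = c≢0 (cong Mat.c eq)
      iff : ∀ M → (InBig M ⊎ InTri M) ⇔ₚ InSL M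
      iff (mat a b c d) = to , from
        where
        to : InBig (mat a b c d) ⊎ InTri (mat a b c d) → InSL (mat a b c d)
        to (inj₁ ((c , a , d) , ((_ , c≢0) , _) , refl)) = by-combination₁ (1# + - (a * d)) (*-recip c≢0)
          (solve 4 (λ a d c r → a :* d :+ :- ((a :* d :+ :- :1) :* r :* c) :+ :- :1 := (:1 :+ :- (a :* d)) :* (c :* r :+ :- :1)) refl a d c (recip c))
        to (inj₂ ((a , b) , ((_ , a≢0) , _) , refl)) = trans (solve 3 (λ a b r → a :* r :+ :- (b :* :0) := a :* r) refl a b (recip a)) (*-recip a≢0)
        from : InSL (mat a b c d) → InBig (mat a b c d) ⊎ InTri (mat a b c d)
        from eq with c ≟ 0#
        ... | no c≢0 = inj₁ ((c , a , d) , ((_ , c≢0) , _) , mat-≡ refl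
          (by-combination₂ (- b) (- recip c) (*-recip c≢0) eq
            (solve 5 (λ a b c d r → b :+ :- ((a :* d :+ :- :1) :* r) := :- b :* (c :* r :+ :- :1) :+ :- r :* (a :* d :+ :- (b :* c) :+ :- :1)) refl a b c d (recip c))) refl refl)
        ... | yes refl = inj₂ ((a , b) , ((_ , a≢0) , _) , mat-≡ refl refl refl (*-cancelˡ a≢0 (trans ad≡1 (sym (*-recip a≢0)))))
          where
          ad≡1 : a * d ≡ 1#
          ad≡1 = trans (solve 3 (λ a b d → a :* d := a :* d :+ :- (b :* :0)) refl a b d) eq
          a≢0 : a ≢ 0#
          a≢0 refl = 0≢1 (trans (sym (zeroˡ d)) ad≡1)

  ∣SL∣≡q*[q-1]*[1+q] : ∣SL∣ ≡ q ℕ.* (q-1 ℕ.* q ℕ.+ q-1)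
  ∣SL∣≡q*[q-1]*[1+q] = begin
    q-1 ℕ.* (q ℕ.* q) ℕ.+ q-1 ℕ.* q   ≡⟨ cong (ℕ._+ q-1 ℕ.* q) (ℕ.*-assoc q-1 q q) ⟨
    q-1 ℕ.* q ℕ.* q ℕ.+ q-1 ℕ.* q     ≡⟨ ℕ.*-distribʳ-+ q (q-1 ℕ.* q) q-1 ⟨
    (q-1 ℕ.* q ℕ.+ q-1) ℕ.* q         ≡⟨ ℕ.*-comm (q-1 ℕ.* q ℕ.+ q-1) q ⟩
    q ℕ.* (q-1 ℕ.* q ℕ.+ q-1)         ∎
    where open ≡-Reasoning

  p∣∣SL∣ : p ∣ ∣SL∣
  p∣∣SL∣ = subst (p ∣_) (sym ∣SL∣≡q*[q-1]*[1+q]) (∣m⇒∣m*n _ p∣q)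

  -- Cancelling q = p^e would leave p dividing (q - 1) q + (q - 1), hence q - 1.
  p^[1+e]∤∣SL∣ : ¬ (p ℕ.^ suc e ∣ ∣SL∣)
  p^[1+e]∤∣SL∣ d = p∤q-1 (∣m+n∣m⇒∣n
    (*-cancelˡ-∣ q {{ℕ.>-nonZero (ℕ.≤-trans (s≤s z≤n) 3≤q)}}
      (subst₂ _∣_ (trans (cong (p ℕ.*_) (sym q≡p^e)) (ℕ.*-comm p q)) ∣SL∣≡q*[q-1]*[1+q] d))
    (∣n⇒∣m*n q-1 p∣q))

  Stab : V → Mat → Set
  Stab v M = InSL M × v ⊙ M ≡ v

  abstract
    -- Any matrix of determinant 1 with first row v will do.
    ∃-moving-e₁ : ∀ v → v ≢ 𝟎 → ∃[ g ] (e₁ ⊙ proj₁ {B = InSL} g ≡ v)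
    ∃-moving-e₁ (x , y) v≢0 with x ≟ 0#
    ... | no x≢0 = sl x y 0# (recip x) (trans (solve 3 (λ x y r → x :* r :+ :- (y :* :0) := x :* r) refl x y (recip x)) (*-recip x≢0)) , e₁-⊙
    ... | yes refl = sl 0# y (- recip y) 0# (trans (solve 2 (λ y r → :0 :* :0 :+ :- (y :* :- r) := y :* r) refl y (recip y)) (*-recip (λ { refl → v≢0 refl }))) , e₁-⊙

  Stab-subgroup : ∀ v → IsSubgroup (Stab v)
  Stab-subgroup v = (λ _ → proj₁) , (det-𝟙 , ⊙-𝟙 v) ,
    (λ x y (p , xf) (p' , yf) → InSL-· {x} {y} p p' , trans (⊙-· v x y) (trans (cong (_⊙ y) xf) yf)) ,
    (λ x (p , xf) → InSL-inv {x} p , ⊙-⁻¹ (x , p) xf)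

  Stab-e₁-listing : Listing (Stab e₁) q
  Stab-e₁-listing = Listing-resp iff (Listing-map (proj₁ ∘ lower) (λ _ _ → cong Mat.c) elements)
    where
    iff : ∀ M → (∃[ τ ] (⊤ × M ≡ proj₁ (lower τ))) ⇔ₚ Stab e₁ M
    iff M = (λ { (τ , _ , refl) → proj₂ (lower τ) , e₁-⊙ }) , from M
      where
      from : ∀ M → Stab e₁ M → ∃[ τ ] (⊤ × M ≡ proj₁ (lower τ))
      from (mat a b c d) (p , fix) with ,-injective (trans (sym e₁-⊙) fix)
      ... | refl , refl = c , tt , mat-≡ refl refl refl
        (trans (solve 2 (λ c d → d := :1 :* d :+ :- (:0 :* c)) refl c d) p)

  module _ {v : V} (g : SL) (e₁g≡v : e₁ ⊙ proj₁ g ≡ v) where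

    conj-Stab⇒ : ∀ x → e₁ ⊙ proj₁ x ≡ e₁ → v ⊙ proj₁ (g ⁻¹ ∙ x ∙ g) ≡ v
    conj-Stab⇒ x fix = begin
      v ⊙ proj₁ (g ⁻¹ ∙ x ∙ g)                        ≡⟨ ⊙-· v _ _ ⟩
      v ⊙ proj₁ (g ⁻¹ ∙ x) ⊙ proj₁ g                  ≡⟨ cong (_⊙ proj₁ g) (⊙-· v _ _) ⟩
      v ⊙ proj₁ (g ⁻¹) ⊙ proj₁ x ⊙ proj₁ g            ≡⟨ cong (λ w → w ⊙ proj₁ x ⊙ proj₁ g) (⊙-⁻¹ g e₁g≡v) ⟩
      e₁ ⊙ proj₁ x ⊙ proj₁ g                          ≡⟨ cong (_⊙ proj₁ g) fix ⟩
      e₁ ⊙ proj₁ g                                    ≡⟨ e₁g≡v ⟩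
      v                                               ∎
      where open ≡-Reasoning

  abstract
    -- All stabilizers of nonzero vectors are conjugate to that of e₁, which consists of the
    -- matrices `lower τ`.
    Stab-listing : ∀ v → v ≢ 𝟎 → Listing (Stab v) q
    Stab-listing v v≢0 with ∃-moving-e₁ v v≢0
    ... | g , e₁g≡v = Listing-resp iff (Listing-map conj conj-injective Stab-e₁-listing)
      where
      conj : Mat → Mat
      conj M = (inv (proj₁ g) · M) · proj₁ g
      unconj : ∀ x → g ⁻¹ ∙ (g ∙ x ∙ g ⁻¹) ∙ g ≡ x
      unconj x = trans (cong (_∙ g) (trans (sym (assoc _ _ _)) (cong (_∙ g ⁻¹) (trans (sym (assoc _ _ _)) (trans (cong (_∙ x) (inverseˡ g)) (identityˡ x)))))) (xy⁻¹y x g)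
      conj-injective : ∀ {M N} → Stab e₁ M → Stab e₁ N → conj M ≡ conj N → M ≡ N
      conj-injective {M} {N} (p , _) (p' , _) eq = cong proj₁
        (∙-cancelˡ (g ⁻¹) (M , p) (N , p') (∙-cancelʳ g (g ⁻¹ ∙ (M , p)) (g ⁻¹ ∙ (N , p')) (SL-≡ eq)))
      iff : ∀ M → (∃[ N ] (Stab e₁ N × M ≡ conj N)) ⇔ₚ Stab v M
      iff M = (λ { (N , (p , fix) , refl) → proj₂ (g ⁻¹ ∙ (N , p) ∙ g) , conj-Stab⇒ g e₁g≡v (N , p) fix }) ,
        λ (p , fix) → let y = g ∙ (M , p) ∙ g ⁻¹ in
          proj₁ y , (proj₂ y , fixed (M , p) fix) , cong proj₁ (sym (unconj (M , p)))
        where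
        fixed : ∀ x → v ⊙ proj₁ x ≡ v → e₁ ⊙ proj₁ (g ∙ x ∙ g ⁻¹) ≡ e₁
        fixed x fix = begin
          e₁ ⊙ proj₁ (g ∙ x ∙ g ⁻¹)                ≡⟨ ⊙-· e₁ _ _ ⟩
          e₁ ⊙ proj₁ (g ∙ x) ⊙ proj₁ (g ⁻¹)        ≡⟨ cong (_⊙ proj₁ (g ⁻¹)) (⊙-· e₁ _ _) ⟩
          e₁ ⊙ proj₁ g ⊙ proj₁ x ⊙ proj₁ (g ⁻¹)    ≡⟨ cong (λ w → w ⊙ proj₁ x ⊙ proj₁ (g ⁻¹)) e₁g≡v ⟩
          v ⊙ proj₁ x ⊙ proj₁ (g ⁻¹)               ≡⟨ cong (_⊙ proj₁ (g ⁻¹)) fix ⟩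
          v ⊙ proj₁ (g ⁻¹)                         ≡⟨ ⊙-⁻¹ g e₁g≡v ⟩
          e₁                                       ∎
          where open ≡-Reasoning

  abstract
    Stab-IsSylow : ∀ v → v ≢ 𝟎 → IsSylow p (Stab v)
    Stab-IsSylow v v≢0 = Stab-subgroup v , e , ∣SL∣ , toHasSize SL-listing ,
      subst (HasSize (Stab v)) q≡p^e (toHasSize (Stab-listing v v≢0)) , p^[1+e]∤∣SL∣

  abstract
    vectors : Listing (λ v → (⊤ × ⊤) × v ≢ 𝟎) (ℕ.pred (q ℕ.* q))
    vectors = Vl.Listing-remove _ (subst (Listing _) q*q≡ (Listing-× elements elements))
      where
      q*q≡ : q ℕ.* q ≡ suc (ℕ.pred (q ℕ.* q))
      q*q≡ rewrite q≡1+q-1 = refl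

  p∤q*q-1 : ¬ p ∣ ℕ.pred (q ℕ.* q)
  p∤q*q-1 p∣ = p∤1 (∣m+n∣m⇒∣n (subst (p ∣_) eq (∣m⇒∣m*n q p∣q)) p∣)
    where
    eq : q ℕ.* q ≡ ℕ.pred (q ℕ.* q) ℕ.+ 1
    eq rewrite q≡1+q-1 = ℕ.+-comm 1 _

  infix 25 _^ᴹ_
  _^ᴹ_ : Mat → ℕ → Mat
  M ^ᴹ n = iter (_· M) n 𝟙

  iter-·-^ᴹ : ∀ M n N → iter (_· M) n N ≡ N · M ^ᴹ n
  iter-·-^ᴹ M zero N = sym (·-identityʳ N)
  iter-·-^ᴹ M (suc n) N = trans (cong (_· M) (iter-·-^ᴹ M n N)) (·-assoc _ _ _)

  iter-⊙-^ᴹ : ∀ M n v → iter (_⊙ M) n v ≡ v ⊙ M ^ᴹ n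
  iter-⊙-^ᴹ M zero v = sym (⊙-𝟙 v)
  iter-⊙-^ᴹ M (suc n) v = trans (cong (_⊙ M) (iter-⊙-^ᴹ M n v)) (sym (⊙-· v _ _))

  ^ᴹ-* : ∀ M m n → M ^ᴹ (m ℕ.* n) ≡ (M ^ᴹ n) ^ᴹ m
  ^ᴹ-* M zero n = refl
  ^ᴹ-* M (suc m) n = trans (cong (M ^ᴹ_) (ℕ.+-comm n (m ℕ.* n))) (trans (iter-+ (_· M) (m ℕ.* n) n 𝟙) (trans (iter-·-^ᴹ M (m ℕ.* n) (M ^ᴹ n))
    (trans (cong (M ^ᴹ n ·_) (^ᴹ-* M m n)) (comm m))))
    where
    N = M ^ᴹ n
    comm : ∀ m → N · N ^ᴹ m ≡ N ^ᴹ m · N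
    comm zero = trans (·-identityʳ N) (sym (·-identityˡ N))
    comm (suc m) = trans (sym (·-assoc _ _ _)) (cong (_· N) (comm m))

  ·-fixed⇒𝟙 : ∀ M N → InSL M → M · N ≡ M → N ≡ 𝟙
  ·-fixed⇒𝟙 M N p eq = begin
    N                  ≡⟨ ·-identityˡ N ⟨
    𝟙 · N              ≡⟨ cong (_· N) (inv-·-inverseˡ M p) ⟨
    (inv M · M) · N    ≡⟨ ·-assoc (inv M) M N ⟩
    inv M · (M · N)    ≡⟨ cong (inv M ·_) eq ⟩
    inv M · M          ≡⟨ inv-·-inverseˡ M p ⟩
    𝟙                  ∎
    where open ≡-Reasoning

  abstract
    -- Lagrange for a cyclic subgroup: a power of g that fixes one element under right
    -- multiplication is 𝟙, so all cycles of this translation of H have the same length.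
    order : ∀ {H n} → IsSubgroup H → Listing H n → ∀ g → H g →
      ∃[ r ] (0 ℕ.< r × r ∣ n × g ^ᴹ r ≡ 𝟙 × (∀ i → 0 ℕ.< i → i ℕ.< r → g ^ᴹ i ≢ 𝟙))
    order {H} (inSL , H𝟙 , H· , Hinv) L g Hg =
      let r , 0<r , r∣n , period , free = Ml.semiregular-period (_· g) {P = H} L closed injective uniform (𝟙 , H𝟙)
      in r , 0<r , r∣n , period H𝟙 , λ i → free i H𝟙
      where
      closed : ∀ {x} → H x → H (x · g)
      closed {x} Hx = H· x g Hx Hg
      injective : ∀ {x y} → H x → H y → x · g ≡ y · g → x ≡ y
      injective {x} {y} Hx Hy eq = cong proj₁ (∙-cancelʳ (g , inSL g Hg) (x , inSL x Hx) (y , inSL y Hy) (SL-≡ eq))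
      uniform : ∀ i {x y} → H x → H y → iter (_· g) i x ≡ x → iter (_· g) i y ≡ y
      uniform i {x} {y} Hx Hy eq = trans (iter-·-^ᴹ g i y) (trans
        (cong (y ·_) (·-fixed⇒𝟙 x (g ^ᴹ i) (inSL x Hx) (trans (sym (iter-·-^ᴹ g i x)) eq))) (·-identityʳ y))

  abstract
    -- Without a fixed vector, g would permute the q² - 1 nonzero vectors in cycles of length p, but
    -- p does not divide q² - 1.
    order-p⇒fixed-vector : ∀ g → InSL g → g ^ᴹ p ≡ 𝟙 → ∃[ v ] (v ≢ 𝟎 × v ⊙ g ≡ v)
    order-p⇒fixed-vector g gSL g^p with any? (λ v → (v ⊙ g) ≟ⱽ v) (Listing.list vectors)
    ... | yes found = let v , v∈ , fix = find found in v , proj₂ (Listing.sound vectors v∈) , fix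
    ... | no none = ⊥-elim (p∤q*q-1 (subst (p ∣_) size (Finite.semiregular⇒∣length _≟ⱽ_ (_⊙ g) p unique record
      { closed = λ v∈ → complete (_ , ⊙-≢𝟎 (g , gSL) (proj₂ (sound v∈)))
      ; period = λ {v} _ → period v
      ; free = λ {v} v∈ 0<i i<p eq → none (lose v∈ (iter-coprime (_⊙ g) (prime⇒coprime p-prime {{ℕ.>-nonZero 0<i}} i<p) (period v) eq)) })))
      where
      open Listing vectors
      period : ∀ v → iter (_⊙ g) p v ≡ v
      period v = trans (iter-⊙-^ᴹ g p v) (trans (cong (v ⊙_) g^p) (⊙-𝟙 v))

  subgroup-^ᴹ : ∀ {H} → IsSubgroup H → ∀ {g} → H g → ∀ n → H (g ^ᴹ n)
  subgroup-^ᴹ (_ , H𝟙 , _) Hg zero = H𝟙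
  subgroup-^ᴹ sub@(_ , _ , H· , _) {g} Hg (suc n) = H· (g ^ᴹ n) g (subgroup-^ᴹ sub Hg n) Hg

  -- The order r of g is a nontrivial divisor of a power of p, so r = m p, and h = g^m has order p.
  p-element⇒transvection : ∀ {T k} → IsSubgroup T → Listing T (p ℕ.^ k) → ∀ g → T g → g ≢ 𝟙 →
    ∃[ v ] ∃[ h ] (v ≢ 𝟎 × h ≢ 𝟙 × T h × Stab v h)
  p-element⇒transvection {T} {k} sub@(inSL , _) L g Tg g≢𝟙 with order sub L g Tg
  ... | r , 0<r , r∣p^k , g^r , least with prime-∣-divisor-of-power p-prime k r∣p^k (λ { refl → g≢𝟙 (trans (sym (·-identityˡ g)) g^r) })
  ... | divides m refl = let v , v≢0 , fix = order-p⇒fixed-vector h (inSL h Th) h^p in v , h , v≢0 , h≢𝟙 , Th , inSL h Th , fix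
    where
    h : Mat
    h = g ^ᴹ m
    Th : T h
    Th = subgroup-^ᴹ sub Tg m
    0<m : 0 ℕ.< m
    0<m = ℕ.n≢0⇒n>0 λ { refl → ℕ.<⇒≢ 0<r refl }
    h≢𝟙 : h ≢ 𝟙
    h≢𝟙 = least m 0<m (ℕ.m<m*n m p {{ℕ.>-nonZero 0<m}} (ℕ.nonTrivial⇒n>1 p {{prime⇒nonTrivial p-prime}}))
    h^p : h ^ᴹ p ≡ 𝟙
    h^p = trans (sym (^ᴹ-* g p m)) (trans (cong (g ^ᴹ_) (ℕ.*-comm p m)) g^r)

  -- T is nontrivial because p divides the group order; the number N that `IsSylow` carries is first
  -- identified with `∣SL∣`.
  Sylow⇒transvection : ∀ {T} → IsSylow p T → ∃[ v ] ∃[ h ] (v ≢ 𝟎 × h ≢ 𝟙 × T h × Stab v h)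
  Sylow⇒transvection {T} (sub , k , N , N-size , T-size , p^∤N) =
    let g , Tg , g∉ = Ml.Listing-avoid (fromHasSize T-size) (𝟙 ∷ []) (1<p^k k p^∤N)
    in p-element⇒transvection {k = k} sub (fromHasSize T-size) g Tg (g∉ ∘ here)
    where
    N≡ : N ≡ ∣SL∣
    N≡ = Listing-size-unique (fromHasSize N-size) SL-listing
    1<p^k : ∀ k → ¬ (p ℕ.^ suc k ∣ N) → 1 ℕ.< p ℕ.^ k
    1<p^k zero p∤N = ⊥-elim (p∤N (subst₂ _∣_ (sym (ℕ.*-identityʳ p)) (sym N≡) p∣∣SL∣))
    1<p^k (suc k) _ = ℕ.≤-trans (ℕ.nonTrivial⇒n>1 p {{prime⇒nonTrivial p-prime}}) (ℕ.m≤m*n p (p ℕ.^ k) {{ℕ.m^n≢0 p k}})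

-- Traces, directions, and subgroups of order q + 1

module Subgroup {q : ℕ} (F : FiniteField q) {p e : ℕ} (p-prime : Prime p) (q≡p^e : q ≡ p ℕ.^ e) (3≤q : 3 ℕ.≤ q) where
  open Sylows F {p} {e} p-prime q≡p^e 3≤q public

  trace : Mat → Carrier
  trace (mat a _ _ d) = a + d

  -- 1 is an eigenvalue, so 0 = det (M - 𝟙) = 2 - trace M. The case split only finds a nonzero
  -- coordinate of v to divide by.
  Stab⇒trace≡2 : ∀ {v M} → v ≢ 𝟎 → Stab v M → trace M ≡ 1# + 1#
  Stab⇒trace≡2 {x , y} {mat a b c d} v≢0 (p , fix) with ,-injective fix | x ≟ 0#
  ... | eq₁ , eq₂ | no x≢0 = *-cancelˡ x≢0 (by-combination₃ (c) (1# + - d) (x) eq₂ eq₁ p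
    (solve 6 (λ x y a b c d → x :* (a :+ d) :+ :- (x :* (:1 :+ :1)) :=
       c :* (x :* b :+ y :* d :+ :- y) :+ (:1 :+ :- d) :* (x :* a :+ y :* c :+ :- x) :+ x :* (a :* d :+ :- (b :* c) :+ :- :1)) refl x y a b c d))
  ... | eq₁ , eq₂ | yes refl = *-cancelˡ (λ y≡0 → v≢0 (cong (0# ,_) y≡0)) (by-combination₃ (1# + - a) b y eq₂ eq₁ p
    (solve 5 (λ y a b c d → y :* (a :+ d) :+ :- (y :* (:1 :+ :1)) :=
       (:1 :+ :- a) :* (:0 :* b :+ y :* d :+ :- y) :+ b :* (:0 :* a :+ y :* c :+ :- :0) :+ y :* (a :* d :+ :- (b :* c) :+ :- :1)) refl y a b c d))

  Independent : V → V → Set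
  Independent (x , y) (x' , y') = x * y' + - (y * x') ≢ 0#

  -- Cramer's rule: each entry times the determinant of (v, w) is a combination of the given
  -- equations.
  fixes-basis⇒𝟙 : ∀ {v w M} → Independent v w → v ⊙ M ≡ v → w ⊙ M ≡ w → M ≡ 𝟙
  fixes-basis⇒𝟙 {x , y} {x' , y'} {mat a b c d} ind fix fix' with ,-injective fix | ,-injective fix'
  ... | eq₁ , eq₂ | eq₁' , eq₂' = mat-≡
    (*-cancelˡ ind (by-combination₂ y' (- y) eq₁ eq₁' (solve 6 (λ x y x' y' a c →
      (x :* y' :+ :- (y :* x')) :* a :+ :- ((x :* y' :+ :- (y :* x')) :* :1) := y' :* (x :* a :+ y :* c :+ :- x) :+ :- y :* (x' :* a :+ y' :* c :+ :- x')) refl x y x' y' a c)))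
    (*-cancelˡ ind (by-combination₂ y' (- y) eq₂ eq₂' (solve 6 (λ x y x' y' b d →
      (x :* y' :+ :- (y :* x')) :* b :+ :- ((x :* y' :+ :- (y :* x')) :* :0) := y' :* (x :* b :+ y :* d :+ :- y) :+ :- y :* (x' :* b :+ y' :* d :+ :- y')) refl x y x' y' b d)))
    (*-cancelˡ ind (by-combination₂ (- x') x eq₁ eq₁' (solve 6 (λ x y x' y' a c →
      (x :* y' :+ :- (y :* x')) :* c :+ :- ((x :* y' :+ :- (y :* x')) :* :0) := :- x' :* (x :* a :+ y :* c :+ :- x) :+ x :* (x' :* a :+ y' :* c :+ :- x')) refl x y x' y' a c)))
    (*-cancelˡ ind (by-combination₂ (- x') x eq₂ eq₂' (solve 6 (λ x y x' y' b d →
      (x :* y' :+ :- (y :* x')) :* d :+ :- ((x :* y' :+ :- (y :* x')) :* :1) := :- x' :* (x :* b :+ y :* d :+ :- y) :+ x :* (x' :* b :+ y' :* d :+ :- y')) refl x y x' y' b d)))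

  Independent-⊙ : ∀ {v w} (g : SL) → Independent v w → Independent (v ⊙ proj₁ g) (w ⊙ proj₁ g)
  Independent-⊙ {x , y} {x' , y'} (mat a b c d , p) ind eq = ind (by-combination₂ 1# (- (x * y' + - (y * x'))) eq p
    (solve 8 (λ x y x' y' a b c d → x :* y' :+ :- (y :* x') :+ :- :0 :=
      :1 :* ((x :* a :+ y :* c) :* (x' :* b :+ y' :* d) :+ :- ((x :* b :+ y :* d) :* (x' :* a :+ y' :* c)) :+ :- :0)
      :+ :- (x :* y' :+ :- (y :* x')) :* (a :* d :+ :- (b :* c) :+ :- :1)) refl x y x' y' a b c d))

  infixr 7 _•_
  _•_ : Carrier → V → V
  λ' • (x , y) = λ' * x , λ' * y

  •-⊙ : ∀ k v M → (k • v) ⊙ M ≡ k • (v ⊙ M)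
  •-⊙ k (x , y) (mat a b c d) = cong₂ _,_ (l k x y a c) (l k x y b d)
    where
    l : ∀ k x y a c → k * x * a + k * y * c ≡ k * (x * a + y * c)
    l = solve 5 (λ k x y a c → k :* x :* a :+ k :* y :* c := k :* (x :* a :+ y :* c)) refl

  •-• : ∀ k l v → k • l • v ≡ (k * l) • v
  •-• k l (x , y) = cong₂ _,_ (sym (*-assoc k l x)) (sym (*-assoc k l y))

  1•v : ∀ v → 1# • v ≡ v
  1•v (x , y) = cong₂ _,_ (*-identityˡ x) (*-identityˡ y)

  •-cancelʳ : ∀ {k l v} → v ≢ 𝟎 → k • v ≡ l • v → k ≡ l
  •-cancelʳ {k} {l} {x , y} v≢0 eq with ,-injective eq | x ≟ 0#
  ... | eq₁ , eq₂ | no x≢0 = *-cancelˡ x≢0 (trans (*-comm x k) (trans eq₁ (*-comm l x)))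
  ... | eq₁ , eq₂ | yes refl = *-cancelˡ (λ y≡0 → v≢0 (cong (0# ,_) y≡0)) (trans (*-comm y k) (trans eq₂ (*-comm l y)))

  •-cancelˡ : ∀ {k v w} → k ≢ 0# → k • v ≡ k • w → v ≡ w
  •-cancelˡ k≢0 eq with ,-injective eq
  ... | eq₁ , eq₂ = cong₂ _,_ (*-cancelˡ k≢0 eq₁) (*-cancelˡ k≢0 eq₂)

  •-≢𝟎 : ∀ {k v} → k ≢ 0# → v ≢ 𝟎 → k • v ≢ 𝟎
  •-≢𝟎 {k} k≢0 v≢0 eq = v≢0 (•-cancelˡ k≢0 (trans eq (sym (cong₂ _,_ (zeroʳ k) (zeroʳ k)))))

  abstract
    det--𝟙 : - 1# * - 1# + - (0# * 0#) ≡ 1#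
    det--𝟙 = solve 0 (:- :1 :* :- :1 :+ :- (:0 :* :0) := :1) refl

  -ε : SL
  -ε = sl (- 1#) 0# 0# (- 1#) det--𝟙

  a²≡1⇒a≡±1 : ∀ {a} → a * a ≡ 1# → a ≡ 1# ⊎ a ≡ - 1#
  a²≡1⇒a≡±1 {a} eq with (a + - 1#) ≟ 0#
  ... | yes a-1≡0 = inj₁ (x-y≡0⇒x≡y a-1≡0)
  ... | no a-1≢0 = inj₂ (*-cancelˡ a-1≢0 (by-combination₁ 1# eq
    (solve 1 (λ a → (a :+ :- :1) :* a :+ :- ((a :+ :- :1) :* :- :1) := :1 :* (a :* a :+ :- :1)) refl a)))

  scalar⇒±ε : ∀ (x : SL) → Mat.b (proj₁ x) ≡ 0# → Mat.c (proj₁ x) ≡ 0# → Mat.a (proj₁ x) ≡ Mat.d (proj₁ x) → x ≡ ε ⊎ x ≡ -ε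
  scalar⇒±ε (mat a _ _ _ , p) refl refl refl with a²≡1⇒a≡±1 {a} (trans (solve 1 (λ a → a :* a := a :* a :+ :- (:0 :* :0)) refl a) p)
  ... | inj₁ refl = inj₁ (SL-≡ refl)
  ... | inj₂ refl = inj₂ (SL-≡ refl)

  upper-conj : ∀ τ (k : SL) → let M = proj₁ k ; N = proj₁ (upper τ ∙ k ∙ upper τ ⁻¹) in
    Mat.a N ≡ Mat.a M + τ * Mat.c M × Mat.c N ≡ Mat.c M × Mat.d N ≡ Mat.d M + - (τ * Mat.c M)
  upper-conj τ (mat a b c d , _) =
    solve 5 (λ τ a b c d → (:1 :* a :+ τ :* c) :* :1 :+ (:1 :* b :+ τ :* d) :* :- :0 := a :+ τ :* c) refl τ a b c d ,
    solve 5 (λ τ a b c d → (:0 :* a :+ :1 :* c) :* :1 :+ (:0 :* b :+ :1 :* d) :* :- :0 := c) refl τ a b c d ,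
    solve 5 (λ τ a b c d → (:0 :* a :+ :1 :* c) :* :- τ :+ (:0 :* b :+ :1 :* d) :* :1 := d :+ :- (τ :* c)) refl τ a b c d

  module SmallSubgroup (S : Mat → Set) (S-sub : IsSubgroup S) (S-listing : Listing S (suc q)) where

    S-∙ : ∀ {x y : SL} → S (proj₁ x) → S (proj₁ y) → S (proj₁ (x ∙ y))
    S-∙ {x} {y} = proj₁ (proj₂ (proj₂ S-sub)) (proj₁ x) (proj₁ y)

    S-⁻¹ : ∀ {x : SL} → S (proj₁ x) → S (proj₁ (x ⁻¹))
    S-⁻¹ {x} = proj₂ (proj₂ (proj₂ S-sub)) (proj₁ x)

    S-ε : S 𝟙
    S-ε = proj₁ (proj₂ S-sub)

    S-InSL : ∀ {M} → S M → InSL M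
    S-InSL {M} = proj₁ S-sub M

    -- Membership in the normal core of S, the largest normal subgroup of SL(2,q) contained in S.
    Core : SL → Set
    Core k = ∀ g → S (proj₁ (g ∙ k ∙ g ⁻¹))

    conj-∙ : ∀ g x y → g ∙ (x ∙ y) ∙ g ⁻¹ ≡ (g ∙ x ∙ g ⁻¹) ∙ (g ∙ y ∙ g ⁻¹)
    conj-∙ g x y = sym (begin
      (g ∙ x ∙ g ⁻¹) ∙ (g ∙ y ∙ g ⁻¹)     ≡⟨ assoc _ _ _ ⟨
      (g ∙ x ∙ g ⁻¹) ∙ (g ∙ y) ∙ g ⁻¹     ≡⟨ cong (_∙ g ⁻¹) (assoc _ _ _) ⟨
      (g ∙ x ∙ g ⁻¹) ∙ g ∙ y ∙ g ⁻¹       ≡⟨ cong (λ t → t ∙ y ∙ g ⁻¹) (xy⁻¹y (g ∙ x) g) ⟩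
      g ∙ x ∙ y ∙ g ⁻¹                    ≡⟨ cong (_∙ g ⁻¹) (assoc g x y) ⟩
      g ∙ (x ∙ y) ∙ g ⁻¹                  ∎)
      where open ≡-Reasoning

    conj-⁻¹ : ∀ g x → g ∙ x ⁻¹ ∙ g ⁻¹ ≡ (g ∙ x ∙ g ⁻¹) ⁻¹
    conj-⁻¹ g x = inverseˡ-unique _ _ (trans (sym (conj-∙ g (x ⁻¹) x)) (trans (cong (λ t → g ∙ t ∙ g ⁻¹) (inverseˡ x)) (trans (cong (_∙ g ⁻¹) (identityʳ g)) (inverseʳ g))))

    conj-conj : ∀ g h x → g ∙ (h ∙ x ∙ h ⁻¹) ∙ g ⁻¹ ≡ (g ∙ h) ∙ x ∙ (g ∙ h) ⁻¹
    conj-conj g h x = begin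
      g ∙ (h ∙ x ∙ h ⁻¹) ∙ g ⁻¹         ≡⟨ cong (_∙ g ⁻¹) (assoc g (h ∙ x) (h ⁻¹)) ⟨
      g ∙ (h ∙ x) ∙ h ⁻¹ ∙ g ⁻¹         ≡⟨ assoc _ _ _ ⟩
      g ∙ (h ∙ x) ∙ (h ⁻¹ ∙ g ⁻¹)       ≡⟨ cong₂ _∙_ (sym (assoc g h x)) (sym (⁻¹-anti-homo-∙ g h)) ⟩
      (g ∙ h) ∙ x ∙ (g ∙ h) ⁻¹          ∎
      where open ≡-Reasoning

    Core-∙ : ∀ {x y} → Core x → Core y → Core (x ∙ y)
    Core-∙ {x} {y} cx cy g = subst (S ∘ proj₁) (sym (conj-∙ g x y)) (S-∙ {g ∙ x ∙ g ⁻¹} {g ∙ y ∙ g ⁻¹} (cx g) (cy g))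

    Core-⁻¹ : ∀ {x} → Core x → Core (x ⁻¹)
    Core-⁻¹ {x} cx g = subst (S ∘ proj₁) (sym (conj-⁻¹ g x)) (S-⁻¹ {g ∙ x ∙ g ⁻¹} (cx g))

    Core-conj : ∀ {x} h → Core x → Core (h ∙ x ∙ h ⁻¹)
    Core-conj {x} h cx g = subst (S ∘ proj₁) (sym (conj-conj g h x)) (cx (g ∙ h))

    upper-conjugates : (k : SL) → Mat.c (proj₁ k) ≢ 0# →
      Listing (λ M → ∃[ τ ] (⊤ × M ≡ proj₁ (upper τ ∙ k ∙ upper τ ⁻¹))) q
    upper-conjugates k c≢0 = Listing-map _ (λ {τ} {τ'} _ _ eq → *-cancelˡ c≢0
      (by-combination₁ 1# (trans (sym (proj₁ (upper-conj τ k))) (trans (cong Mat.a eq) (proj₁ (upper-conj τ' k))))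
        (solve 4 (λ a c τ τ' → c :* τ :+ :- (c :* τ') := :1 :* (a :+ τ :* c :+ :- (a :+ τ' :* c))) refl (Mat.a (proj₁ k)) (Mat.c (proj₁ k)) τ τ'))) elements

    -- Conjugating by upper unitriangular matrices gives q elements of S for each of two
    -- lower left entries, which is too many.
    Core⇒c≡0 : ∀ k → Core k → Mat.c (proj₁ k) ≡ 0#
    Core⇒c≡0 k core with Mat.c (proj₁ k) ≟ 0#
    ... | yes c≡0 = c≡0
    ... | no c≢0 = ⊥-elim (ℕ.<⇒≱ (ℕ.≤-trans (s≤s (s≤s z≤n)) 3≤q) (ℕ.+-cancelˡ-≤ q q 1 (subst (q ℕ.+ q ℕ.≤_) (ℕ.+-comm 1 q)
          (Listing-≤ (Listing-⊎ disjoint (upper-conjugates k c≢0) (upper-conjugates k₂ (λ eq → c₂≢0 (trans (sym c-k₂) eq)))) S-listing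
            λ { (inj₁ (τ , _ , refl)) → core (upper τ) ; (inj₂ (τ , _ , refl)) → core₂ (upper τ) }))))
      where
      c : Carrier
      c = Mat.c (proj₁ k)
      c₂ : Carrier
      c₂ = proj₁ (avoid₂ 0# c)
      c₂≢0 : c₂ ≢ 0#
      c₂≢0 = proj₁ (proj₂ (avoid₂ 0# c))
      -- The commutator of `upper σ` and k has lower left entry σ c²; this σ makes it the second
      -- value c₂.
      σ : Carrier
      σ = c₂ * (recip c * recip c)
      k₂ : SL
      k₂ = (upper σ ∙ k ∙ upper σ ⁻¹) ∙ k ⁻¹
      core₂ : Core k₂
      core₂ = Core-∙ {upper σ ∙ k ∙ upper σ ⁻¹} {k ⁻¹} (Core-conj {k} (upper σ) core) (Core-⁻¹ {k} core)
      c-k₂ : Mat.c (proj₁ k₂) ≡ c₂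
      c-k₂ = trans
        (cong₂ (λ s t → s * Mat.d (proj₁ k) + t * - c) (proj₁ (proj₂ (upper-conj σ k))) (proj₂ (proj₂ (upper-conj σ k))))
        (by-combination₁ (c₂ * (1# + c * recip c)) (*-recip c≢0)
          (solve 4 (λ c d c₂ r → c :* d :+ (d :+ :- ((c₂ :* (r :* r)) :* c)) :* :- c :+ :- c₂ := c₂ :* (:1 :+ c :* r) :* (c :* r :+ :- :1)) refl c (Mat.d (proj₁ k)) c₂ (recip c)))
      disjoint : ∀ {M} → ∃[ τ ] (⊤ × M ≡ proj₁ (upper τ ∙ k ∙ upper τ ⁻¹)) → ∃[ τ ] (⊤ × M ≡ proj₁ (upper τ ∙ k₂ ∙ upper τ ⁻¹)) → ⊥
      disjoint (τ , _ , refl) (τ' , _ , eq) = proj₂ (proj₂ (avoid₂ 0# c))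
        (sym (trans (sym (proj₁ (proj₂ (upper-conj τ k)))) (trans (cong Mat.c eq) (trans (proj₁ (proj₂ (upper-conj τ' k₂))) c-k₂))))

    -- `Core⇒c≡0` also applies to conjugates of k: the conjugate by `weyl` gives b = 0 and the one
    -- by `lower 1#` gives a = d, so k is scalar.
    Core⇒±ε : ∀ k → Core k → k ≡ ε ⊎ k ≡ -ε
    Core⇒±ε k@(mat a b c d , _) core = scalar⇒±ε k b≡0 c≡0 a≡d
      where
      c≡0 : c ≡ 0#
      c≡0 = Core⇒c≡0 k core
      weyl : SL
      weyl = sl 0# 1# (- 1#) 0# (solve 0 (:0 :* :0 :+ :- (:1 :* :- :1) := :1) refl)
      b≡0 : b ≡ 0#
      b≡0 = by-combination₁ (- 1#) (Core⇒c≡0 (weyl ∙ k ∙ weyl ⁻¹) (Core-conj {k} weyl core))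
        (solve 4 (λ a b c d → b :+ :- :0 := :- :1 :* ((:- :1 :* a :+ :0 :* c) :* :0 :+ (:- :1 :* b :+ :0 :* d) :* :- (:- :1) :+ :- :0)) refl a b c d)
      a≡d : a ≡ d
      a≡d = by-combination₃ 1# 1# (- 1#) (Core⇒c≡0 (lower 1# ∙ k ∙ lower 1# ⁻¹) (Core-conj {k} (lower 1#) core)) b≡0 c≡0
        (solve 4 (λ a b c d → a :+ :- d := :1 :* ((:1 :* a :+ :1 :* c) :* :1 :+ (:1 :* b :+ :1 :* d) :* :- :1 :+ :- :0) :+ :1 :* (b :+ :- :0) :+ :- :1 :* (c :+ :- :0)) refl a b c d)

    -- Odd characteristic: -𝟙 is the only involution and lies in S

    module OddCharacteristic (2≢0 : 1# + 1# ≢ 0#) where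

      x+x≡0⇒x≡0 : ∀ {x} → x + x ≡ 0# → x ≡ 0#
      x+x≡0⇒x≡0 {x} eq = no-zero-divisors 2≢0 (trans (solve 1 (λ x → (:1 :+ :1) :* x := x :+ x) refl x) eq)

      -- Inversion swaps the diagonal entries and negates the others, so an x fixed by it is scalar.
      involution⇒±ε : ∀ x → x ⁻¹ ≡ x → x ≡ ε ⊎ x ≡ -ε
      involution⇒±ε x@(mat a b c d , _) eq = scalar⇒±ε x
        (x+x≡0⇒x≡0 (by-combination₁ (- 1#) (cong (Mat.b ∘ proj₁) eq) (solve 1 (λ b → b :+ b :+ :- :0 := :- :1 :* (:- b :+ :- b)) refl b)))
        (x+x≡0⇒x≡0 (by-combination₁ (- 1#) (cong (Mat.c ∘ proj₁) eq) (solve 1 (λ b → b :+ b :+ :- :0 := :- :1 :* (:- b :+ :- b)) refl c)))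
        (sym (cong (Mat.a ∘ proj₁) eq))

      -ε≢ε : -ε ≢ ε
      -ε≢ε eq = 2≢0 (by-combination₁ (- 1#) (cong (Mat.a ∘ proj₁) eq) (solve 0 (:1 :+ :1 :+ :- :0 := :- :1 :* (:- :1 :+ :- :1)) refl))

      -- Otherwise 2 = -2, that is, 4 = 0. This separates -M from the p-elements when M has trace 2.
      trace-neg≢2 : ∀ {M} → trace M ≡ 1# + 1# → trace (M · proj₁ -ε) ≢ 1# + 1#
      trace-neg≢2 {mat a b c d} tr eq = 2≢0 (x+x≡0⇒x≡0 (by-combination₂ (- 1#) (- 1#) tr eq
        (solve 4 (λ a b c d → :1 :+ :1 :+ (:1 :+ :1) :+ :- :0 := :- :1 :* (a :+ d :+ :- (:1 :+ :1)) :+ :- :1 :* (a :* :- :1 :+ b :* :0 :+ (c :* :0 :+ d :* :- :1) :+ :- (:1 :+ :1))) refl a b c d)))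

      -ε∉Stab : ∀ {v} → v ≢ 𝟎 → ¬ Stab v (proj₁ -ε)
      -ε∉Stab v≢0 fix = trace-neg≢2 {𝟙} refl (trans (cong trace (·-identityˡ (proj₁ -ε))) (Stab⇒trace≡2 {M = proj₁ -ε} v≢0 fix))

      -ε∙-ε≡ε : -ε ∙ -ε ≡ ε
      -ε∙-ε≡ε = SL-≡ (mat-≡ (solve 0 (:- :1 :* :- :1 :+ :0 :* :0 := :1) refl) (solve 0 (:- :1 :* :0 :+ :0 :* :- :1 := :0) refl)
        (solve 0 (:0 :* :- :1 :+ :- :1 :* :0 := :0) refl) (solve 0 (:0 :* :0 :+ :- :1 :* :- :1 := :1) refl))

      monomorphism-fixes--ε : (f : SL → SL) → (∀ x y → f (x ∙ y) ≡ f x ∙ f y) → (∀ {x y} → f x ≡ f y → x ≡ y) → f ε ≡ ε → f -ε ≡ -ε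
      monomorphism-fixes--ε f f-∙ f-injective f-ε = [ (λ eq → ⊥-elim (-ε≢ε (f-injective { -ε} {ε} (trans eq (sym f-ε))))) , id ]′
        (involution⇒±ε (f -ε) (sym (inverseˡ-unique (f -ε) (f -ε) (trans (sym (f-∙ -ε -ε)) (trans (cong f -ε∙-ε≡ε) f-ε)))))

      2∣q-1 : 2 ∣ q-1
      2∣q-1 = subst (2 ∣_) size (Finite.semiregular⇒∣length _≟_ (-_) 2 unique record
        { closed = λ x∈ → complete (_ , x≢0⇒-x≢0 (proj₂ (sound x∈)))
        ; period = λ {x} _ → solve 1 (λ x → :- (:- x) := x) refl x
        ; free = λ { {x} {1} x∈ _ _ eq → proj₂ (sound x∈) (x+x≡0⇒x≡0 (by-combination₁ (- 1#) eq (solve 1 (λ x → x :+ x :+ :- :0 := :- :1 :* (:- x :+ :- x)) refl x)))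
                   ; {x} {suc (suc _)} _ _ (s≤s (s≤s ())) _ } })
        where open Listing units

      -- Otherwise inversion would pair off the q elements of S other than 𝟙, making q even, whereas
      -- negation already pairs off the q - 1 nonzero scalars.
      -ε∈S : S (proj₁ -ε)
      -ε∈S with Ml.Listing-dec S-listing (proj₁ -ε)
      ... | yes s = s
      ... | no -ε∉S = ⊥-elim (contra (∣m+n∣m⇒∣n (subst (2 ∣_) (trans q≡1+q-1 (ℕ.+-comm 1 q-1)) 2∣q) 2∣q-1))
        where
        contra : ¬ (2 ∣ 1)
        contra 2∣1 with ∣1⇒≡1 2∣1
        ... | ()
        S∖𝟙 : Listing (λ M → S M × M ≢ 𝟙) q
        S∖𝟙 = Ml.Listing-remove S-ε S-listing
        2∣q : 2 ∣ q
        2∣q = subst (2 ∣_) size (Finite.semiregular⇒∣length _≟ᴹ_ inv 2 unique record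
          { closed = λ {M} M∈ → let s , M≢𝟙 = sound M∈ ; x = M , S-InSL s in
              complete (S-⁻¹ {x} s , λ eq → M≢𝟙 (cong proj₁ (⁻¹-injective {x} {ε} (trans (SL-≡ eq) (sym ε⁻¹≈ε)))))
          ; period = λ {M} M∈ → cong proj₁ (⁻¹-involutive (M , S-InSL (proj₁ (sound M∈))))
          ; free = λ { {M} {1} M∈ _ _ eq → no-involution M∈ eq ; {x} {suc (suc _)} _ _ (s≤s (s≤s ())) _ } })
          where
          open Listing S∖𝟙
          no-involution : ∀ {M} → M ∈ list → inv M ≢ M
          no-involution {M} M∈ eq = [ (λ M≡ε → proj₂ (sound M∈) (cong proj₁ M≡ε)) ,
                                      (λ M≡-ε → -ε∉S (subst S (cong proj₁ M≡-ε) (proj₁ (sound M∈)))) ]′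
            (involution⇒±ε (M , S-InSL (proj₁ (sound M∈))) (SL-≡ eq))

    -- Even characteristic: S is abelian and acts sharply transitively on directions

    module EvenCharacteristic (2≡0 : 1# + 1# ≡ 0#)
      (S∩Stab : ∀ {v M} → v ≢ 𝟎 → S M → v ⊙ M ≡ v → M ≡ 𝟙) where

      -x≡x : ∀ x → - x ≡ x
      -x≡x x = by-combination₁ (- x) 2≡0 (solve 1 (λ x → :- x :+ :- x := :- x :* (:1 :+ :1 :+ :- :0)) refl x)

      Core⇒ε : ∀ k → Core k → k ≡ ε
      Core⇒ε k core = [ id , (λ eq → trans eq (SL-≡ (mat-≡ (-x≡x 1#) refl refl (-x≡x 1#)))) ]′ (Core⇒±ε k core)

      -- The trace is 2 = 0, so the diagonal entries agree and signs do not matter.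
      Stab-involution : ∀ {v} x → v ≢ 𝟎 → v ⊙ proj₁ x ≡ v → x ⁻¹ ≡ x
      Stab-involution (mat a b c d , p) v≢0 fix = SL-≡ (mat-≡
        (by-combination₂ (1#) (1# + - a) tr 2≡0 (solve 2 (λ a d → d :+ :- a := :1 :* (a :+ d :+ :- (:1 :+ :1)) :+ (:1 :+ :- a) :* (:1 :+ :1 :+ :- :0)) refl a d))
        (-x≡x b) (-x≡x c)
        (by-combination₂ (1#) (1# + - d) tr 2≡0 (solve 2 (λ a d → a :+ :- d := :1 :* (a :+ d :+ :- (:1 :+ :1)) :+ (:1 :+ :- d) :* (:1 :+ :1 :+ :- :0)) refl a d)))
        where
        tr : a + d ≡ 1# + 1#
        tr = Stab⇒trace≡2 {M = mat a b c d} v≢0 (p , fix)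

      -- The translation x ↦ 1 + x pairs off the field elements.
      2∣q : 2 ∣ q
      2∣q = subst (2 ∣_) size (Finite.semiregular⇒∣length _≟_ (1# +_) 2 unique record
        { closed = λ _ → complete _
        ; period = λ {x} _ → by-combination₁ 1# 2≡0 (solve 1 (λ x → :1 :+ (:1 :+ x) :+ :- x := :1 :* (:1 :+ :1 :+ :- :0)) refl x)
        ; free = λ { {x} {1} _ _ _ eq → 0≢1 (sym (by-combination₁ 1# eq (solve 1 (λ x → :1 :+ :- :0 := :1 :* (:1 :+ x :+ :- x)) refl x)))
                   ; {x} {suc (suc _)} _ _ (s≤s (s≤s ())) _ } })
        where open Listing elements

      _⊕_ : Mat → Mat → Mat
      mat a b c d ⊕ mat a' b' c' d' = mat (a + a') (b + b') (c + c') (d + d')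

      𝟘 : Mat
      𝟘 = mat 0# 0# 0# 0#

      Σᴹ : (Mat → Mat) → List Mat → Mat
      Σᴹ f [] = 𝟘
      Σᴹ f (M ∷ Ms) = f M ⊕ Σᴹ f Ms

      ·-⊕ : ∀ L M N → L · (M ⊕ N) ≡ (L · M) ⊕ (L · N)
      ·-⊕ (mat a b c d) (mat a' b' c' d') (mat x y z w) = mat-≡ (l a b a' c' x z) (l a b b' d' y w) (l c d a' c' x z) (l c d b' d' y w)
        where
        l : ∀ a b a' c' x z → a * (a' + x) + b * (c' + z) ≡ (a * a' + b * c') + (a * x + b * z)
        l = solve 6 (λ a b a' c' x z → a :* (a' :+ x) :+ b :* (c' :+ z) := (a :* a' :+ b :* c') :+ (a :* x :+ b :* z)) refl

      ⊕-· : ∀ M N L → (M ⊕ N) · L ≡ (M · L) ⊕ (N · L)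
      ⊕-· (mat a' b' c' d') (mat x y z w) (mat a b c d) = mat-≡ (l a' b' x y a c) (l a' b' x y b d) (l c' d' z w a c) (l c' d' z w b d)
        where
        l : ∀ a' b' x y a c → (a' + x) * a + (b' + y) * c ≡ (a' * a + b' * c) + (x * a + y * c)
        l = solve 6 (λ a' b' x y a c → (a' :+ x) :* a :+ (b' :+ y) :* c := (a' :* a :+ b' :* c) :+ (x :* a :+ y :* c)) refl

      ⊕-swap : ∀ L M N → L ⊕ (M ⊕ N) ≡ M ⊕ (L ⊕ N)
      ⊕-swap (mat a b c d) (mat a' b' c' d') (mat x y z w) = mat-≡ (l a a' x) (l b b' y) (l c c' z) (l d d' w)
        where
        l : ∀ a b c → a + (b + c) ≡ b + (a + c)
        l = solve 3 (λ a b c → a :+ (b :+ c) := b :+ (a :+ c)) refl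

      ·-𝟘 : ∀ M → M · 𝟘 ≡ 𝟘
      ·-𝟘 (mat a b c d) = mat-≡ (l a b) (l a b) (l c d) (l c d)
        where
        l : ∀ a b → a * 0# + b * 0# ≡ 0#
        l = solve 2 (λ a b → a :* :0 :+ b :* :0 := :0) refl

      𝟘-· : ∀ M → 𝟘 · M ≡ 𝟘
      𝟘-· (mat a b c d) = mat-≡ (l a c) (l b d) (l a c) (l b d)
        where
        l : ∀ a b → 0# * a + 0# * b ≡ 0#
        l = solve 2 (λ a b → :0 :* a :+ :0 :* b := :0) refl

      Σᴹ-↭ : ∀ f {xs ys} → xs ↭ ys → Σᴹ f xs ≡ Σᴹ f ys
      Σᴹ-↭ f ↭.refl = refl
      Σᴹ-↭ f (↭.prep x r) = cong (f x ⊕_) (Σᴹ-↭ f r)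
      Σᴹ-↭ f (↭.swap x y r) = trans (cong (λ t → f x ⊕ (f y ⊕ t)) (Σᴹ-↭ f r)) (⊕-swap (f x) (f y) _)
      Σᴹ-↭ f (↭.trans r r') = trans (Σᴹ-↭ f r) (Σᴹ-↭ f r')

      -- A projection of trace 1; any other matrix of trace 1 would serve as well as the seed of the
      -- average.
      E : Mat
      E = mat 1# 0# 0# 0#

      conjE : Mat → Mat
      conjE M = (M · E) · inv M

      trace-conjE : ∀ M → trace (conjE M) ≡ det M
      trace-conjE (mat a b c d) = solve 4 (λ a b c d →
        (a :* :1 :+ b :* :0) :* d :+ (a :* :0 :+ b :* :0) :* :- c :+ ((c :* :1 :+ d :* :0) :* :- b :+ (c :* :0 :+ d :* :0) :* a) := a :* d :+ :- (b :* c)) refl a b c d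

      average : Mat
      average = Σᴹ conjE (Listing.list S-listing)

      conjE-· : ∀ {M N} → InSL M → M · conjE N ≡ conjE (M · N) · M
      conjE-· {M} {N} p = sym (begin
        conjE (M · N) · M                              ≡⟨ cong (λ t → (((M · N) · E) · t) · M) inv-· ⟩
        (((M · N) · E) · (inv N · inv M)) · M          ≡⟨ ·-assoc _ _ _ ⟩
        ((M · N) · E) · ((inv N · inv M) · M)          ≡⟨ cong (((M · N) · E) ·_) (·-assoc (inv N) (inv M) M) ⟩
        ((M · N) · E) · (inv N · (inv M · M))          ≡⟨ cong (λ t → ((M · N) · E) · (inv N · t)) (inv-·-inverseˡ M p) ⟩
        ((M · N) · E) · (inv N · 𝟙)                    ≡⟨ cong (((M · N) · E) ·_) (·-identityʳ (inv N)) ⟩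
        ((M · N) · E) · inv N                          ≡⟨ cong (_· inv N) (·-assoc M N E) ⟩
        (M · (N · E)) · inv N                          ≡⟨ ·-assoc M (N · E) (inv N) ⟩
        M · conjE N                                    ∎)
        where
        open ≡-Reasoning
        inv-· : inv (M · N) ≡ inv N · inv M
        inv-· = go M N
          where
          l₁ : ∀ c d b' d' → c * b' + d * d' ≡ d' * d + - b' * - c
          l₁ = solve 4 (λ c d b' d' → c :* b' :+ d :* d' := d' :* d :+ :- b' :* :- c) refl
          l₂ : ∀ a b b' d' → - (a * b' + b * d') ≡ d' * - b + - b' * a
          l₂ = solve 4 (λ a b b' d' → :- (a :* b' :+ b :* d') := d' :* :- b :+ :- b' :* a) refl
          l₃ : ∀ c d a' c' → - (c * a' + d * c') ≡ - c' * d + a' * - c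
          l₃ = solve 4 (λ c d a' c' → :- (c :* a' :+ d :* c') := :- c' :* d :+ a' :* :- c) refl
          l₄ : ∀ a b a' c' → a * a' + b * c' ≡ - c' * - b + a' * a
          l₄ = solve 4 (λ a b a' c' → a :* a' :+ b :* c' := :- c' :* :- b :+ a' :* a) refl
          go : ∀ M N → inv (M · N) ≡ inv N · inv M
          go (mat a b c d) (mat a' b' c' d') = mat-≡ (l₁ c d b' d') (l₂ a b b' d') (l₃ c d a' c') (l₄ a b a' c')

      -- Two duplicate-free lists with the same members are permutations of each other.
      translate-↭ : ∀ {M} → S M → map (M ·_) (Listing.list S-listing) ↭ Listing.list S-listing
      translate-↭ {M} SM = ∼bag⇒↭ (unique∧set⇒bag
        (map-unique (M ·_) (λ {x} {y} x∈ y∈ eq → cong proj₁ (∙-cancelˡ m (x , S-InSL (sound x∈)) (y , S-InSL (sound y∈)) (SL-≡ eq))) unique)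
        unique
        (λ {N} → mk⇔ to from))
        where
        open Listing S-listing
        m : SL
        m = M , S-InSL SM
        to : ∀ {N} → N ∈ map (M ·_) list → N ∈ list
        to N∈ with ∈-map⁻ (M ·_) N∈
        ... | L , L∈ , refl = complete (S-∙ {m} {L , S-InSL (sound L∈)} SM (sound L∈))
        from : ∀ {N} → N ∈ list → N ∈ map (M ·_) list
        from {N} N∈ = subst (_∈ map (M ·_) list) (cong proj₁ (trans (sym (assoc m (m ⁻¹) n)) (trans (cong (_∙ n) (inverseʳ m)) (identityˡ n))))
          (∈-map⁺ (M ·_) (complete (S-∙ {m ⁻¹} {n} (S-⁻¹ {m} SM) (sound N∈))))
          where
          n : SL
          n = N , S-InSL (sound N∈)

      average-central : ∀ {M} → S M → M · average ≡ average · M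
      average-central {M} SM = trans (go (Listing.list S-listing)) (cong (_· M) (Σᴹ-↭ conjE (translate-↭ SM)))
        where
        go : ∀ Ns → M · Σᴹ conjE Ns ≡ Σᴹ conjE (map (M ·_) Ns) · M
        go [] = trans (·-𝟘 M) (sym (𝟘-· M))
        go (N ∷ Ns) = trans (·-⊕ M (conjE N) (Σᴹ conjE Ns)) (trans (cong₂ _⊕_ (conjE-· (S-InSL SM)) (go Ns)) (sym (⊕-· _ _ M)))

      -- Every conjugate of `E` by an element of S contributes 1, and q + 1 ones add up to 1 because
      -- q is even.
      trace-average : trace average ≡ 1#
      trace-average = trans (go (Listing.list S-listing) (λ M∈ → S-InSL (Listing.sound S-listing M∈)))
        (trans (cong count (Listing.size S-listing)) (trans (cong (1# +_) (even 2∣q)) (+-identityʳ 1#)))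
        where
        count : ℕ → Carrier
        count zero = 0#
        count (suc n) = 1# + count n
        trace-⊕ : ∀ M N → trace (M ⊕ N) ≡ trace M + trace N
        trace-⊕ (mat a b c d) (mat a' b' c' d') = solve 4 (λ a d a' d' → a :+ a' :+ (d :+ d') := a :+ d :+ (a' :+ d')) refl a d a' d'
        go : ∀ Ms → (∀ {M} → M ∈ Ms → InSL M) → trace (Σᴹ conjE Ms) ≡ count (length Ms)
        go [] _ = +-identityʳ 0#
        go (M ∷ Ms) inSL = trans (trace-⊕ (conjE M) (Σᴹ conjE Ms)) (cong₂ _+_ (trans (trace-conjE M) (inSL (here refl))) (go Ms (inSL ∘ there)))
        even : ∀ {n} → 2 ∣ n → count n ≡ 0#
        even (divides zero refl) = refl
        even (divides (suc k) refl) = trans (sym (+-assoc 1# 1# _)) (trans (cong₂ _+_ 2≡0 (even (divides k refl))) (+-identityʳ 0#))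

      -- In characteristic 2 a matrix of trace 1 is not scalar, so its centralizer is commutative.
      centralizer-commutative : ∀ {L M N} → trace L ≡ 1# → M · L ≡ L · M → N · L ≡ L · N → M · N ≡ N · M
      centralizer-commutative {mat x y z w} {mat a b c d} {mat a' b' c' d'} tr eq eq' = go (offdiag a b c d eq) (offdiag a' b' c' d' eq')
        where
        -- With x + w = 1 and signs irrelevant, the off-diagonal entries of the commutation relation
        -- give those of the commuting matrix as a + d times those of L. Two such matrices then
        -- commute.
        offdiag : ∀ a b c d → mat a b c d · mat x y z w ≡ mat x y z w · mat a b c d → b ≡ (a + d) * y × c ≡ (a + d) * z
        offdiag a b c d eq =
          by-combination₃ (- b) (- 1#) (b * w + - (y * d)) tr (cong Mat.b eq) 2≡0
            (solve 7 (λ a b c d x y w → b :+ :- ((a :+ d) :* y) := :- b :* (x :+ w :+ :- :1) :+ :- :1 :* (a :* y :+ b :* w :+ :- (x :* b :+ y :* d)) :+ (b :* w :+ :- (y :* d)) :* (:1 :+ :1 :+ :- :0)) refl a b c d x y w) ,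
          by-combination₃ (- c) 1# (c * w + - (d * z)) tr (cong Mat.c eq) 2≡0
            (solve 6 (λ a c d x z w → c :+ :- ((a :+ d) :* z) := :- c :* (x :+ w :+ :- :1) :+ :1 :* (c :* x :+ d :* z :+ :- (z :* a :+ w :* c)) :+ (c :* w :+ :- (d :* z)) :* (:1 :+ :1 :+ :- :0)) refl a c d x z w)
        go : b ≡ (a + d) * y × c ≡ (a + d) * z → b' ≡ (a' + d') * y × c' ≡ (a' + d') * z → mat a b c d · mat a' b' c' d' ≡ mat a' b' c' d' · mat a b c d
        go (refl , refl) (refl , refl) = mat-≡
          (solve 6 (λ a d a' d' y z → a :* a' :+ (a :+ d) :* y :* ((a' :+ d') :* z) := a' :* a :+ (a' :+ d') :* y :* ((a :+ d) :* z)) refl a d a' d' y z)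
          (by-combination₁ ((a * d' + - (a' * d)) * y) 2≡0 (solve 5 (λ a d a' d' y → a :* ((a' :+ d') :* y) :+ (a :+ d) :* y :* d' :+ :- (a' :* ((a :+ d) :* y) :+ (a' :+ d') :* y :* d) := (a :* d' :+ :- (a' :* d)) :* y :* (:1 :+ :1 :+ :- :0)) refl a d a' d' y))
          (by-combination₁ ((d * a' + - (d' * a)) * z) 2≡0 (solve 5 (λ a d a' d' y → (a :+ d) :* y :* a' :+ d :* ((a' :+ d') :* y) :+ :- ((a' :+ d') :* y :* a :+ d' :* ((a :+ d) :* y)) := (d :* a' :+ :- (d' :* a)) :* y :* (:1 :+ :1 :+ :- :0)) refl a d a' d' z))
          (solve 6 (λ a d a' d' y z → (a :+ d) :* z :* ((a' :+ d') :* y) :+ d :* d' := (a' :+ d') :* z :* ((a :+ d) :* y) :+ d' :* d) refl a d a' d' y z)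

      S-commutative : ∀ {x y : SL} → S (proj₁ x) → S (proj₁ y) → x ∙ y ≡ y ∙ x
      S-commutative Sx Sy = SL-≡ (centralizer-commutative trace-average (average-central Sx) (average-central Sy))

      eigenvector-power : ∀ {v M μ} → v ⊙ M ≡ μ • v → ∀ n → v ⊙ M ^ᴹ n ≡ iter (μ *_) n 1# • v
      eigenvector-power {v} eq zero = trans (⊙-𝟙 v) (sym (1•v v))
      eigenvector-power {v} {M} {μ} eq (suc n) = begin
        v ⊙ (M ^ᴹ n · M)                     ≡⟨ ⊙-· v (M ^ᴹ n) M ⟩
        v ⊙ M ^ᴹ n ⊙ M                       ≡⟨ cong (_⊙ M) (eigenvector-power eq n) ⟩
        (μⁿ • v) ⊙ M                         ≡⟨ •-⊙ μⁿ v M ⟩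
        μⁿ • (v ⊙ M)                         ≡⟨ cong (μⁿ •_) eq ⟩
        μⁿ • μ • v                           ≡⟨ •-• μⁿ μ v ⟩
        (μⁿ * μ) • v                         ≡⟨ cong (_• v) (*-comm μⁿ μ) ⟩
        (μ * μⁿ) • v                         ∎
        where
        open ≡-Reasoning
        μⁿ : Carrier
        μⁿ = iter (μ *_) n 1#

      unit-order : ∀ μ → μ ≢ 0# →
        ∃[ r ] (0 ℕ.< r × r ∣ q-1 × iter (μ *_) r 1# ≡ 1# × (∀ i → 0 ℕ.< i → i ℕ.< r → iter (μ *_) i 1# ≢ 1#))
      unit-order μ μ≢0 =
        let r , 0<r , r∣ , period , free = Fl.semiregular-period (μ *_) {P = λ x → ⊤ × x ≢ 0#} units
              (λ (_ , x≢0) → tt , λ eq → x≢0 (no-zero-divisors μ≢0 eq)) (λ _ _ → *-cancelˡ μ≢0) uniform (1# , tt , 0≢1 ∘ sym)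
        in r , 0<r , r∣ , period {1#} (tt , 0≢1 ∘ sym) , λ i → free {1#} i (tt , 0≢1 ∘ sym)
        where
        iter-scale : ∀ i x → iter (μ *_) i x ≡ x * iter (μ *_) i 1#
        iter-scale zero x = sym (*-identityʳ x)
        iter-scale (suc i) x = trans (cong (μ *_) (iter-scale i x)) (solve 3 (λ m x y → m :* (x :* y) := x :* (m :* y)) refl μ x (iter (μ *_) i 1#))
        uniform : ∀ i {x y} → ⊤ × x ≢ 0# → ⊤ × y ≢ 0# → iter (μ *_) i x ≡ x → iter (μ *_) i y ≡ y
        uniform i {x} {y} (_ , x≢0) _ eq = trans (iter-scale i y) (trans (cong (y *_)
          (*-cancelˡ x≢0 (trans (sym (iter-scale i x)) (trans eq (sym (*-identityʳ x)))))) (*-identityʳ y))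

      -- An element of S with an eigenvector has order dividing gcd(q + 1, q − 1) = 1.
      S-eigenvector⇒𝟙 : ∀ {v M μ} → v ≢ 𝟎 → S M → v ⊙ M ≡ μ • v → M ≡ 𝟙
      S-eigenvector⇒𝟙 {v} {M} {μ} v≢0 SM eq = conclude (order S-sub S-listing M SM) (unit-order μ μ≢0)
        where
        μ≢0 : μ ≢ 0#
        μ≢0 refl = ⊙-≢𝟎 (M , S-InSL SM) v≢0 (trans eq (cong₂ _,_ (zeroˡ _) (zeroˡ _)))
        conclude : ∃[ r ] (0 ℕ.< r × r ∣ suc q × M ^ᴹ r ≡ 𝟙 × (∀ i → 0 ℕ.< i → i ℕ.< r → M ^ᴹ i ≢ 𝟙)) →
          ∃[ r ] (0 ℕ.< r × r ∣ q-1 × iter (μ *_) r 1# ≡ 1# × (∀ i → 0 ℕ.< i → i ℕ.< r → iter (μ *_) i 1# ≢ 1#)) → M ≡ 𝟙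
        conclude (r , 0<r , r∣q+1 , M^r , r-least) (r' , 0<r' , r'∣q-1 , μ^r' , r'-least) =
          trans (sym (·-identityˡ M)) (subst (λ n → M ^ᴹ n ≡ 𝟙) r≡1 M^r)
          where
          μ^r : iter (μ *_) r 1# ≡ 1#
          μ^r = •-cancelʳ v≢0 (trans (sym (eigenvector-power eq r)) (trans (cong (v ⊙_) M^r) (trans (⊙-𝟙 v) (sym (1•v v)))))
          -- This power of M lies in S and fixes v, and S meets the stabilizer of v trivially. So M
          -- and its eigenvalue μ have the same order.
          M^r' : M ^ᴹ r' ≡ 𝟙
          M^r' = S∩Stab v≢0 (subgroup-^ᴹ S-sub SM r') (trans (eigenvector-power eq r') (trans (cong (_• v) μ^r') (1•v v)))
          r≡r' : r ≡ r'
          r≡r' = ℕ.≤-antisym (ℕ.≮⇒≥ λ r'<r → r-least r' 0<r' r'<r M^r') (ℕ.≮⇒≥ λ r<r' → r'-least r 0<r r<r' μ^r)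
          r∣q-1 : r ∣ q-1
          r∣q-1 = subst (_∣ q-1) (sym r≡r') r'∣q-1
          r∣2 : r ∣ 2
          r∣2 = ∣m+n∣m⇒∣n (subst (r ∣_) (trans (cong suc q≡1+q-1) (ℕ.+-comm 2 q-1)) r∣q+1) r∣q-1
          r≡1 : r ≡ 1
          r≡1 = [ id , (λ r≡2 → ⊥-elim (2∤1 (∣m+n∣m⇒∣n (subst₂ _∣_ r≡2 (ℕ.+-comm 1 q) r∣q+1) 2∣q))) ]′
            (prime⇒irreducible prime[2] r∣2)
            where
            2∤1 : ¬ (2 ∣ 1)
            2∤1 2∣1 with ∣1⇒≡1 2∣1
            ... | ()

      abstract
        -- The map (s, k) ↦ k • (v ⊙ s) is injective, because m n⁻¹ has the eigenvector v whenever
        -- two images agree. It has (q + 1)(q - 1) arguments and as many possible values, so it is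
        -- onto.
        S-transitive : ∀ {v w} → v ≢ 𝟎 → w ≢ 𝟎 → ∃[ s ] ∃[ k ] (S (proj₁ {B = InSL} s) × k ≢ 0# × w ≡ k • (v ⊙ proj₁ s))
        S-transitive {v} {w} v≢0 w≢0 = unpack (Vl.Listing-⊆-long⇒⊇ images vectors
            (λ { ((M , k) , (SM , (_ , k≢0)) , refl) → _ , •-≢𝟎 k≢0 (⊙-≢𝟎 (M , S-InSL SM) v≢0) })
            (ℕ.≤-reflexive sizes) (_ , w≢0))
          where
          image : Mat × Carrier → V
          image (M , k) = k • (v ⊙ M)
          unpack : ∃[ x ] ((S (proj₁ x) × (⊤ × proj₂ x ≢ 0#)) × w ≡ image x) → ∃[ s ] ∃[ k ] (S (proj₁ {B = InSL} s) × k ≢ 0# × w ≡ k • (v ⊙ proj₁ s))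
          unpack ((M , k) , (SM , (_ , k≢0)) , eq) = (M , S-InSL SM) , k , SM , k≢0 , eq
          injective : ∀ {x y} → S (proj₁ x) × (⊤ × proj₂ x ≢ 0#) → S (proj₁ y) × (⊤ × proj₂ y ≢ 0#) → image x ≡ image y → x ≡ y
          injective {M , k} {N , l} (SM , (_ , k≢0)) (SN , (_ , l≢0)) eq = cong₂ _,_ (cong proj₁ m≡n)
            (•-cancelʳ (⊙-≢𝟎 n v≢0) (trans (cong (λ x → k • (v ⊙ proj₁ x)) (sym m≡n)) eq))
            where
            m n : SL
            m = M , S-InSL SM
            n = N , S-InSL SN
            eigen : v ⊙ proj₁ (m ∙ n ⁻¹) ≡ (recip k * l) • v
            eigen = begin
              v ⊙ proj₁ (m ∙ n ⁻¹)                         ≡⟨ ⊙-· v M (inv N) ⟩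
              v ⊙ M ⊙ inv N                                ≡⟨ cong (_⊙ inv N) (1•v (v ⊙ M)) ⟨
              (1# • (v ⊙ M)) ⊙ inv N                       ≡⟨ cong (λ t → (t • (v ⊙ M)) ⊙ inv N) (trans (*-comm (recip k) k) (*-recip k≢0)) ⟨
              ((recip k * k) • (v ⊙ M)) ⊙ inv N            ≡⟨ cong (_⊙ inv N) (•-• (recip k) k (v ⊙ M)) ⟨
              (recip k • k • (v ⊙ M)) ⊙ inv N              ≡⟨ cong (λ t → (recip k • t) ⊙ inv N) eq ⟩
              (recip k • l • (v ⊙ N)) ⊙ inv N              ≡⟨ cong (_⊙ inv N) (•-• (recip k) l (v ⊙ N)) ⟩
              ((recip k * l) • (v ⊙ N)) ⊙ inv N            ≡⟨ •-⊙ (recip k * l) (v ⊙ N) (inv N) ⟩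
              (recip k * l) • (v ⊙ N ⊙ inv N)              ≡⟨ cong ((recip k * l) •_) (⊙-⁻¹ n refl) ⟩
              (recip k * l) • v                            ∎
              where open ≡-Reasoning
            m≡n : m ≡ n
            m≡n = xy⁻¹≡ε⇒x≡y (SL-≡ (S-eigenvector⇒𝟙 {μ = recip k * l} v≢0 (S-∙ {m} {n ⁻¹} SM (S-⁻¹ {n} SN)) eigen))
          images : Listing (λ w → ∃[ x ] ((S (proj₁ x) × (⊤ × proj₂ x ≢ 0#)) × w ≡ image x)) (suc q ℕ.* q-1)
          images = Listing-map image injective (Listing-× S-listing units)
          sizes : ℕ.pred (q ℕ.* q) ≡ suc q ℕ.* q-1
          sizes = ℕ.suc-injective (begin
            suc (ℕ.pred (q ℕ.* q))             ≡⟨ ℕ.suc-pred (q ℕ.* q) {{ℕ.m*n≢0 q q {{q-nonZero}} {{q-nonZero}}}} ⟩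
            q ℕ.* q                            ≡⟨ cong (q ℕ.*_) q≡1+q-1 ⟩
            q ℕ.* suc q-1                      ≡⟨ ℕ.*-suc q q-1 ⟩
            q ℕ.+ q ℕ.* q-1                    ≡⟨ cong (ℕ._+ q ℕ.* q-1) q≡1+q-1 ⟩
            suc (suc q ℕ.* q-1)                ∎)
            where
            open ≡-Reasoning
            q-nonZero : NonZero q
            q-nonZero = ℕ.>-nonZero (ℕ.≤-trans (s≤s z≤n) 3≤q)

≐-sym : ∀ {a ℓ ℓ′} {A : Set a} {P : A → Set ℓ} {Q : A → Set ℓ′} → P ≐ Q → Q ≐ P
≐-sym eq x = proj₂ (eq x) , proj₁ (eq x)

≐-trans : ∀ {a ℓ ℓ′ ℓ″} {A : Set a} {P : A → Set ℓ} {Q : A → Set ℓ′} {R : A → Set ℓ″} → P ≐ Q → Q ≐ R → P ≐ R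
≐-trans eq eq′ x = proj₁ (eq′ x) ∘ proj₁ (eq x) , proj₂ (eq x) ∘ proj₂ (eq′ x)

≐-refl : ∀ {a ℓ} {A : Set a} {P : A → Set ℓ} → P ≐ P
≐-refl x = id , id

-- Points, blocks and automorphisms of the unital

module Geometry {q : ℕ} (F : FiniteField q) {p e : ℕ} (p-prime : Prime p) (q≡p^e : q ≡ p ℕ.^ e) (3≤q : 3 ℕ.≤ q)
  (S : SL2.Mat F → Set) (S-sub : SL2.IsSubgroup F S) (S-size : HasSize S (suc q))
  (m : ℕ) (D : Fin m → SL2.Mat F → Set) (D-family : SL2.Unital.IsDFamily F p S m D)
  (partition : SL2.Unital.IsPartition F p S m D) where

  open Subgroup F {p} {e} p-prime q≡p^e 3≤q public
  open SmallSubgroup S S-sub (fromHasSize S-size) public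
  open SL2.Unital F p S m D public

  _∋_ : Sylow p → SL → Set
  T ∋ x = proj₁ T (proj₁ x)

  -- Condition (P): a nontrivial g lies in one part only, so both Sylow subgroups are that part.
  Sylow-≐ : ∀ (T T' : Sylow p) {g} → g ≢ 𝟙 → proj₁ T g → proj₁ T' g → proj₁ T ≐ proj₁ T'
  Sylow-≐ T@(_ , (inSL , _) , _) T' {g} g≢𝟙 Tg T'g = proj₂ (partition g (inSL g Tg) g≢𝟙) (inj₂ (inj₁ T)) (inj₂ (inj₁ T')) (Tg , g≢𝟙) (T'g , g≢𝟙)

  S∩Sylow : ∀ (T : Sylow p) {g} → S g → proj₁ T g → g ≡ 𝟙
  S∩Sylow T {g} Sg Tg with g ≟ᴹ 𝟙
  ... | yes g≡𝟙 = g≡𝟙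
  ... | no g≢𝟙 = ⊥-elim (proj₂ (partition g (S-InSL Sg) g≢𝟙) (inj₁ (lift tt)) (inj₂ (inj₁ T)) (Sg , g≢𝟙) (Tg , g≢𝟙))

  stab : ∀ v → v ≢ 𝟎 → Sylow p
  stab v v≢0 = Stab v , Stab-IsSylow v v≢0

  S∩Stab : ∀ {v M} → v ≢ 𝟎 → S M → v ⊙ M ≡ v → M ≡ 𝟙
  S∩Stab {v} v≢0 SM fix = S∩Sylow (stab v v≢0) SM (S-InSL SM , fix)

  abstract
    -- T contains a transvection h, and the stabilizer of a vector fixed by h is itself a Sylow
    -- p-subgroup that shares h with T.
    Sylow⇒Stab : ∀ (T : Sylow p) → ∃[ v ] Σ (v ≢ 𝟎) λ _ → proj₁ T ≐ Stab v
    Sylow⇒Stab T = let v , h , v≢0 , h≢𝟙 , Th , fix = Sylow⇒transvection (proj₂ T) in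
      v , v≢0 , Sylow-≐ T (stab v v≢0) h≢𝟙 Th fix

  ∋-∙ : ∀ (T : Sylow p) {x y} → T ∋ x → T ∋ y → T ∋ (x ∙ y)
  ∋-∙ (_ , (_ , _ , closed , _) , _) {x} {y} = closed (proj₁ x) (proj₁ y)

  ∋-⁻¹ : ∀ (T : Sylow p) {x} → T ∋ x → T ∋ (x ⁻¹)
  ∋-⁻¹ (_ , (_ , _ , _ , closed) , _) {x} = closed (proj₁ x)

  ∋-ε : ∀ (T : Sylow p) → T ∋ ε
  ∋-ε (_ , (_ , T𝟙 , _) , _) = T𝟙

  ≋-refl : ∀ x → x ≋ x
  ≋-refl (inj₁ _) = refl
  ≋-refl (inj₂ _) = ≐-refl

  ≋-reflexive : ∀ {x y} → x ≡ y → x ≋ y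
  ≋-reflexive {x} refl = ≋-refl x

  ≋-sym : ∀ {x y} → x ≋ y → y ≋ x
  ≋-sym {inj₁ _} {inj₁ _} eq = sym eq
  ≋-sym {inj₂ _} {inj₂ _} eq = ≐-sym eq

  ≋-trans : ∀ {x y z} → x ≋ y → y ≋ z → x ≋ z
  ≋-trans {inj₁ _} {inj₁ _} {inj₁ _} eq eq' = trans eq eq'
  ≋-trans {inj₂ _} {inj₂ _} {inj₂ _} eq eq' = ≐-trans eq eq'

  -- A decidable form of `block∞` that lives in `Set`.
  Inf : Point → Set
  Inf (inj₁ _) = ⊥
  Inf (inj₂ _) = ⊤

  Inf? : ∀ x → Dec (Inf x)
  Inf? (inj₁ _) = no λ ()
  Inf? (inj₂ _) = yes tt

  Inf-resp : ∀ {x y} → x ≋ y → Inf x → Inf y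
  Inf-resp {inj₂ _} {inj₂ _} _ _ = tt

  affine : ∀ x → ¬ Inf x → ∃[ a ] x ≡ inj₁ a
  affine (inj₁ a) _ = a , refl
  affine (inj₂ _) fin = ⊥-elim (fin tt)

  blockS-resp : ∀ g {x y} → x ≋ y → blockS g x → blockS g y
  blockS-resp g {inj₁ _} {inj₁ _} refl b = b

  blockT-resp : ∀ T g {x y} → x ≋ y → blockT T g x → blockT T g y
  blockT-resp T g {inj₁ _} {inj₁ _} refl b = b
  blockT-resp T g {inj₂ _} {inj₂ _} eq (lift b) = lift (≐-trans b eq)

  blockD-resp : ∀ i g {x y} → x ≋ y → blockD i g x → blockD i g y
  blockD-resp i g {inj₁ _} {inj₁ _} refl b = b

  block∞-resp : ∀ {x y} → x ≋ y → block∞ x → block∞ y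
  block∞-resp {inj₂ _} {inj₂ _} _ b = b

  resp-≐ : ∀ {B C : PtSet} → B ≐ C → (∀ {x y} → x ≋ y → C x → C y) → ∀ {x y} → x ≋ y → B x → B y
  resp-≐ eq resp x≋y b = proj₂ (eq _) (resp x≋y (proj₁ (eq _) b))

  block-resp : ∀ {B} → IsBlock B → ∀ {x y} → x ≋ y → B x → B y
  block-resp (inj₁ (g , _ , eq)) = resp-≐ eq (blockS-resp g)
  block-resp (inj₂ (inj₁ (T , g , _ , eq))) = resp-≐ eq (blockT-resp T g)
  block-resp (inj₂ (inj₂ (inj₁ (i , g , _ , eq)))) = resp-≐ eq (blockD-resp i g)
  block-resp (inj₂ (inj₂ (inj₂ eq))) = resp-≐ eq block∞-resp

  IsBlock-resp : ∀ {B C : PtSet} → B ≐ C → IsBlock B → IsBlock C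
  IsBlock-resp B≐C (inj₁ (g , p , eq)) = inj₁ (g , p , ≐-trans (≐-sym B≐C) eq)
  IsBlock-resp B≐C (inj₂ (inj₁ (T , g , p , eq))) = inj₂ (inj₁ (T , g , p , ≐-trans (≐-sym B≐C) eq))
  IsBlock-resp B≐C (inj₂ (inj₂ (inj₁ (i , g , p , eq)))) = inj₂ (inj₂ (inj₁ (i , g , p , ≐-trans (≐-sym B≐C) eq)))
  IsBlock-resp B≐C (inj₂ (inj₂ (inj₂ eq))) = inj₂ (inj₂ (inj₂ (≐-trans (≐-sym B≐C) eq)))

  -- Automorphisms acting on blocks by inverse images: φ maps B to the block B ∘ ψ.
  record Aut : Set₂ where
    no-eta-equality
    field
      φ ψ    : Point → Point
      φ-cong : ∀ {x y} → x ≋ y → φ x ≋ φ y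
      ψ-cong : ∀ {x y} → x ≋ y → ψ x ≋ ψ y
      φψ     : ∀ x → φ (ψ x) ≋ x
      ψφ     : ∀ x → ψ (φ x) ≋ x
      φ-block : ∀ {B} → IsBlock B → IsBlock (B ∘ ψ)
      ψ-block : ∀ {B} → IsBlock B → IsBlock (B ∘ φ)

  open Aut

  fromAutomorphism : Automorphism → Aut
  fromAutomorphism α = record
    { φ = A.φ ; ψ = A.ψ ; φ-cong = A.φ-cong _ _ ; ψ-cong = A.ψ-cong _ _ ; φψ = A.φψ ; ψφ = A.ψφ
    ; φ-block = λ b → IsBlock-resp (λ y →
        (λ (x , Bx , eq) → block-resp b (≋-trans {x} {A.ψ (A.φ x)} {A.ψ y} (≋-sym {A.ψ (A.φ x)} {x} (A.ψφ x)) (A.ψ-cong _ _ eq)) Bx) ,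
        (λ Bψy → A.ψ y , Bψy , A.φψ y)) (A.φ-blocks _ b)
    ; ψ-block = λ b → IsBlock-resp (λ y →
        (λ (x , Bx , eq) → block-resp b (≋-trans {x} {A.φ (A.ψ x)} {A.φ y} (≋-sym {A.φ (A.ψ x)} {x} (A.φψ x)) (A.φ-cong _ _ eq)) Bx) ,
        (λ Bφy → A.φ y , Bφy , A.ψφ y)) (A.ψ-blocks _ b) }
    where module A = Automorphism α

  infixr 9 _∘ᴬ_
  infix 10 _⁻ᴬ

  _⁻ᴬ : Aut → Aut
  α ⁻ᴬ = record { φ = ψ α ; ψ = φ α ; φ-cong = ψ-cong α ; ψ-cong = φ-cong α ; φψ = ψφ α ; ψφ = φψ α ; φ-block = ψ-block α ; ψ-block = φ-block α }

  _∘ᴬ_ : Aut → Aut → Aut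
  α ∘ᴬ β = record
    { φ = φ α ∘ φ β ; ψ = ψ β ∘ ψ α
    ; φ-cong = φ-cong α ∘ φ-cong β ; ψ-cong = ψ-cong β ∘ ψ-cong α
    ; φψ = λ x → ≋-trans {φ α (φ β (ψ β (ψ α x)))} {φ α (ψ α x)} {x} (φ-cong α (φψ β (ψ α x))) (φψ α x)
    ; ψφ = λ x → ≋-trans {ψ β (ψ α (φ α (φ β x)))} {ψ β (φ β x)} {x} (ψ-cong β (ψφ α (φ β x))) (ψφ β x)
    ; φ-block = φ-block α ∘ φ-block β ; ψ-block = ψ-block β ∘ ψ-block α }

  -- Right multiplication maps T h to T (h g), hence preserves every class of ♭ and fixes the new
  -- points.
  shift : SL → Point → Point
  shift g (inj₁ x) = inj₁ (x ∙ g)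
  shift g (inj₂ T) = inj₂ T

  shift-Inf : ∀ g {x} → Inf x → shift g x ≋ x
  shift-Inf g {inj₂ _} _ = ≐-refl

  Coset-shift : ∀ (A : Mat → Set) (g h x : SL) → Coset A (proj₁ h) (proj₁ (x ∙ g ⁻¹)) ⇔ₚ Coset A (proj₁ (h ∙ g)) (proj₁ x)
  Coset-shift A g h x =
    (λ (a , Aa , eq) → a , Aa , trans (cong proj₁ (sym (xy⁻¹y x g))) (trans (cong (_· proj₁ g) eq) (·-assoc a (proj₁ h) (proj₁ g)))) ,
    (λ (a , Aa , eq) → a , Aa , trans (cong (_· proj₁ (g ⁻¹)) (trans eq (sym (·-assoc a (proj₁ h) (proj₁ g)))))
      (trans (·-assoc _ _ _) (trans (cong ((a · proj₁ h) ·_) (cong proj₁ (inverseʳ g))) (·-identityʳ _))))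

  shift-block : ∀ g {B} → IsBlock B → IsBlock (B ∘ shift (g ⁻¹))
  shift-block g (inj₁ (h , p , eq)) = inj₁ (h · proj₁ g , proj₂ ((h , p) ∙ g) , ≐-trans (eq ∘ shift (g ⁻¹)) λ
    { (inj₁ x) → let to , from = Coset-shift S g (h , p) x in (λ (lift c) → lift (to c)) , (λ (lift c) → lift (from c)) ; (inj₂ _) → id , id })
  shift-block g (inj₂ (inj₁ (T , h , p , eq))) = inj₂ (inj₁ (T , h · proj₁ g , proj₂ ((h , p) ∙ g) , ≐-trans (eq ∘ shift (g ⁻¹)) λ
    { (inj₁ x) → let to , from = Coset-shift (proj₁ T) g (h , p) x in (λ (lift c) → lift (to c)) , (λ (lift c) → lift (from c)) ; (inj₂ _) → id , id }))
  shift-block g (inj₂ (inj₂ (inj₁ (i , h , p , eq)))) = inj₂ (inj₂ (inj₁ (i , h · proj₁ g , proj₂ ((h , p) ∙ g) , ≐-trans (eq ∘ shift (g ⁻¹)) λ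
    { (inj₁ x) → let to , from = Coset-shift (D i) g (h , p) x in (λ (lift c) → lift (to c)) , (λ (lift c) → lift (from c)) ; (inj₂ _) → id , id })))
  shift-block g (inj₂ (inj₂ (inj₂ eq))) = inj₂ (inj₂ (inj₂ (≐-trans (eq ∘ shift (g ⁻¹)) λ { (inj₁ _) → id , id ; (inj₂ _) → id , id })))

  right : SL → Aut
  right g = record
    { φ = shift g ; ψ = shift (g ⁻¹) ; φ-cong = cong-shift g ; ψ-cong = cong-shift (g ⁻¹)
    ; φψ = λ { (inj₁ x) → cong proj₁ (xy⁻¹y x g) ; (inj₂ _) → ≐-refl }
    ; ψφ = λ { (inj₁ x) → cong proj₁ (xyy⁻¹ x g) ; (inj₂ _) → ≐-refl }
    ; φ-block = shift-block g
    ; ψ-block = λ {B} b → subst (λ h → IsBlock (B ∘ shift h)) (⁻¹-involutive g) (shift-block (g ⁻¹) b) }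
    where
    cong-shift : ∀ g {x y} → x ≋ y → shift g x ≋ shift g y
    cong-shift g {inj₁ _} {inj₁ _} refl = refl
    cong-shift g {inj₂ _} {inj₂ _} eq = eq

  -- Only a short block contains both a new point and group elements, and y x⁻¹ does not depend on
  -- the representative of the coset.
  block-through-infinite : ∀ {B} → IsBlock B → ∀ {T x y} → B (inj₂ T) → B (inj₁ x) → B (inj₁ y) → T ∋ (y ∙ x ⁻¹)
  block-through-infinite (inj₁ (g , _ , eq)) bT _ _ = ⊥-elim (Level.lower (proj₁ (eq _) bT))
  block-through-infinite (inj₂ (inj₁ (T' , g , p , eq))) {T} {x} {y} bT bx by with proj₁ (eq _) bT | proj₁ (eq _) bx | proj₁ (eq _) by
  ... | lift T'≐T | lift (t , T't , x≡tg) | lift (t' , T't' , y≡t'g) = proj₁ (T'≐T _) (subst (T' ∋_) quotient (∋-∙ T' {t' , t'SL} {(t , tSL) ⁻¹} T't' (∋-⁻¹ T' {t , tSL} T't)))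
    where
    tSL : InSL t
    tSL = proj₁ (proj₁ (proj₂ T')) t T't
    t'SL : InSL t'
    t'SL = proj₁ (proj₁ (proj₂ T')) t' T't'
    quotient : (t' , t'SL) ∙ (t , tSL) ⁻¹ ≡ y ∙ x ⁻¹
    quotient = begin
      τ' ∙ τ ⁻¹                    ≡⟨ cong (_∙ τ ⁻¹) (xyy⁻¹ τ' γ) ⟨
      τ' ∙ γ ∙ γ ⁻¹ ∙ τ ⁻¹         ≡⟨ assoc (τ' ∙ γ) (γ ⁻¹) (τ ⁻¹) ⟩
      τ' ∙ γ ∙ (γ ⁻¹ ∙ τ ⁻¹)       ≡⟨ cong (τ' ∙ γ ∙_) (⁻¹-anti-homo-∙ τ γ) ⟨
      τ' ∙ γ ∙ (τ ∙ γ) ⁻¹          ≡⟨ cong₂ (λ s t → s ∙ t ⁻¹) (SL-≡ {τ' ∙ γ} {y} (sym y≡t'g)) (SL-≡ {τ ∙ γ} {x} (sym x≡tg)) ⟩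
      y ∙ x ⁻¹                     ∎
      where
      open ≡-Reasoning
      τ τ' γ : SL
      τ = t , tSL
      τ' = t' , t'SL
      γ = g , p
  block-through-infinite (inj₂ (inj₂ (inj₁ (i , g , _ , eq)))) bT _ _ = ⊥-elim (Level.lower (proj₁ (eq _) bT))
  block-through-infinite (inj₂ (inj₂ (inj₂ eq))) _ bx _ = ⊥-elim (Level.lower (proj₁ (eq _) bx))

  block-through-two-infinite : ∀ {B} → IsBlock B → ∀ {T T'} → B (inj₂ T) → B (inj₂ T') → (proj₁ T ≐ proj₁ T') ⊎ (B ≐ block∞)
  block-through-two-infinite (inj₁ (g , _ , eq)) bT _ = ⊥-elim (Level.lower (proj₁ (eq _) bT))
  block-through-two-infinite (inj₂ (inj₁ (T' , g , p , eq))) bT bT' = inj₁ (≐-trans (≐-sym (Level.lower (proj₁ (eq _) bT))) (Level.lower (proj₁ (eq _) bT')))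
  block-through-two-infinite (inj₂ (inj₂ (inj₁ (i , g , _ , eq)))) bT _ = ⊥-elim (Level.lower (proj₁ (eq _) bT))
  block-through-two-infinite (inj₂ (inj₂ (inj₂ eq))) _ _ = inj₂ eq

  -- α maps [∞] to the point set {y | Inf (ψ α y)}.
  Fixes∞ : Aut → Set₁
  Fixes∞ α = ∀ y → Inf (ψ α y) ⇔ₚ Inf y

  block∞⇒Inf : ∀ {x} → block∞ x → Inf x
  block∞⇒Inf {inj₂ _} _ = tt

  Inf⇒block∞ : ∀ {x} → Inf x → block∞ x
  Inf⇒block∞ {inj₂ _} _ = lift tt

  ≐block∞⇒Fixes∞ : ∀ α → (block∞ ∘ ψ α) ≐ block∞ → Fixes∞ α
  ≐block∞⇒Fixes∞ α eq y = block∞⇒Inf ∘ proj₁ (eq y) ∘ Inf⇒block∞ , block∞⇒Inf ∘ proj₂ (eq y) ∘ Inf⇒block∞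

  Fixes∞-φ : ∀ α → Fixes∞ α → ∀ y → Inf (φ α y) ⇔ₚ Inf y
  Fixes∞-φ α fix y = Inf-resp {ψ α (φ α y)} {y} (ψφ α y) ∘ proj₂ (fix (φ α y)) ,
    proj₁ (fix (φ α y)) ∘ Inf-resp {y} {ψ α (φ α y)} (≋-sym {ψ α (φ α y)} {y} (ψφ α y))

  Fixes∞-⁻ᴬ : ∀ α → Fixes∞ α → Fixes∞ (α ⁻ᴬ)
  Fixes∞-⁻ᴬ = Fixes∞-φ

  Fixes∞-∘ᴬ : ∀ α β → Fixes∞ α → Fixes∞ β → Fixes∞ (α ∘ᴬ β)
  Fixes∞-∘ᴬ α β fα fβ y = proj₁ (fα y) ∘ proj₁ (fβ (ψ α y)) , proj₂ (fβ (ψ α y)) ∘ proj₂ (fα y)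

  Fixes∞-right : ∀ g → Fixes∞ (right g)
  Fixes∞-right g (inj₁ _) = id , id
  Fixes∞-right g (inj₂ _) = id , id

  -- Automorphisms that fix [∞]

  module _ (α : Aut) (fix : Fixes∞ α) where

    abstract
      aff : SL → SL
      aff x = proj₁ (affine (φ α (inj₁ x)) (proj₁ (Fixes∞-φ α fix (inj₁ x))))

      aff-≡ : ∀ x → φ α (inj₁ x) ≡ inj₁ (aff x)
      aff-≡ x = proj₂ (affine (φ α (inj₁ x)) (proj₁ (Fixes∞-φ α fix (inj₁ x))))

    aff-≋ : ∀ x → φ α (inj₁ x) ≋ inj₁ (aff x)
    aff-≋ x = ≋-reflexive (aff-≡ x)

    aff-injective : ∀ {x y} → aff x ≡ aff y → x ≡ y
    aff-injective {x} {y} eq = SL-≡ (≋-trans {inj₁ x} {ψ α (φ α (inj₁ x))} {inj₁ y} (≋-sym {ψ α (φ α (inj₁ x))} {inj₁ x} (ψφ α (inj₁ x)))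
      (subst (λ z → ψ α z ≋ inj₁ y) (trans (aff-≡ y) (trans (cong inj₁ (sym eq)) (sym (aff-≡ x)))) (ψφ α (inj₁ y))))

    -- The block T x contains the new point T, so its image is a block through T' and aff x, that
    -- is, the coset T' (aff x).
    aff-coset : ∀ {T T'} → φ α (inj₂ T) ≋ inj₂ T' → ∀ {x y} → T ∋ (y ∙ x ⁻¹) → T' ∋ (aff y ∙ aff x ⁻¹)
    aff-coset {T} {T'} eq {x} {y} Tyx = block-through-infinite image-block {T'} {aff x} {aff y}
      (block-resp image-block eq (lift-block (lift ≐-refl)))
      (subst (blockT T (proj₁ x) ∘ ψ α) (aff-≡ x) (lift-block (lift (𝟙 , ∋-ε T , sym (·-identityˡ (proj₁ x))))))
      (subst (blockT T (proj₁ x) ∘ ψ α) (aff-≡ y) (lift-block (lift (proj₁ (y ∙ x ⁻¹) , Tyx , cong proj₁ (sym (xy⁻¹y y x))))))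
      where
      block : IsBlock (blockT T (proj₁ x))
      block = inj₂ (inj₁ (T , proj₁ x , proj₂ x , ≐-refl))
      image-block : IsBlock (blockT T (proj₁ x) ∘ ψ α)
      image-block = φ-block α block
      lift-block : ∀ {z} → blockT T (proj₁ x) z → blockT T (proj₁ x) (ψ α (φ α z))
      lift-block {z} = blockT-resp T (proj₁ x) (≋-sym {ψ α (φ α z)} {z} (ψφ α z))

  ⊙-quotient⇒ : ∀ v x y → v ⊙ proj₁ x ≡ v ⊙ proj₁ y → v ⊙ proj₁ (y ∙ x ⁻¹) ≡ v
  ⊙-quotient⇒ v x y eq = trans (⊙-· v (proj₁ y) (proj₁ (x ⁻¹))) (⊙-⁻¹ x eq)

  ⊙-quotient⇐ : ∀ v x y → v ⊙ proj₁ (y ∙ x ⁻¹) ≡ v → v ⊙ proj₁ x ≡ v ⊙ proj₁ y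
  ⊙-quotient⇐ v x y eq = trans (cong (_⊙ proj₁ x) (sym eq)) (trans (sym (⊙-· v _ _)) (cong (λ z → v ⊙ proj₁ z) (xy⁻¹y y x)))

  -- An automorphism that fixes the new point of a vector stabilizer permutes the right cosets of
  -- that stabilizer, which is the hypothesis of `Rigidity`.
  rigid : ∀ α → (∀ x → Inf x → φ α x ≋ x) → φ α (inj₁ ε) ≋ inj₁ ε → Fixes∞ α → ∀ x → φ α (inj₁ x) ≋ inj₁ x
  rigid α fix-inf fix-ε fix x = ≋-trans {φ α (inj₁ x)} {inj₁ (f x)} {inj₁ x} (aff-≋ α fix x) (cong proj₁
    (Rigidity.f≡id f (aff-injective α fix) (SL-≡ (≋-trans {inj₁ (f ε)} {φ α (inj₁ ε)} {inj₁ ε} (≋-sym {φ α (inj₁ ε)} {inj₁ (f ε)} (aff-≋ α fix ε)) fix-ε)) respects x))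
    where
    f : SL → SL
    f = aff α fix
    respects : ∀ v x y → v ≢ 𝟎 → v ⊙ proj₁ x ≡ v ⊙ proj₁ y → v ⊙ proj₁ (f x) ≡ v ⊙ proj₁ (f y)
    respects v x y v≢0 eq = ⊙-quotient⇐ v (f x) (f y) (proj₂ (aff-coset α fix {T} {T} (fix-inf (inj₂ T) tt) {x} {y}
      (proj₂ (y ∙ x ⁻¹) , ⊙-quotient⇒ v x y eq)))
      where
      T : Sylow p
      T = stab v v≢0

  -- α⁻¹ ∘ right (f g)⁻¹ ∘ α ∘ right g fixes ε and [∞] pointwise, so it is trivial.
  aff-homomorphic : ∀ α (fix : Fixes∞ α) → φ α (inj₁ ε) ≋ inj₁ ε → ∀ x g → aff α fix (x ∙ g) ≡ aff α fix x ∙ aff α fix g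
  aff-homomorphic α fix fix-ε x g = begin
    f (x ∙ g)                       ≡⟨ xy⁻¹y (f (x ∙ g)) (f g) ⟨
    f (x ∙ g) ∙ f g ⁻¹ ∙ f g        ≡⟨ cong (_∙ f g) (SL-≡ key) ⟩
    f x ∙ f g                       ∎
    where
    open ≡-Reasoning
    f : SL → SL
    f = aff α fix
    γ : Aut
    γ = α ⁻ᴬ ∘ᴬ right (f g ⁻¹) ∘ᴬ α ∘ᴬ right g
    γ-affine : ∀ y → φ γ (inj₁ y) ≡ ψ α (inj₁ (f (y ∙ g) ∙ f g ⁻¹))
    γ-affine y = cong (ψ α ∘ shift (f g ⁻¹)) (aff-≡ α fix (y ∙ g))
    γ-inf : ∀ y → Inf y → φ γ y ≋ y
    γ-inf y@(inj₂ _) inf = ≋-trans {φ γ y} {ψ α (φ α y)} {y} (ψ-cong α (shift-Inf (f g ⁻¹) (proj₂ (Fixes∞-φ α fix y) inf))) (ψφ α y)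
    ψ-ε : ψ α (inj₁ ε) ≋ inj₁ ε
    ψ-ε = ≋-trans {ψ α (inj₁ ε)} {ψ α (φ α (inj₁ ε))} {inj₁ ε} (ψ-cong α (≋-sym {φ α (inj₁ ε)} {inj₁ ε} fix-ε)) (ψφ α (inj₁ ε))
    γ-ε : φ γ (inj₁ ε) ≋ inj₁ ε
    γ-ε = subst (_≋ inj₁ ε) (trans (cong (ψ α ∘ inj₁) (sym (trans (cong (λ t → f t ∙ f g ⁻¹) (identityˡ g)) (inverseʳ (f g))))) (sym (γ-affine ε))) ψ-ε
    γ-fix : Fixes∞ γ
    γ-fix = Fixes∞-∘ᴬ (α ⁻ᴬ) (right (f g ⁻¹) ∘ᴬ α ∘ᴬ right g) (Fixes∞-⁻ᴬ α fix)
      (Fixes∞-∘ᴬ (right (f g ⁻¹)) (α ∘ᴬ right g) (Fixes∞-right (f g ⁻¹)) (Fixes∞-∘ᴬ α (right g) fix (Fixes∞-right g)))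
    γ-id : ψ α (inj₁ (f (x ∙ g) ∙ f g ⁻¹)) ≋ inj₁ x
    γ-id = subst (_≋ inj₁ x) (γ-affine x) (rigid γ γ-inf γ-ε γ-fix x)
    y : Point
    y = inj₁ (f (x ∙ g) ∙ f g ⁻¹)
    key : y ≋ inj₁ (f x)
    key = ≋-trans {y} {φ α (ψ α y)} {inj₁ (f x)} (≋-sym {φ α (ψ α y)} {y} (φψ α y))
      (≋-trans {φ α (ψ α y)} {φ α (inj₁ x)} {inj₁ (f x)} (φ-cong α γ-id) (aff-≋ α fix x))

  infix 4 _≈_
  -- `_≋_` computes, so its endpoints cannot be recovered by unification; the wrapper makes them
  -- inferable in chains of equations.
  record _≈_ (x y : Point) : Set where
    constructor mk
    field un : x ≋ y
  open _≈_ public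

  ≈-refl : ∀ {x} → x ≈ x
  ≈-refl {x} = mk (≋-refl x)

  ≈-sym : ∀ {x y} → x ≈ y → y ≈ x
  ≈-sym {x} {y} (mk eq) = mk (≋-sym {x} {y} eq)

  infixr 3 _⟫_
  _⟫_ : ∀ {x y z} → x ≈ y → y ≈ z → x ≈ z
  _⟫_ {x} {y} {z} (mk eq) (mk eq') = mk (≋-trans {x} {y} {z} eq eq')

  ≡⇒≈ : ∀ {x y} → x ≡ y → x ≈ y
  ≡⇒≈ refl = ≈-refl

  φ≈ : ∀ α {x y} → x ≈ y → φ α x ≈ φ α y
  φ≈ α (mk eq) = mk (φ-cong α eq)

  ψ≈ : ∀ α {x y} → x ≈ y → ψ α x ≈ ψ α y
  ψ≈ α (mk eq) = mk (ψ-cong α eq)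

  φψ≈ : ∀ α {x} → φ α (ψ α x) ≈ x
  φψ≈ α {x} = mk (φψ α x)

  ψφ≈ : ∀ α {x} → ψ α (φ α x) ≈ x
  ψφ≈ α {x} = mk (ψφ α x)

  φ-cancel : ∀ α {x y} → φ α x ≈ φ α y → x ≈ y
  φ-cancel α eq = ≈-sym (ψφ≈ α) ⟫ ψ≈ α eq ⟫ ψφ≈ α

  shift≈ : ∀ g {x y} → x ≈ y → shift g x ≈ shift g y
  shift≈ g = φ≈ (right g)

  Inf≈ : ∀ {x y} → x ≈ y → Inf x → Inf y
  Inf≈ {x} {y} (mk eq) = Inf-resp {x} {y} eq

  shift-Inf≈ : ∀ g {x} → Inf x → shift g x ≈ x
  shift-Inf≈ g inf = mk (shift-Inf g inf)

  inj₁-injective : ∀ {x y : SL} → inj₁ x ≈ inj₁ y → x ≡ y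
  inj₁-injective (mk eq) = SL-≡ eq

  block≈ : ∀ {B} → IsBlock B → ∀ {x y} → x ≈ y → B x → B y
  block≈ b {x} {y} (mk eq) = block-resp b {x} {y} eq

  IsBlock-block∞ : IsBlock block∞
  IsBlock-block∞ = inj₂ (inj₂ (inj₂ ≐-refl))

  -- Conjugates of right multiplications

  conjᴬ : Aut → SL → Aut
  conjᴬ α h = α ∘ᴬ right h ∘ᴬ α ⁻ᴬ

  module _ (α : Aut) where

    conj-fixes : ∀ h {y} → Inf (ψ α y) → φ (conjᴬ α h) y ≈ y
    conj-fixes h inf = φ≈ α (shift-Inf≈ h inf) ⟫ φψ≈ α

    -- Right multiplications act regularly, so one point off the image of [∞] already determines the
    -- parameter.
    conj-agree : ∀ h h' {y} → ¬ Inf (ψ α y) → φ (conjᴬ α h) y ≈ φ (conjᴬ α h') y → h ≡ h'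
    conj-agree h h' {y} fin eq with affine (ψ α y) fin
    ... | x , ψy≡x = ∙-cancelˡ x h h' (inj₁-injective (subst (λ z → shift h z ≈ shift h' z) ψy≡x (φ-cancel α eq)))

    conj-free : ∀ h {y} → ¬ Inf (ψ α y) → φ (conjᴬ α h) y ≈ y → h ≡ ε
    conj-free h {y} fin eq with affine (ψ α y) fin
    ... | x , ψy≡x = ∙-cancelˡ x h ε (trans (inj₁-injective (subst (λ z → shift h z ≈ z) ψy≡x (φ-cancel α (eq ⟫ ≈-sym (φψ≈ α))))) (sym (identityʳ x)))

    abstract
      -- The preimages x and x' are returned along with the map because `conj-involution` derives
      -- from them that x⁻¹ x' is an involution or ε.
      conj-transitive : ∀ {y y'} → ¬ Inf (ψ α y) → ¬ Inf (ψ α y') →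
        ∃[ x ] ∃[ x' ] (ψ α y ≡ inj₁ x × ψ α y' ≡ inj₁ x' × φ (conjᴬ α (x ⁻¹ ∙ x')) y ≈ y')
      conj-transitive {y} {y'} fin fin' with affine (ψ α y) fin | affine (ψ α y') fin'
      ... | x , ψy≡x | x' , ψy'≡x' = x , x' , ψy≡x , ψy'≡x' , (φ≈ α
        (≡⇒≈ (trans (cong (shift (x ⁻¹ ∙ x')) ψy≡x) (trans (cong inj₁ (xx⁻¹y x x')) (sym ψy'≡x')))) ⟫ φψ≈ α)

    conj-conj≈ : ∀ h {y} → h ∙ h ≡ ε → φ (conjᴬ α h) (φ (conjᴬ α h) y) ≈ y
    conj-conj≈ h {y} hh = φ≈ α (shift≈ h (ψφ≈ α) ⟫ twice (ψ α y)) ⟫ φψ≈ α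
      where
      twice : ∀ z → shift h (shift h z) ≈ z
      twice (inj₁ x) = ≡⇒≈ (cong inj₁ (trans (assoc x h h) (trans (cong (x ∙_) hh) (identityʳ x))))
      twice (inj₂ _) = ≈-refl

  S-list : Listing (λ (x : SL) → S (proj₁ x)) (suc q)
  S-list = Listing-resp (λ x → (λ { (M , SM , refl) → subst S (sym (toSL-proj₁ (S-InSL SM))) SM }) , λ Sx → proj₁ x , Sx , SL-≡ (sym (toSL-proj₁ (proj₂ x))))
    (Listing-map toSL (λ Sx Sy eq → trans (sym (toSL-proj₁ (S-InSL Sx))) (trans (cong proj₁ eq) (toSL-proj₁ (S-InSL Sy)))) (fromHasSize S-size))
    where
    -- The value ε at matrices outside SL(2,q) is only a default; S contains no such matrix.
    toSL : Mat → SL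
    toSL M with det M ≟ 1#
    ... | yes p = M , p
    ... | no _ = ε
    toSL-proj₁ : ∀ {M} → InSL M → proj₁ (toSL M) ≡ M
    toSL-proj₁ {M} p with det M ≟ 1#
    ... | yes _ = refl
    ... | no ne = ⊥-elim (ne p)

  module Sˡ = FiniteListing _≟ˢ_

  ∃-nontrivial-S : ∃[ s ] (S (proj₁ {B = InSL} s) × s ≢ ε)
  ∃-nontrivial-S = let s , Ss , s∉ = Sˡ.Listing-avoid S-list (ε ∷ []) (s≤s (ℕ.≤-trans (s≤s z≤n) 3≤q)) in s , Ss , s∉ ∘ here

  -- Otherwise D* would be contained in D, so q (q + 1) ≤ q + 1.
  D-not-closed : ∀ i → (∀ x y → D i x → D i y → D i (x · inv y)) → ⊥
  D-not-closed i closed = let _ , _ , size , star-size = D-family i in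
    ℕ.<⇒≱ (ℕ.≤-trans (s≤s (s≤s z≤n)) 3≤q) (ℕ.*-cancelʳ-≤ q 1 (suc q)
      (subst (q ℕ.* suc q ℕ.≤_) (sym (ℕ.*-identityˡ (suc q)))
        (Listing-≤ (fromHasSize star-size) (fromHasSize size) λ { (x , y , Dx , Dy , _ , refl) → closed x y Dx Dy })))

  Coset-cancel : ∀ (A : Mat → Set) (g x : SL) → (∀ {M} → A M → InSL M) → Coset A (proj₁ g) (proj₁ (x ∙ g)) ⇔ₚ A (proj₁ x)
  Coset-cancel A g x inSL =
    (λ (a , Aa , eq) → subst A (cong proj₁ (∙-cancelʳ g (a , inSL Aa) x (SL-≡ (sym eq)))) Aa) , (λ Ax → proj₁ x , Ax , refl)

  aff-ε : ∀ α (fix : Fixes∞ α) → φ α (inj₁ ε) ≈ inj₁ ε → aff α fix ε ≡ ε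
  aff-ε α fix fix-ε = inj₁-injective (≈-sym (mk (aff-≋ α fix ε)) ⟫ fix-ε)

  aff-⁻¹ : ∀ α (fix : Fixes∞ α) → φ α (inj₁ ε) ≈ inj₁ ε → ∀ x → aff α fix (x ⁻¹) ≡ aff α fix x ⁻¹
  aff-⁻¹ α fix fix-ε x = inverseˡ-unique _ _ (trans (sym (aff-homomorphic α fix (un fix-ε) (x ⁻¹) x)) (trans (cong (aff α fix) (inverseˡ x)) (aff-ε α fix fix-ε)))

  -- The image of S is a block through ε and a subgroup, so it is neither a T nor a D g.
  aff-S : ∀ α (fix : Fixes∞ α) → φ α (inj₁ ε) ≈ inj₁ ε → ∀ {s} → S (proj₁ s) → S (proj₁ (aff α fix s))
  aff-S α fix fix-ε {s} Ss = cases (φ-block α block)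
    where
    f : SL → SL
    f = aff α fix
    block : IsBlock (blockS 𝟙)
    block = inj₁ (𝟙 , InSL-𝟙 , ≐-refl)
    onS : ∀ {x} → S (proj₁ x) → blockS 𝟙 (inj₁ x)
    onS {x} Sx = lift (proj₁ x , Sx , sym (·-identityʳ (proj₁ x)))
    offS : ∀ {x} → blockS 𝟙 (inj₁ x) → S (proj₁ x)
    offS (lift (s , Ss , eq)) = subst S (sym (trans eq (·-identityʳ s))) Ss
    onImage : ∀ {x} → S (proj₁ x) → blockS 𝟙 (ψ α (inj₁ (f x)))
    onImage {x} Sx = block≈ block (≈-sym (ψ≈ α (≈-sym (mk (aff-≋ α fix x))) ⟫ ψφ≈ α)) (onS {x} Sx)
    offImage : ∀ {y} → blockS 𝟙 (ψ α (inj₁ y)) → ∃[ x ] (S (proj₁ x) × y ≡ f x)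
    offImage {y} b with affine (ψ α (inj₁ y)) (proj₁ (fix (inj₁ y)))
    ... | x , ψy≡x = x , offS {x} (subst (blockS 𝟙) ψy≡x b) , inj₁-injective (≈-sym (φψ≈ α) ⟫ φ≈ α (≡⇒≈ ψy≡x) ⟫ mk (aff-≋ α fix x))
    cases : IsBlock (blockS 𝟙 ∘ ψ α) → S (proj₁ (f s))
    cases (inj₁ (g , p , eq)) with proj₁ (eq _) (onImage {s} Ss) | proj₁ (eq _) (onImage {ε} S-ε)
    ... | lift (a , Sa , fs≡ag) | lift (b , Sb , fε≡bg) = subst (S ∘ proj₁) eq' (S-∙ {a'} {b' ⁻¹} Sa (S-⁻¹ {b'} Sb))
      where
      a' b' g' : SL
      a' = a , S-InSL Sa
      b' = b , S-InSL Sb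
      g' = g , p
      eq' : a' ∙ b' ⁻¹ ≡ f s
      eq' = trans (cong (a' ∙_) (sym (inverseʳ-unique b' g' (trans (SL-≡ (sym fε≡bg)) (aff-ε α fix fix-ε))))) (SL-≡ (sym fs≡ag))
    cases (inj₂ (inj₁ (T , g , _ , eq))) = ⊥-elim (no-infinite (proj₂ (fix (inj₂ T)) tt) (proj₂ (eq (inj₂ T)) (lift ≐-refl)))
      where
      no-infinite : ∀ {x} → Inf x → blockS 𝟙 x → ⊥
      no-infinite {inj₂ _} _ (lift ())
    cases (inj₂ (inj₂ (inj₂ eq))) = ⊥-elim (Level.lower (proj₁ (eq _) (onImage {ε} S-ε)))
    cases (inj₂ (inj₂ (inj₁ (i , g , p , eq)))) = ⊥-elim (D-not-closed i closed)
      where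
      g' : SL
      g' = g , p
      D-InSL : ∀ {M} → D i M → InSL M
      D-InSL {M} = proj₁ (D-family i) M
      D⇒image : ∀ x → D i (proj₁ x) → ∃[ s ] (S (proj₁ s) × x ∙ g' ≡ f s)
      D⇒image x Dx = offImage {x ∙ g'} (proj₂ (eq _) (lift (proj₂ (Coset-cancel (D i) g' x D-InSL) Dx)))
      image⇒D : ∀ x → ∃[ s ] (S (proj₁ s) × x ∙ g' ≡ f s) → D i (proj₁ x)
      image⇒D x (s , Ss , eq') = proj₁ (Coset-cancel (D i) g' x D-InSL) (Level.lower (proj₁ (eq _) (subst (λ y → blockS 𝟙 (ψ α (inj₁ y))) (sym eq') (onImage {s} Ss))))
      closed : ∀ x y → D i x → D i y → D i (x · inv y)
      -- With x g = f a, y g = f b and g = f c, the last because 𝟙 ∈ D, one gets x y⁻¹ g = f (a b⁻¹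
      -- c), again in the image of S.
      closed x y Dx Dy =
        let a , Sa , xg = D⇒image x' Dx ; b , Sb , yg = D⇒image y' Dy ; c , Sc , εg = D⇒image ε (proj₁ (proj₂ (D-family i))) in
        image⇒D (x' ∙ y' ⁻¹) (a ∙ b ⁻¹ ∙ c , S-∙ {a ∙ b ⁻¹} {c} (S-∙ {a} {b ⁻¹} Sa (S-⁻¹ {b} Sb)) Sc , (begin
          x' ∙ y' ⁻¹ ∙ g'                      ≡⟨ cong (λ t → t ∙ y' ⁻¹ ∙ g') (xyy⁻¹ x' g') ⟨
          x' ∙ g' ∙ g' ⁻¹ ∙ y' ⁻¹ ∙ g'         ≡⟨ cong (_∙ g') (assoc (x' ∙ g') (g' ⁻¹) (y' ⁻¹)) ⟩
          x' ∙ g' ∙ (g' ⁻¹ ∙ y' ⁻¹) ∙ g'       ≡⟨ cong (λ t → x' ∙ g' ∙ t ∙ g') (⁻¹-anti-homo-∙ y' g') ⟨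
          x' ∙ g' ∙ (y' ∙ g') ⁻¹ ∙ g'          ≡⟨ cong₂ (λ s t → s ∙ t ⁻¹ ∙ g') xg yg ⟩
          f a ∙ f b ⁻¹ ∙ g'                    ≡⟨ cong₂ (λ s t → f a ∙ s ∙ t) (sym (aff-⁻¹ α fix fix-ε b)) (trans (sym (identityˡ g')) εg) ⟩
          f a ∙ f (b ⁻¹) ∙ f c                 ≡⟨ cong (_∙ f c) (aff-homomorphic α fix (un fix-ε) a (b ⁻¹)) ⟨
          f (a ∙ b ⁻¹) ∙ f c                   ≡⟨ aff-homomorphic α fix (un fix-ε) (a ∙ b ⁻¹) c ⟨
          f (a ∙ b ⁻¹ ∙ c)                     ∎))
        where
        open ≡-Reasoning
        x' y' : SL
        x' = x , D-InSL Dx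
        y' = y , D-InSL Dy

  -- A nontrivial element of the common stabilizer would fix a basis.
  Independent⇒¬≐ : ∀ {v w} → v ≢ 𝟎 → Independent v w → ¬ (Stab v ≐ Stab w)
  Independent⇒¬≐ {v} {w} v≢0 ind eq =
    let M , fix , M∉ = Ml.Listing-avoid (Stab-listing v v≢0) (𝟙 ∷ []) (ℕ.≤-trans (s≤s (s≤s z≤n)) 3≤q) in
    M∉ (here (fixes-basis⇒𝟙 {v} {w} ind (proj₂ fix) (proj₂ (proj₁ (eq M) fix))))

  module _ (2≡0 : 1# + 1# ≡ 0#) (α : Aut) where
    open EvenCharacteristic 2≡0 S∩Stab

    Sylow-involution : ∀ (T : Sylow p) {x} → T ∋ x → x ⁻¹ ≡ x
    Sylow-involution T {x} Tx = let v , v≢0 , T≐ = Sylow⇒Stab T in Stab-involution x v≢0 (proj₂ (proj₁ (T≐ _) Tx))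

    -- ψ α carries B to a short block, so x and x' lie in one coset of a Sylow subgroup, which has exponent 2.
    conj-involution : ∀ {B} → IsBlock B → ∀ {u y y' x x'} → B u → B y → B y' → Inf (ψ α u) → ψ α y ≡ inj₁ x → ψ α y' ≡ inj₁ x' →
      (x ⁻¹ ∙ x') ∙ (x ⁻¹ ∙ x') ≡ ε
    conj-involution {B} b {u} {y} {y'} {x} {x'} Bu By By' inf ψy ψy' with ψ α u in ψu
    ... | inj₂ T = begin
      (x ⁻¹ ∙ x') ∙ (x ⁻¹ ∙ x')     ≡⟨ assoc (x ⁻¹) x' (x ⁻¹ ∙ x') ⟩
      x ⁻¹ ∙ (x' ∙ (x ⁻¹ ∙ x'))     ≡⟨ cong (x ⁻¹ ∙_) (assoc x' (x ⁻¹) x') ⟨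
      x ⁻¹ ∙ (x' ∙ x ⁻¹ ∙ x')       ≡⟨ cong (λ t → x ⁻¹ ∙ (t ∙ x')) (Sylow-involution T Txx') ⟨
      x ⁻¹ ∙ ((x' ∙ x ⁻¹) ⁻¹ ∙ x')  ≡⟨ cong (λ t → x ⁻¹ ∙ (t ∙ x')) (trans (⁻¹-anti-homo-∙ x' (x ⁻¹)) (cong (_∙ x' ⁻¹) (⁻¹-involutive x))) ⟩
      x ⁻¹ ∙ (x ∙ x' ⁻¹ ∙ x')       ≡⟨ cong (x ⁻¹ ∙_) (xy⁻¹y x x') ⟩
      x ⁻¹ ∙ x                      ≡⟨ inverseˡ x ⟩
      ε                             ∎
      where
      open ≡-Reasoning
      pull : ∀ {z z'} → ψ α z ≡ z' → B z → B (φ α z')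
      pull refl = block≈ b (≈-sym (φψ≈ α))
      Txx' : T ∋ (x' ∙ x ⁻¹)
      Txx' = block-through-infinite (ψ-block α b) {T} {x} {x'} (pull ψu Bu) (pull ψy By) (pull ψy' By')

  -- s ↦ s⁻¹ f(s) is injective on S, hence onto S, and f inverts its values.
  module _ (f : SL → SL) (f-∙ : ∀ x y → f (x ∙ y) ≡ f x ∙ f y) (f-⁻¹ : ∀ x → f (x ⁻¹) ≡ f x ⁻¹)
    (f-involutive : ∀ x → f (f x) ≡ x) (f-S : ∀ {x} → S (proj₁ x) → S (proj₁ (f x)))
    (f-free : ∀ {x} → S (proj₁ x) → f x ≡ x → x ≡ ε) where

    private
      k : SL → SL
      k x = x ⁻¹ ∙ f x

      k∈S : ∀ {y} → ∃[ x ] (S (proj₁ x) × y ≡ k x) → S (proj₁ y)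
      k∈S (x , Sx , y≡kx) = subst (S ∘ proj₁) (sym y≡kx) (S-∙ {x ⁻¹} {f x} (S-⁻¹ {x} Sx) (f-S {x} Sx))

      k-injective : ∀ {x y} → S (proj₁ x) → S (proj₁ y) → k x ≡ k y → x ≡ y
      k-injective {x} {y} Sx Sy eq = xy⁻¹≡ε⇒x≡y (f-free {x ∙ y ⁻¹} (S-∙ {x} {y ⁻¹} Sx (S-⁻¹ {y} Sy)) (begin
        f (x ∙ y ⁻¹)                     ≡⟨ trans (f-∙ x (y ⁻¹)) (cong (f x ∙_) (f-⁻¹ y)) ⟩
        f x ∙ f y ⁻¹                     ≡⟨ cong (_∙ f y ⁻¹) (xx⁻¹y x (f x)) ⟨
        x ∙ k x ∙ f y ⁻¹                 ≡⟨ cong (λ t → x ∙ t ∙ f y ⁻¹) eq ⟩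
        x ∙ (y ⁻¹ ∙ f y) ∙ f y ⁻¹        ≡⟨ cong (_∙ f y ⁻¹) (assoc x (y ⁻¹) (f y)) ⟨
        x ∙ y ⁻¹ ∙ f y ∙ f y ⁻¹          ≡⟨ xyy⁻¹ (x ∙ y ⁻¹) (f y) ⟩
        x ∙ y ⁻¹                         ∎))
        where open ≡-Reasoning

    fixed-point-free-involution-inverts : ∀ {s} → S (proj₁ s) → f s ≡ s ⁻¹
    fixed-point-free-involution-inverts {s} Ss = inverted (Sˡ.Listing-⊆-long⇒⊇ (Listing-map k (λ {x} {y} → k-injective {x} {y}) S-list) S-list (λ {y} → k∈S {y}) ℕ.≤-refl {s} Ss)
      where
      inverted : ∃[ x ] (S (proj₁ x) × s ≡ k x) → f s ≡ s ⁻¹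
      inverted (x , _ , s≡kx) = trans (cong f s≡kx) (trans (f-∙ (x ⁻¹) (f x)) (trans (cong₂ _∙_ (f-⁻¹ x) (f-involutive x))
        (sym (trans (cong _⁻¹ s≡kx) (trans (⁻¹-anti-homo-∙ (x ⁻¹) (f x)) (cong (f x ⁻¹ ∙_) (⁻¹-involutive x)))))))

  -- [∞] does not move to a short block

  module ShortBlock (α : Aut) (T : Sylow p)
    (onT : ∀ x → Inf (ψ α (inj₁ x)) ⇔ₚ (T ∋ x)) (on∞ : ∀ T' → Inf (ψ α (inj₂ T')) ⇔ₚ (proj₁ T ≐ proj₁ T')) where

    v : V
    v = proj₁ (Sylow⇒Stab T)
    v≢0 : v ≢ 𝟎
    v≢0 = proj₁ (proj₂ (Sylow⇒Stab T))
    T≐ : proj₁ T ≐ Stab v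
    T≐ = proj₂ (proj₂ (Sylow⇒Stab T))
    g : SL
    g = proj₁ (∃-moving-e₁ v v≢0)
    e₁g≡v : e₁ ⊙ proj₁ g ≡ v
    e₁g≡v = proj₂ (∃-moving-e₁ v v≢0)

    -- Here v is the first row of g, so the vectors (c, 1) g span pairwise different directions
    -- other than that of v. Thus `Z` parametrizes new points other than T.
    w : Carrier → V
    w c = (c , 1#) ⊙ proj₁ g

    w≢0 : ∀ c → w c ≢ 𝟎
    w≢0 c = ⊙-≢𝟎 g (λ eq → 0≢1 (sym (cong proj₂ eq)))

    Z : Carrier → Sylow p
    Z c = stab (w c) (w≢0 c)

    T≢Z : ∀ c → ¬ (proj₁ T ≐ proj₁ (Z c))
    T≢Z c eq = Independent⇒¬≐ v≢0 (subst (λ u → Independent u (w c)) e₁g≡v (Independent-⊙ {e₁} {c , 1#} g ind)) (≐-trans (≐-sym T≐) eq)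
      where
      ind : Independent e₁ (c , 1#)
      ind eq = 0≢1 (sym (trans (solve 1 (λ c → :1 := :1 :* :1 :+ :- (:0 :* c)) refl c) eq))

    Z-injective : ∀ {c c'} → proj₁ (Z c) ≐ proj₁ (Z c') → c ≡ c'
    Z-injective {c} {c'} eq with c ≟ c'
    ... | yes c≡c' = c≡c'
    ... | no c≢c' = ⊥-elim (Independent⇒¬≐ (w≢0 c) (Independent-⊙ {c , 1#} {c' , 1#} g
      (λ eq → c≢c' (x-y≡0⇒x≡y (trans (solve 2 (λ c c' → c :+ :- c' := c :* :1 :+ :- (:1 :* c')) refl c c') eq)))) eq)

    Z-finite : ∀ c → ¬ Inf (ψ α (inj₂ (Z c)))
    Z-finite c inf = T≢Z c (proj₁ (on∞ (Z c)) inf)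

    ψT-Inf : Inf (ψ α (inj₂ T))
    ψT-Inf = proj₂ (on∞ T) ≐-refl

    abstract
      moving : ∀ c → ∃[ x ] ∃[ x' ] (ψ α (inj₂ (Z 0#)) ≡ inj₁ x × ψ α (inj₂ (Z c)) ≡ inj₁ x' × φ (conjᴬ α (x ⁻¹ ∙ x')) (inj₂ (Z 0#)) ≈ inj₂ (Z c))
      moving c = conj-transitive α (Z-finite 0#) (Z-finite c)

    h : Carrier → SL
    h c = proj₁ (moving c) ⁻¹ ∙ proj₁ (proj₂ (moving c))

    β : Carrier → Aut
    β c = conjᴬ α (h c)

    β-Z : ∀ c → φ (β c) (inj₂ (Z 0#)) ≈ inj₂ (Z c)
    β-Z c = proj₂ (proj₂ (proj₂ (proj₂ (moving c))))

    β-ε : ∀ c → φ (β c) (inj₁ ε) ≈ inj₁ ε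
    β-ε c = conj-fixes α (h c) (proj₂ (onT ε) (∋-ε T))

    -- The image of [∞] under `β c` contains T, which is fixed since it lies on the image of [∞]
    -- under α, and also `Z c`, the image of `Z 0#`. Two different new points lie together on [∞]
    -- only.
    β-fix : ∀ c → Fixes∞ (β c)
    β-fix c = [ ⊥-elim ∘ T≢Z c , ≐block∞⇒Fixes∞ (β c) ]′ (block-through-two-infinite (φ-block (β c) IsBlock-block∞)
      (Inf⇒block∞ (Inf≈ (≈-sym (ψφ≈ (β c)) ⟫ ψ≈ (β c) (conj-fixes α (h c) ψT-Inf)) tt))
      (Inf⇒block∞ (Inf≈ (≈-sym (ψφ≈ (β c)) ⟫ ψ≈ (β c) (β-Z c)) tt)))

    h≢ε : ∀ {c} → c ≢ 0# → h c ≢ ε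
    h≢ε {c} c≢0 eq = c≢0 (sym (Z-injective (un (≈-sym (trivial (h c) eq) ⟫ β-Z c))))
      where
      trivial : ∀ h → h ≡ ε → φ (conjᴬ α h) (inj₂ (Z 0#)) ≈ inj₂ (Z 0#)
      trivial _ refl = φ≈ α (shift-ε (ψ α (inj₂ (Z 0#)))) ⟫ φψ≈ α
        where
        shift-ε : ∀ z → shift ε z ≈ z
        shift-ε (inj₁ x) = ≡⇒≈ (cong inj₁ (identityʳ x))
        shift-ε (inj₂ _) = ≈-refl

    f : Carrier → SL → SL
    f c = aff (β c) (β-fix c)

    f-≈ : ∀ c x → φ (β c) (inj₁ x) ≈ inj₁ (f c x)
    f-≈ c x = mk (aff-≋ (β c) (β-fix c) x)

    f-∙ : ∀ c x y → f c (x ∙ y) ≡ f c x ∙ f c y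
    f-∙ c = aff-homomorphic (β c) (β-fix c) (un (β-ε c))

    f-⁻¹ : ∀ c x → f c (x ⁻¹) ≡ f c x ⁻¹
    f-⁻¹ c = aff-⁻¹ (β c) (β-fix c) (β-ε c)

    -- For c ≠ 0 the conjugated right multiplication is nontrivial, so it fixes no point off α([∞]),
    -- and the affine points of that block form T.
    f-fixed⇒T : ∀ {c} → c ≢ 0# → ∀ {x} → f c x ≡ x → T ∋ x
    f-fixed⇒T {c} c≢0 {x} eq = cases (Inf? (ψ α (inj₁ x)))
      where
      fixed : φ (β c) (inj₁ x) ≈ inj₁ x
      fixed = f-≈ c x ⟫ ≡⇒≈ (cong inj₁ eq)
      cases : Dec (Inf (ψ α (inj₁ x))) → T ∋ x
      cases (yes inf) = proj₁ (onT x) inf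
      cases (no fin) = ⊥-elim (h≢ε c≢0 (conj-free α (h c) {inj₁ x} fin fixed))

    odd-impossible : 1# + 1# ≢ 0# → ⊥
    odd-impossible 2≢0 = -ε∉Stab v≢0 (proj₁ (T≐ _) (f-fixed⇒T {1#} (0≢1 ∘ sym) { -ε}
      (monomorphism-fixes--ε (f 1#) (f-∙ 1#) (λ {x} {y} → aff-injective (β 1#) (β-fix 1#) {x} {y}) (aff-ε (β 1#) (β-fix 1#) (β-ε 1#)))))
      where open OddCharacteristic 2≢0

    module _ (2≡0 : 1# + 1# ≡ 0#) where

      -- T, `Z 0#` and `Z c` are all on [∞], and α⁻¹ sends T to a new point. So the preimage of [∞]
      -- under α is a short block, to which `conj-involution` applies.
      f-involutive : ∀ c x → f c (f c x) ≡ x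
      f-involutive c x = inj₁-injective (≈-sym (f-≈ c (f c x)) ⟫ φ≈ (β c) (≈-sym (f-≈ c x)) ⟫ conj-conj≈ α (h c) {inj₁ x} hh)
        where
        hh : h c ∙ h c ≡ ε
        hh = conj-involution 2≡0 α IsBlock-block∞ {inj₂ T} {inj₂ (Z 0#)} {inj₂ (Z c)} (lift tt) (lift tt) (lift tt) ψT-Inf
          (proj₁ (proj₂ (proj₂ (moving c)))) (proj₁ (proj₂ (proj₂ (proj₂ (moving c)))))

      -- All fixed points of `f c` lie in T, and S meets T in 𝟙 only; so `f c` restricts to an
      -- involutive automorphism of S without nontrivial fixed points.
      f-inverts-S : ∀ {c} → c ≢ 0# → ∀ {s} → S (proj₁ s) → f c s ≡ s ⁻¹
      f-inverts-S {c} c≢0 = fixed-point-free-involution-inverts (f c) (f-∙ c) (f-⁻¹ c) (f-involutive c)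
        (λ {x} → aff-S (β c) (β-fix c) (β-ε c) {x}) (λ {x} Sx eq → SL-≡ (S∩Sylow T Sx (f-fixed⇒T {c} c≢0 {x} eq)))

      even-impossible : ⊥
      even-impossible =
        let c , c≢0 , c≢1 = avoid₂ 0# 1# ; s , Ss , s≢ε = ∃-nontrivial-S
            fin : ¬ Inf (ψ α (inj₁ s))
            fin inf = s≢ε (SL-≡ (S∩Sylow T Ss (proj₁ (onT s) inf)))
            -- Both maps send s to s⁻¹ and s is off T, so their parameters agree, although they send
            -- `Z 0#` to different points.
            h≡ : h 1# ≡ h c
            h≡ = conj-agree α (h 1#) (h c) fin (f-≈ 1# s ⟫ ≡⇒≈ (cong inj₁ (trans (f-inverts-S {1#} (0≢1 ∘ sym) {s} Ss) (sym (f-inverts-S {c} c≢0 {s} Ss)))) ⟫ ≈-sym (f-≈ c s))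
        in c≢1 (sym (Z-injective (un (≈-sym (β-Z 1#) ⟫ ≡⇒≈ (cong (λ h → φ (conjᴬ α h) (inj₂ (Z 0#))) h≡) ⟫ β-Z c))))

    impossible : ⊥
    impossible with (1# + 1#) ≟ 0#
    ... | yes 2≡0 = even-impossible 2≡0
    ... | no 2≢0 = odd-impossible 2≢0

  no-short-image : ∀ α T g → InSL g → ¬ ((block∞ ∘ ψ α) ≐ blockT T g)
  no-short-image α T g gSL eq = ShortBlock.impossible ((right g') ⁻ᴬ ∘ᴬ α) T
    (λ x → let to , from = Coset-cancel (proj₁ T) g' x (λ {M} → proj₁ (proj₁ (proj₂ T)) M) in
      (λ inf → to (Level.lower (proj₁ (eq (inj₁ (x ∙ g'))) (Inf⇒block∞ inf)))) ,
      (λ Tx → block∞⇒Inf (proj₂ (eq (inj₁ (x ∙ g'))) (lift (from Tx)))))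
    (λ T' → (λ inf → Level.lower (proj₁ (eq (inj₂ T')) (Inf⇒block∞ inf))) , (λ T≐T' → block∞⇒Inf (proj₂ (eq (inj₂ T')) (lift T≐T'))))
    where
    g' : SL
    g' = g , gSL

  -- [∞] does not move to a block D g

  blockS-affine : ∀ g {x} → Inf x → ¬ blockS g x
  blockS-affine g {inj₂ _} _ (lift ())

  blockD-affine : ∀ i g {x} → Inf x → ¬ blockD i g x
  blockD-affine i g {inj₂ _} _ (lift ())

  -- For d ∈ D the image of [∞] under `β` contains the new point z, so it is a short block, which is
  -- excluded, or [∞] itself. That `β` fixes [∞] means that x d⁻¹ ∈ D for all x ∈ D, so D would be
  -- closed under quotients.
  no-D-image : ∀ α i g → InSL g → ¬ ((block∞ ∘ ψ α) ≐ blockD i g)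
  no-D-image α i g gSL eq = D-not-closed i closed
    where
    g' : SL
    g' = g , gSL
    α' : Aut
    α' = (right g') ⁻ᴬ ∘ᴬ α
    D-InSL : ∀ {M} → D i M → InSL M
    D-InSL {M} = proj₁ (D-family i) M
    onD⇒ : ∀ x → Inf (ψ α' (inj₁ x)) → D i (proj₁ x)
    onD⇒ x inf = proj₁ (Coset-cancel (D i) g' x D-InSL) (Level.lower (proj₁ (eq (inj₁ (x ∙ g'))) (Inf⇒block∞ inf)))
    onD⇐ : ∀ x → D i (proj₁ x) → Inf (ψ α' (inj₁ x))
    onD⇐ x Dx = block∞⇒Inf (proj₂ (eq (inj₁ (x ∙ g'))) (lift (proj₂ (Coset-cancel (D i) g' x D-InSL) Dx)))
    z : Point
    z = ψ α' (inj₁ ε)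
    z-Inf : Inf z
    z-Inf = onD⇐ ε (proj₁ (proj₂ (D-family i)))
    module _ (d : SL) (Dd : D i (proj₁ d)) where
      β : Aut
      β = α' ⁻ᴬ ∘ᴬ (right d) ⁻ᴬ ∘ᴬ α'
      ψβ-ψ : ∀ x → ψ β (ψ α' (inj₁ x)) ≈ ψ α' (inj₁ (x ∙ d))
      ψβ-ψ x = ψ≈ α' (shift≈ d (φψ≈ α' {inj₁ x}))
      ψβ-z : block∞ (ψ β z)
      ψβ-z = Inf⇒block∞ (Inf≈ (≈-sym (ψβ-ψ ε ⟫ ≡⇒≈ (cong (ψ α' ∘ inj₁) (identityˡ d)))) (onD⇐ d Dd))
      β-fix : Fixes∞ β
      β-fix = cases (φ-block β IsBlock-block∞)
        where
        cases : IsBlock (block∞ ∘ ψ β) → Fixes∞ β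
        cases (inj₁ (h , _ , eq')) = ⊥-elim (blockS-affine h z-Inf (proj₁ (eq' z) ψβ-z))
        cases (inj₂ (inj₁ (T , h , hSL , eq'))) = ⊥-elim (no-short-image β T h hSL eq')
        cases (inj₂ (inj₂ (inj₁ (j , h , _ , eq')))) = ⊥-elim (blockD-affine j h z-Inf (proj₁ (eq' z) ψβ-z))
        cases (inj₂ (inj₂ (inj₂ eq'))) = ≐block∞⇒Fixes∞ β eq'
      quotient : ∀ x → D i (proj₁ x) → D i (proj₁ (x ∙ d ⁻¹))
      quotient x Dx = onD⇒ (x ∙ d ⁻¹) (proj₁ (β-fix (ψ α' (inj₁ (x ∙ d ⁻¹))))
        (Inf≈ (≈-sym (ψβ-ψ (x ∙ d ⁻¹) ⟫ ≡⇒≈ (cong (ψ α' ∘ inj₁) (xy⁻¹y x d)))) (onD⇐ x Dx)))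
    closed : ∀ x y → D i x → D i y → D i (x · inv y)
    closed x y Dx Dy = quotient (y , D-InSL Dy) Dy (x , D-InSL Dx) Dx

  image-of-∞ : ∀ α → Fixes∞ α ⊎ (∃[ g ] ((block∞ ∘ ψ α) ≐ blockS (proj₁ {B = InSL} g)))
  image-of-∞ α with φ-block α IsBlock-block∞
  ... | inj₁ (g , gSL , eq) = inj₂ ((g , gSL) , eq)
  ... | inj₂ (inj₁ (T , g , gSL , eq)) = ⊥-elim (no-short-image α T g gSL eq)
  ... | inj₂ (inj₂ (inj₁ (i , g , gSL , eq))) = ⊥-elim (no-D-image α i g gSL eq)
  ... | inj₂ (inj₂ (inj₂ eq)) = inj₁ (≐block∞⇒Fixes∞ α eq)

  -- [∞] does not move to a block S g

  infix 4 _∼_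
  -- The equivalence relation with classes [∞] and the cosets S g. The blocks S g partition SL(2,q),
  -- and by `image-of-∞` no other block can be an image of [∞].
  _∼_ : Point → Point → Set
  inj₁ x ∼ inj₁ y = S (proj₁ (x ∙ y ⁻¹))
  inj₂ _ ∼ inj₂ _ = ⊤
  _ ∼ _ = ⊥

  Inf-∼ : ∀ {x y} → Inf x → Inf y → x ∼ y
  Inf-∼ {inj₂ _} {inj₂ _} _ _ = tt

  ∼-Inf : ∀ {x y} → x ∼ y → Inf x → Inf y
  ∼-Inf {inj₂ _} {inj₂ _} _ _ = tt

  ∼-sym : ∀ {x y} → x ∼ y → y ∼ x
  ∼-sym {inj₁ x} {inj₁ y} s = subst (S ∘ proj₁) (trans (⁻¹-anti-homo-∙ x (y ⁻¹)) (cong (_∙ x ⁻¹) (⁻¹-involutive y))) (S-⁻¹ {x ∙ y ⁻¹} s)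
  ∼-sym {inj₂ _} {inj₂ _} _ = tt

  ∼-trans : ∀ {x y z} → x ∼ y → y ∼ z → x ∼ z
  ∼-trans {inj₁ x} {inj₁ y} {inj₁ z} s s' = subst (S ∘ proj₁) (trans (sym (assoc (x ∙ y ⁻¹) y (z ⁻¹))) (cong (_∙ z ⁻¹) (xy⁻¹y x y))) (S-∙ {x ∙ y ⁻¹} {y ∙ z ⁻¹} s s')
  ∼-trans {inj₂ _} {inj₂ _} {inj₂ _} _ _ = tt

  ≈⇒∼ : ∀ {x y} → x ≈ y → x ∼ y
  ≈⇒∼ {inj₁ x} {inj₁ y} (mk eq) = subst (S ∘ proj₁) (trans (sym (inverseʳ y)) (cong (_∙ y ⁻¹) (SL-≡ {y} {x} (sym eq)))) S-ε
  ≈⇒∼ {inj₂ _} {inj₂ _} _ = tt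

  ∼-resp : ∀ {x x' y y'} → x ≈ x' → y ≈ y' → x ∼ y → x' ∼ y'
  ∼-resp {x} {x'} {y} {y'} eq eq' r = ∼-trans {x'} {x} {y'} (≈⇒∼ (≈-sym eq)) (∼-trans {x} {y} {y'} r (≈⇒∼ eq'))

  φ-Inf-∼ : ∀ β {z z'} → Inf z → Inf z' → φ β z ∼ φ β z'
  φ-Inf-∼ β {z} {z'} inf inf' = cases (image-of-∞ β)
    where
    same : ∀ {g y y'} → blockS (proj₁ {B = InSL} g) y → blockS (proj₁ g) y' → y ∼ y'
    same {g} {inj₁ y} {inj₁ y'} (lift (s , Ss , y≡sg)) (lift (s' , Ss' , y'≡s'g)) =
      subst (S ∘ proj₁) quotient (S-∙ {σ} {σ' ⁻¹} Ss (S-⁻¹ {σ'} Ss'))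
      where
      σ σ' : SL
      σ = s , S-InSL Ss
      σ' = s' , S-InSL Ss'
      open ≡-Reasoning
      quotient : σ ∙ σ' ⁻¹ ≡ y ∙ y' ⁻¹
      quotient = begin
        σ ∙ σ' ⁻¹                   ≡⟨ cong (_∙ σ' ⁻¹) (xyy⁻¹ σ g) ⟨
        σ ∙ g ∙ g ⁻¹ ∙ σ' ⁻¹        ≡⟨ assoc (σ ∙ g) (g ⁻¹) (σ' ⁻¹) ⟩
        σ ∙ g ∙ (g ⁻¹ ∙ σ' ⁻¹)      ≡⟨ cong (σ ∙ g ∙_) (⁻¹-anti-homo-∙ σ' g) ⟨
        σ ∙ g ∙ (σ' ∙ g) ⁻¹         ≡⟨ cong₂ (λ s t → s ∙ t ⁻¹) (SL-≡ {σ ∙ g} {y} (sym y≡sg)) (SL-≡ {σ' ∙ g} {y'} (sym y'≡s'g)) ⟩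
        y ∙ y' ⁻¹                   ∎
    pulled : ∀ {z} → Inf z → block∞ (ψ β (φ β z))
    pulled inf = Inf⇒block∞ (Inf≈ (≈-sym (ψφ≈ β)) inf)
    cases : Fixes∞ β ⊎ (∃[ g ] ((block∞ ∘ ψ β) ≐ blockS (proj₁ {B = InSL} g))) → φ β z ∼ φ β z'
    cases (inj₁ fix) = Inf-∼ (proj₂ (Fixes∞-φ β fix z) inf) (proj₂ (Fixes∞-φ β fix z') inf')
    cases (inj₂ (g , eq)) = same {g} {φ β z} {φ β z'} (proj₁ (eq (φ β z)) (pulled inf)) (proj₁ (eq (φ β z')) (pulled inf'))

  module MovedToS (α : Aut) (onS : ∀ x → Inf (ψ α (inj₁ x)) ⇔ₚ S (proj₁ x)) (off∞ : ∀ T → ¬ Inf (ψ α (inj₂ T))) where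

    -- The class S y is the image of [∞] under `right y ∘ᴬ α`, so precomposing with this map reduces
    -- the claim to images of [∞].
    φ-∼ : ∀ β {x y} → x ∼ y → φ β x ∼ φ β y
    φ-∼ β {inj₂ T} {inj₂ T'} _ = φ-Inf-∼ β {inj₂ T} {inj₂ T'} tt tt
    φ-∼ β {inj₁ x} {inj₁ y} s = ∼-resp (φ≈ β z≈x) (φ≈ β z'≈y) (φ-Inf-∼ (β ∘ᴬ γ) {z} {z'} (proj₂ (onS (x ∙ y ⁻¹)) s) (proj₂ (onS ε) S-ε))
      where
      γ : Aut
      γ = right y ∘ᴬ α
      z z' : Point
      z = ψ α (inj₁ (x ∙ y ⁻¹))
      z' = ψ α (inj₁ ε)
      z≈x : φ γ z ≈ inj₁ x
      z≈x = shift≈ y (φψ≈ α {inj₁ (x ∙ y ⁻¹)}) ⟫ ≡⇒≈ (cong inj₁ (xy⁻¹y x y))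
      z'≈y : φ γ z' ≈ inj₁ y
      z'≈y = shift≈ y (φψ≈ α {inj₁ ε}) ⟫ ≡⇒≈ (cong inj₁ (identityˡ y))

    -- Automorphisms permute the classes of `_∼_` and [∞] is one class, so a single point decides.
    Fixes∞-one : ∀ β {z} → Inf z → Inf (φ β z) → Fixes∞ β
    Fixes∞-one β {z} inf inf' y =
      (λ ψy-inf → ∼-Inf (∼-resp (≈-refl {φ β z}) (φψ≈ β {y}) (φ-∼ β {z} {ψ β y} (Inf-∼ inf ψy-inf))) inf') ,
      (λ y-inf → ∼-Inf (∼-resp (ψφ≈ β {z}) (≈-refl {ψ β y}) (φ-∼ (β ⁻ᴬ) {φ β z} {y} (Inf-∼ inf' y-inf))) inf)

    ψ-∼-self : ∀ β → (∀ y → φ β y ∼ y) → ∀ y → ψ β y ∼ y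
    ψ-∼-self β self y = ∼-sym {y} {ψ β y} (∼-resp (φψ≈ β {y}) (≈-refl {ψ β y}) (self (ψ β y)))

    Fixes∞-self : ∀ β → (∀ y → φ β y ∼ y) → Fixes∞ β
    Fixes∞-self β self y = ∼-Inf (ψ-∼-self β self y) , ∼-Inf (∼-sym {ψ β y} {y} (ψ-∼-self β self y))

    T₀ : Sylow p
    T₀ = stab e₁ e₁≢𝟎

    T₀∋lower : ∀ c → T₀ ∋ lower c
    T₀∋lower c = proj₂ (lower c) , e₁-⊙

    lower-injective : ∀ {c c'} → lower c ≡ lower c' → c ≡ c'
    lower-injective eq = cong (Mat.c ∘ proj₁) eq

    lower≢ε : ∀ {c} → c ≢ 0# → lower c ≢ ε
    lower≢ε c≢0 eq = c≢0 (cong (Mat.c ∘ proj₁) eq)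

    module Odd (2≢0 : 1# + 1# ≢ 0#) where
      open OddCharacteristic 2≢0

      -ε-central : ∀ x → x ∙ -ε ≡ -ε ∙ x
      -ε-central (mat a b c d , _) = SL-≡ (mat-≡
        (solve 4 (λ a b c d → a :* :- :1 :+ b :* :0 := :- :1 :* a :+ :0 :* c) refl a b c d) (solve 4 (λ a b c d → a :* :0 :+ b :* :- :1 := :- :1 :* b :+ :0 :* d) refl a b c d)
        (solve 4 (λ a b c d → c :* :- :1 :+ d :* :0 := :0 :* a :+ :- :1 :* c) refl a b c d) (solve 4 (λ a b c d → c :* :0 :+ d :* :- :1 := :0 :* b :+ :- :1 :* d) refl a b c d))

      σ : Aut
      σ = conjᴬ α -ε

      shift--ε-∼ : ∀ y → shift -ε y ∼ y
      shift--ε-∼ (inj₁ x) = subst (S ∘ proj₁) (sym (trans (cong (_∙ x ⁻¹) (-ε-central x)) (xyy⁻¹ -ε x))) -ε∈S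
      shift--ε-∼ (inj₂ _) = tt

      -- As -𝟙 is central and lies in S, multiplication by it maps every class to itself;
      -- conjugation by α, which permutes the classes, keeps this property.
      σ-∼ : ∀ y → φ σ y ∼ y
      σ-∼ y = ∼-resp (≈-refl {φ σ y}) (φψ≈ α {y}) (φ-∼ α {shift -ε (ψ α y)} {ψ α y} (shift--ε-∼ (ψ α y)))

      σ-fix : Fixes∞ σ
      σ-fix = Fixes∞-self σ σ-∼

      σ-ε : φ σ (inj₁ ε) ≈ inj₁ ε
      σ-ε = conj-fixes α -ε {inj₁ ε} (proj₂ (onS ε) S-ε)

      f : SL → SL
      f = aff σ σ-fix

      f-≈ : ∀ x → φ σ (inj₁ x) ≈ inj₁ (f x)
      f-≈ x = mk (aff-≋ σ σ-fix x)

      f-∙ : ∀ x y → f (x ∙ y) ≡ f x ∙ f y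
      f-∙ = aff-homomorphic σ σ-fix (un σ-ε)

      deviation : SL → SL
      deviation x = f x ∙ x ⁻¹

      deviation∈S : ∀ x → S (proj₁ (deviation x))
      deviation∈S x = ∼-resp {φ σ (inj₁ x)} {inj₁ (f x)} {inj₁ x} {inj₁ x} (f-≈ x) ≈-refl (σ-∼ (inj₁ x))

      -- Because f is multiplicative, the conjugate of `deviation h` by g is
      -- `deviation g ⁻¹ ∙ deviation (g ∙ h)`, a product of elements of S.
      deviation-Core : ∀ h → Core (deviation h)
      deviation-Core h g = subst (S ∘ proj₁) eq (S-∙ {deviation g ⁻¹} {deviation (g ∙ h)} (S-⁻¹ {deviation g} (deviation∈S g)) (deviation∈S (g ∙ h)))
        where
        open ≡-Reasoning
        eq : deviation g ⁻¹ ∙ deviation (g ∙ h) ≡ g ∙ deviation h ∙ g ⁻¹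
        eq = begin
          deviation g ⁻¹ ∙ (f (g ∙ h) ∙ (g ∙ h) ⁻¹)               ≡⟨ cong₂ (λ s t → deviation g ⁻¹ ∙ (s ∙ t)) (f-∙ g h) (⁻¹-anti-homo-∙ g h) ⟩
          deviation g ⁻¹ ∙ (f g ∙ f h ∙ (h ⁻¹ ∙ g ⁻¹))            ≡⟨ cong₂ _∙_ (trans (⁻¹-anti-homo-∙ (f g) (g ⁻¹)) (cong (_∙ f g ⁻¹) (⁻¹-involutive g))) (sym (assoc (f g ∙ f h) (h ⁻¹) (g ⁻¹))) ⟩
          g ∙ f g ⁻¹ ∙ (f g ∙ f h ∙ h ⁻¹ ∙ g ⁻¹)                  ≡⟨ assoc (g ∙ f g ⁻¹) (f g ∙ f h ∙ h ⁻¹) (g ⁻¹) ⟨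
          g ∙ f g ⁻¹ ∙ (f g ∙ f h ∙ h ⁻¹) ∙ g ⁻¹                  ≡⟨ cong (λ t → g ∙ f g ⁻¹ ∙ t ∙ g ⁻¹) (assoc (f g) (f h) (h ⁻¹)) ⟩
          g ∙ f g ⁻¹ ∙ (f g ∙ deviation h) ∙ g ⁻¹                 ≡⟨ cong (_∙ g ⁻¹) (assoc (g ∙ f g ⁻¹) (f g) (deviation h)) ⟨
          g ∙ f g ⁻¹ ∙ f g ∙ deviation h ∙ g ⁻¹                   ≡⟨ cong (λ t → t ∙ deviation h ∙ g ⁻¹) (xy⁻¹y g (f g)) ⟩
          g ∙ deviation h ∙ g ⁻¹                                  ∎

      t : SL
      t = lower 1#

      -- The transvection t is not in S, and off S a fixed point of `σ` would force -𝟙 = 𝟙.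
      ft≢t : f t ≢ t
      ft≢t eq = cases (Inf? (ψ α (inj₁ t)))
        where
        cases : Dec (Inf (ψ α (inj₁ t))) → ⊥
        cases (yes inf) = lower≢ε (0≢1 ∘ sym) (SL-≡ {t} {ε} (S∩Stab {e₁} e₁≢𝟎 (proj₁ (onS t) inf) e₁-⊙))
        cases (no fin) = -ε≢ε (conj-free α -ε {inj₁ t} fin (f-≈ t ⟫ ≡⇒≈ (cong inj₁ eq)))

      -- `σ` fixes [∞], so f maps T₀ into some Sylow subgroup. Hence f t has trace 2, unlike -t.
      ft≢-t : f t ≢ t ∙ -ε
      ft≢-t eq = cases (φ σ (inj₂ T₀)) refl
        where
        cases : ∀ z → φ σ (inj₂ T₀) ≡ z → ⊥
        cases (inj₁ _) φT≡z = subst Inf φT≡z (proj₂ (Fixes∞-φ σ σ-fix (inj₂ T₀)) tt)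
        cases (inj₂ T') φT≡T' = let v , v≢0 , T'≐ = Sylow⇒Stab T' in
          trace-neg≢2 {proj₁ t} refl (trans (cong (trace ∘ proj₁) (sym eq)) (Stab⇒trace≡2 {M = proj₁ (f t)} v≢0 (proj₁ (T'≐ _) T'∋ft)))
          where
          T'∋ft : T' ∋ f t
          T'∋ft = subst (T' ∋_) (trans (cong (λ s → f t ∙ s ⁻¹) (aff-ε σ σ-fix σ-ε)) (trans (cong (f t ∙_) ε⁻¹≈ε) (identityʳ (f t))))
            (aff-coset σ σ-fix {T₀} {T'} (≋-reflexive φT≡T') {ε} {t} (subst (T₀ ∋_) (sym (trans (cong (t ∙_) ε⁻¹≈ε) (identityʳ t))) (T₀∋lower 1#)))

      impossible : ⊥
      impossible = [ (λ eq → ft≢t (xy⁻¹≡ε⇒x≡y eq)) ,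
                     (λ eq → ft≢-t (trans (sym (xy⁻¹y (f t) t)) (trans (cong (_∙ t) eq) (sym (-ε-central t))))) ]′
        (Core⇒±ε (deviation t) (deviation-Core t))

    module Even (2≡0 : 1# + 1# ≡ 0#) where
      open EvenCharacteristic 2≡0 S∩Stab

      Stab-• : ∀ {k v} → k ≢ 0# → Stab (k • v) ≐ Stab v
      Stab-• {k} {v} k≢0 M =
        (λ (MSL , fix) → MSL , •-cancelˡ k≢0 (trans (sym (•-⊙ k v M)) fix)) ,
        (λ (MSL , fix) → MSL , trans (•-⊙ k v M) (cong (k •_) fix))

      -- The conjugate s⁻¹ T₀ s. By `S-transitive` every new point is of this form with s ∈ S.
      Z : SL → Sylow p
      Z s = stab (e₁ ⊙ proj₁ s) (⊙-≢𝟎 s e₁≢𝟎)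

      Z-≡ : ∀ {s s'} → s ≡ s' → proj₁ (Z s) ≐ proj₁ (Z s')
      Z-≡ refl = ≐-refl

      Sylow⇒Z : ∀ T → ∃[ s ] (S (proj₁ s) × (proj₁ T ≐ proj₁ (Z s)))
      Sylow⇒Z T = let v , v≢0 , T≐ = Sylow⇒Stab T in go v T≐ (S-transitive {e₁} {v} e₁≢𝟎 v≢0)
        where
        go : ∀ v → proj₁ T ≐ Stab v → ∃[ s ] ∃[ k ] (S (proj₁ {B = InSL} s) × k ≢ 0# × v ≡ k • (e₁ ⊙ proj₁ s)) →
          ∃[ s ] (S (proj₁ s) × (proj₁ T ≐ proj₁ (Z s)))
        go _ T≐ (s , k , Ss , k≢0 , refl) = s , Ss , ≐-trans T≐ (Stab-• k≢0)

      t : SL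
      t = lower 1#

      t≢ε : t ≢ ε
      t≢ε = lower≢ε (0≢1 ∘ sym)

      -- A conjugate `β` of a right multiplication fixes S pointwise and sends T₀ to r T₀ r⁻¹. It
      -- turns out to act as x ↦ r x r⁻¹, so that following it by right multiplication with r gives
      -- left multiplication by r.
      module LeftMultiplication (r : SL) (Sr : S (proj₁ r)) where

        moving : ∃[ x ] ∃[ x' ] (ψ α (inj₂ T₀) ≡ inj₁ x × ψ α (inj₂ (Z (r ⁻¹))) ≡ inj₁ x' × φ (conjᴬ α (x ⁻¹ ∙ x')) (inj₂ T₀) ≈ inj₂ (Z (r ⁻¹)))
        moving = conj-transitive α {inj₂ T₀} {inj₂ (Z (r ⁻¹))} (off∞ T₀) (off∞ (Z (r ⁻¹)))

        h : SL
        h = proj₁ moving ⁻¹ ∙ proj₁ (proj₂ moving)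

        β : Aut
        β = conjᴬ α h

        β-T₀ : φ β (inj₂ T₀) ≈ inj₂ (Z (r ⁻¹))
        β-T₀ = proj₂ (proj₂ (proj₂ (proj₂ moving)))

        β-fix : Fixes∞ β
        β-fix = Fixes∞-one β {inj₂ T₀} tt (Inf≈ (≈-sym β-T₀) tt)

        β-S : ∀ s → S (proj₁ s) → φ β (inj₁ s) ≈ inj₁ s
        β-S s Ss = conj-fixes α h {inj₁ s} (proj₂ (onS s) Ss)

        f : SL → SL
        f = aff β β-fix

        f-≈ : ∀ x → φ β (inj₁ x) ≈ inj₁ (f x)
        f-≈ x = mk (aff-≋ β β-fix x)

        f-∙ : ∀ x y → f (x ∙ y) ≡ f x ∙ f y
        f-∙ = aff-homomorphic β β-fix (un (β-S ε S-ε))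

        f-ε : f ε ≡ ε
        f-ε = aff-ε β β-fix (β-S ε S-ε)

        f-S : ∀ s → S (proj₁ s) → f s ≡ s
        f-S s Ss = inj₁-injective (≈-sym (f-≈ s) ⟫ β-S s Ss)

        f-Sylow : ∀ {T T'} → φ β (inj₂ T) ≈ inj₂ T' → ∀ {x} → T ∋ x → T' ∋ f x
        f-Sylow {T} {T'} eq {x} Tx = subst (T' ∋_) (trans (cong (λ s → f x ∙ s ⁻¹) f-ε) (trans (cong (f x ∙_) ε⁻¹≈ε) (identityʳ (f x))))
          (aff-coset β β-fix {T} {T'} (un eq) {ε} {x} (subst (T ∋_) (sym (trans (cong (x ∙_) ε⁻¹≈ε) (identityʳ x))) Tx))

        conj-t : SL → SL
        conj-t s = s ⁻¹ ∙ t ∙ s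

        conj-t≢ε : ∀ s → conj-t s ≢ ε
        conj-t≢ε s eq = t≢ε (∙-cancelˡ (s ⁻¹) t ε (∙-cancelʳ s (s ⁻¹ ∙ t) (s ⁻¹ ∙ ε) (trans eq (sym (trans (cong (_∙ s) (identityʳ (s ⁻¹))) (inverseˡ s))))))

        Z∋conj : ∀ (r s x : SL) → Z r ∋ x → Z (r ∙ s) ∋ (s ⁻¹ ∙ x ∙ s)
        Z∋conj r s x (_ , fix) = proj₂ (s ⁻¹ ∙ x ∙ s) , (begin
          e₁ ⊙ proj₁ (r ∙ s) ⊙ proj₁ (s ⁻¹ ∙ x ∙ s)                  ≡⟨ ⊙-· e₁ (proj₁ (r ∙ s)) (proj₁ (s ⁻¹ ∙ x ∙ s)) ⟨
          e₁ ⊙ proj₁ (r ∙ s ∙ (s ⁻¹ ∙ x ∙ s))                        ≡⟨ cong (λ y → e₁ ⊙ proj₁ y) eq ⟩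
          e₁ ⊙ proj₁ (r ∙ x ∙ s)                                     ≡⟨ ⊙-· e₁ (proj₁ (r ∙ x)) (proj₁ s) ⟩
          e₁ ⊙ proj₁ (r ∙ x) ⊙ proj₁ s                               ≡⟨ cong (_⊙ proj₁ s) (trans (⊙-· e₁ (proj₁ r) (proj₁ x)) fix) ⟩
          e₁ ⊙ proj₁ r ⊙ proj₁ s                                     ≡⟨ ⊙-· e₁ (proj₁ r) (proj₁ s) ⟨
          e₁ ⊙ proj₁ (r ∙ s)                                         ∎)
          where
          open ≡-Reasoning
          eq : r ∙ s ∙ (s ⁻¹ ∙ x ∙ s) ≡ r ∙ x ∙ s
          eq = begin
            r ∙ s ∙ (s ⁻¹ ∙ x ∙ s)     ≡⟨ cong (r ∙ s ∙_) (assoc (s ⁻¹) x s) ⟩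
            r ∙ s ∙ (s ⁻¹ ∙ (x ∙ s))   ≡⟨ assoc r s (s ⁻¹ ∙ (x ∙ s)) ⟩
            r ∙ (s ∙ (s ⁻¹ ∙ (x ∙ s))) ≡⟨ cong (r ∙_) (xx⁻¹y s (x ∙ s)) ⟩
            r ∙ (x ∙ s)                ≡⟨ assoc r x s ⟨
            r ∙ x ∙ s                  ∎

        f-conj-t : ∀ s → S (proj₁ s) → f (conj-t s) ≡ s ⁻¹ ∙ f t ∙ s
        f-conj-t s Ss = trans (f-∙ (s ⁻¹ ∙ t) s) (cong₂ _∙_ (trans (f-∙ (s ⁻¹) t) (cong (_∙ f t) (f-S (s ⁻¹) (S-⁻¹ {s} Ss)))) (f-S s Ss))

        Z-ε : proj₁ (Z ε) ≐ proj₁ T₀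
        Z-ε = subst (λ v → Stab v ≐ Stab e₁) (sym (⊙-𝟙 e₁)) ≐-refl

        -- f fixes S pointwise, so it commutes with conjugation by s. Hence the nontrivial element
        -- s⁻¹ t s of `Z s` goes to s⁻¹ (f t) s, which lies in `Z (r ⁻¹ ∙ s)` and thereby determines
        -- the image.
        β-Z : ∀ s → S (proj₁ s) → φ β (inj₂ (Z s)) ≈ inj₂ (Z (r ⁻¹ ∙ s))
        β-Z s Ss = cases (φ β (inj₂ (Z s))) refl
          where
          cases : ∀ z → φ β (inj₂ (Z s)) ≡ z → φ β (inj₂ (Z s)) ≈ inj₂ (Z (r ⁻¹ ∙ s))
          cases (inj₁ _) eq = ⊥-elim (subst Inf eq (proj₂ (Fixes∞-φ β β-fix (inj₂ (Z s))) tt))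
          cases (inj₂ T') eq = ≡⇒≈ eq ⟫ mk (Sylow-≐ T' (Z (r ⁻¹ ∙ s)) {proj₁ (f (conj-t s))} nontrivial
            (f-Sylow {Z s} {T'} (≡⇒≈ eq) {conj-t s} (subst (λ y → Z y ∋ conj-t s) (identityˡ s) (Z∋conj ε s t (proj₂ (Z-ε (proj₁ t)) (T₀∋lower 1#)))))
            (subst (Z (r ⁻¹ ∙ s) ∋_) (sym (f-conj-t s Ss)) (Z∋conj (r ⁻¹) s (f t) (f-Sylow {T₀} {Z (r ⁻¹)} β-T₀ {t} (T₀∋lower 1#)))))
            where
            nontrivial : proj₁ (f (conj-t s)) ≢ 𝟙
            nontrivial eq' = conj-t≢ε s (aff-injective β β-fix (trans (SL-≡ eq') (sym f-ε)))

        twisted : SL → SL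
        twisted x = r ⁻¹ ∙ f x ∙ r

        twisted-injective : ∀ {x y} → twisted x ≡ twisted y → x ≡ y
        twisted-injective {x} {y} eq = aff-injective β β-fix {x} {y} (∙-cancelˡ (r ⁻¹) (f x) (f y) (∙-cancelʳ r (r ⁻¹ ∙ f x) (r ⁻¹ ∙ f y) eq))

        twisted-ε : twisted ε ≡ ε
        twisted-ε = trans (cong (λ s → r ⁻¹ ∙ s ∙ r) f-ε) (trans (cong (_∙ r) (identityʳ (r ⁻¹))) (inverseˡ r))

        -- f maps right cosets of `Z s` to right cosets of `Z (r ⁻¹ ∙ s)`, and conjugation undoes
        -- the shift of the label because r⁻¹ s = s r⁻¹ in the abelian group S.
        twisted-Z : ∀ s → S (proj₁ s) → ∀ x y → (e₁ ⊙ proj₁ s) ⊙ proj₁ x ≡ (e₁ ⊙ proj₁ s) ⊙ proj₁ y →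
          (e₁ ⊙ proj₁ s) ⊙ proj₁ (twisted x) ≡ (e₁ ⊙ proj₁ s) ⊙ proj₁ (twisted y)
        twisted-Z s Ss x y eq = trans (expand x) (trans (cong (_⊙ proj₁ r) coset) (sym (expand y)))
          where
          u : V
          u = e₁ ⊙ proj₁ (r ⁻¹ ∙ s)
          coset : u ⊙ proj₁ (f x) ≡ u ⊙ proj₁ (f y)
          coset = ⊙-quotient⇐ u (f x) (f y) (proj₂ (aff-coset β β-fix {Z s} {Z (r ⁻¹ ∙ s)} (un (β-Z s Ss)) {x} {y}
            (proj₂ (y ∙ x ⁻¹) , ⊙-quotient⇒ (e₁ ⊙ proj₁ s) x y eq)))
          expand : ∀ z → (e₁ ⊙ proj₁ s) ⊙ proj₁ (twisted z) ≡ u ⊙ proj₁ (f z) ⊙ proj₁ r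
          expand z = begin
            (e₁ ⊙ proj₁ s) ⊙ proj₁ (r ⁻¹ ∙ f z ∙ r)                        ≡⟨ ⊙-· (e₁ ⊙ proj₁ s) (proj₁ (r ⁻¹ ∙ f z)) (proj₁ r) ⟩
            (e₁ ⊙ proj₁ s) ⊙ proj₁ (r ⁻¹ ∙ f z) ⊙ proj₁ r                  ≡⟨ cong (_⊙ proj₁ r) (⊙-· (e₁ ⊙ proj₁ s) (proj₁ (r ⁻¹)) (proj₁ (f z))) ⟩
            (e₁ ⊙ proj₁ s) ⊙ proj₁ (r ⁻¹) ⊙ proj₁ (f z) ⊙ proj₁ r          ≡⟨ cong (λ w → w ⊙ proj₁ (f z) ⊙ proj₁ r) (⊙-· e₁ (proj₁ s) (proj₁ (r ⁻¹))) ⟨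
            e₁ ⊙ proj₁ (s ∙ r ⁻¹) ⊙ proj₁ (f z) ⊙ proj₁ r                  ≡⟨ cong (λ w → e₁ ⊙ proj₁ w ⊙ proj₁ (f z) ⊙ proj₁ r) (S-commutative {s} {r ⁻¹} Ss (S-⁻¹ {r} Sr)) ⟩
            u ⊙ proj₁ (f z) ⊙ proj₁ r                                      ∎
            where open ≡-Reasoning

        twisted-respects : ∀ v x y → v ≢ 𝟎 → v ⊙ proj₁ x ≡ v ⊙ proj₁ y → v ⊙ proj₁ (twisted x) ≡ v ⊙ proj₁ (twisted y)
        twisted-respects v x y v≢0 eq = go (S-transitive {e₁} {v} e₁≢𝟎 v≢0)
          where
          go : ∃[ s ] ∃[ k ] (S (proj₁ {B = InSL} s) × k ≢ 0# × v ≡ k • (e₁ ⊙ proj₁ s)) → v ⊙ proj₁ (twisted x) ≡ v ⊙ proj₁ (twisted y)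
          go (s , k , Ss , k≢0 , refl) = trans (•-⊙ k w (proj₁ (twisted x))) (trans
            (cong (k •_) (twisted-Z s Ss x y (•-cancelˡ k≢0 (trans (sym (•-⊙ k w (proj₁ x))) (trans eq (•-⊙ k w (proj₁ y)))))))
            (sym (•-⊙ k w (proj₁ (twisted y)))))
            where
            w : V
            w = e₁ ⊙ proj₁ s

        fx∙r≡r∙x : ∀ x → f x ∙ r ≡ r ∙ x
        fx∙r≡r∙x x = begin
          f x ∙ r                   ≡⟨ xx⁻¹y r (f x ∙ r) ⟨
          r ∙ (r ⁻¹ ∙ (f x ∙ r))    ≡⟨ cong (r ∙_) (assoc (r ⁻¹) (f x) r) ⟨
          r ∙ twisted x             ≡⟨ cong (r ∙_) (Rigidity.f≡id twisted (λ {x} {y} → twisted-injective {x} {y}) twisted-ε twisted-respects x) ⟩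
          r ∙ x                     ∎
          where open ≡-Reasoning

        Λ : Aut
        Λ = right r ∘ᴬ β

        Λ-affine : ∀ x → φ Λ (inj₁ x) ≈ inj₁ (r ∙ x)
        Λ-affine x = shift≈ r (f-≈ x) ⟫ ≡⇒≈ (cong inj₁ (fx∙r≡r∙x x))

        Λ-∼ : ∀ y → φ Λ y ∼ y
        Λ-∼ (inj₁ x) = ∼-resp {inj₁ (r ∙ x)} {φ Λ (inj₁ x)} {inj₁ x} {inj₁ x} (≈-sym (Λ-affine x)) ≈-refl (subst (S ∘ proj₁) (sym (xyy⁻¹ r x)) Sr)
        Λ-∼ (inj₂ T) = Inf-∼ {φ Λ (inj₂ T)} {inj₂ T} (Inf≈ (≈-sym (shift-Inf≈ r β-inf)) β-inf) tt
          where
          β-inf : Inf (φ β (inj₂ T))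
          β-inf = proj₂ (Fixes∞-φ β β-fix (inj₂ T)) tt

        Λ-T₀ : φ Λ (inj₂ T₀) ≈ inj₂ (Z (r ⁻¹))
        Λ-T₀ = shift≈ r β-T₀

      shift-cancel : ∀ h y → shift h (shift (h ⁻¹) y) ≈ y
      shift-cancel h y = φψ≈ (right h) {y}

      -- The commutator with right h fixes [∞] pointwise, so it is a right multiplication by an element of the core of S.
      module Commute (n : Aut) (n-∼ : ∀ y → φ n y ∼ y) (h : SL) where

        n-fix : Fixes∞ n
        n-fix = Fixes∞-self n n-∼

        c : Aut
        c = n ⁻ᴬ ∘ᴬ (right h) ⁻ᴬ ∘ᴬ n ∘ᴬ right h

        c-∼ : ∀ y → φ c y ∼ y
        c-∼ y = ∼-trans {φ c y} {w} {y} (ψ-∼-self n n-∼ w)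
          (∼-resp {w} {w} {shift (h ⁻¹) (shift h y)} {y} ≈-refl (ψφ≈ (right h) {y}) (φ-∼ ((right h) ⁻ᴬ) {φ n (shift h y)} {shift h y} (n-∼ (shift h y))))
          where
          w : Point
          w = shift (h ⁻¹) (φ n (shift h y))

        c-fix : Fixes∞ c
        c-fix = Fixes∞-self c c-∼

        c-Inf : ∀ y → Inf y → φ c y ≈ y
        c-Inf y inf = ψ≈ n (shift≈ (h ⁻¹) (φ≈ n (shift-Inf≈ h inf)) ⟫ shift-Inf≈ (h ⁻¹) (proj₂ (Fixes∞-φ n n-fix y) inf)) ⟫ ψφ≈ n {y}

        k : SL
        k = aff c c-fix ε

        -- Normalized to fix ε, as `rigid` requires; hence c acts on SL(2,q) as x ↦ x k.
        c' : Aut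
        c' = (right k) ⁻ᴬ ∘ᴬ c

        c'-id : ∀ x → φ c' (inj₁ x) ≋ inj₁ x
        c'-id = rigid c'
          (λ y inf → un (shift≈ (k ⁻¹) (c-Inf y inf) ⟫ shift-Inf≈ (k ⁻¹) inf))
          (un (shift≈ (k ⁻¹) (mk (aff-≋ c c-fix ε)) ⟫ ≡⇒≈ (cong inj₁ (inverseʳ k))))
          (Fixes∞-∘ᴬ ((right k) ⁻ᴬ) c (Fixes∞-⁻ᴬ (right k) (Fixes∞-right k)) c-fix)

        c-affine : ∀ x → φ c (inj₁ x) ≈ inj₁ (x ∙ k)
        c-affine x = ≈-sym (shift-cancel k (φ c (inj₁ x))) ⟫ shift≈ k (mk (c'-id x))

        k≡ε : k ≡ ε
        k≡ε = Core⇒ε k (λ x → ∼-resp {φ c (inj₁ x)} {inj₁ (x ∙ k)} {inj₁ x} {inj₁ x} (c-affine x) ≈-refl (c-∼ (inj₁ x)))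

        c≈ : ∀ y → φ c y ≈ y
        c≈ (inj₁ x) = c-affine x ⟫ ≡⇒≈ (cong inj₁ (trans (cong (x ∙_) k≡ε) (identityʳ x)))
        c≈ (inj₂ T) = c-Inf (inj₂ T) tt

        commutes : ∀ y → φ n (shift h y) ≈ shift h (φ n y)
        commutes y = ≈-sym (shift-cancel h (φ n (shift h y))) ⟫ shift≈ h (≈-sym (φψ≈ n {shift (h ⁻¹) (φ n (shift h y))}) ⟫ φ≈ n (c≈ y))

      -- The involution fixing the block S (lower τ) pointwise and interchanging T₀ and ε.
      module Involution (τ : Carrier) (τ≢0 : τ ≢ 0#) where

        s : SL
        s = lower τ

        ατ : Aut
        ατ = right s ∘ᴬ α

        onSs⇒ : ∀ x → Inf (ψ ατ (inj₁ x)) → S (proj₁ (x ∙ s ⁻¹))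
        onSs⇒ x = proj₁ (onS (x ∙ s ⁻¹))

        s-Inf : Inf (ψ ατ (inj₁ s))
        s-Inf = proj₂ (onS (s ∙ s ⁻¹)) (subst (S ∘ proj₁) (sym (inverseʳ s)) S-ε)

        -- If ε were in S s, then s⁻¹ would be a nontrivial element of both S and T₀.
        ε-finite : ¬ Inf (ψ ατ (inj₁ ε))
        ε-finite inf = lower≢ε τ≢0 (⁻¹-injective {s} {ε} (trans (SL-≡ {s ⁻¹} {ε}
          (S∩Sylow T₀ {proj₁ (s ⁻¹)} (subst (S ∘ proj₁) (identityˡ (s ⁻¹)) (onSs⇒ ε inf)) (∋-⁻¹ T₀ {s} (T₀∋lower τ)))) (sym ε⁻¹≈ε)))

        abstract
          moving : ∃[ x ] ∃[ x' ] (ψ ατ (inj₂ T₀) ≡ inj₁ x × ψ ατ (inj₁ ε) ≡ inj₁ x' × φ (conjᴬ ατ (x ⁻¹ ∙ x')) (inj₂ T₀) ≈ inj₁ ε)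
          moving = conj-transitive ατ {inj₂ T₀} {inj₁ ε} (off∞ T₀) ε-finite

        h : SL
        h = proj₁ moving ⁻¹ ∙ proj₁ (proj₂ moving)

        u : Aut
        u = conjᴬ ατ h

        u-T₀ : φ u (inj₂ T₀) ≈ inj₁ ε
        u-T₀ = proj₂ (proj₂ (proj₂ (proj₂ moving)))

        -- The points s, T₀ and ε lie on the block T₀. The preimage of s is a new point, so the
        -- preimage of this block is short.
        hh≡ε : h ∙ h ≡ ε
        hh≡ε = conj-involution 2≡0 ατ {blockT T₀ 𝟙} (inj₂ (inj₁ (T₀ , 𝟙 , InSL-𝟙 , ≐-refl))) {inj₁ s} {inj₂ T₀} {inj₁ ε}
          (lift (proj₁ s , T₀∋lower τ , sym (·-identityʳ (proj₁ s)))) (lift ≐-refl) (lift (𝟙 , ∋-ε T₀ , sym (·-identityʳ 𝟙))) s-Inf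
          (proj₁ (proj₂ (proj₂ moving))) (proj₁ (proj₂ (proj₂ (proj₂ moving))))

        u-ε : φ u (inj₁ ε) ≈ inj₂ T₀
        u-ε = φ≈ u (≈-sym u-T₀) ⟫ conj-conj≈ ατ h {inj₂ T₀} hh≡ε

        u-fixes-s : φ u (inj₁ s) ≈ inj₁ s
        u-fixes-s = conj-fixes ατ h {inj₁ s} s-Inf

        h≢ε : h ≢ ε
        h≢ε eq = un (≈-sym (trivial h eq) ⟫ u-T₀)
          where
          trivial : ∀ h → h ≡ ε → φ (conjᴬ ατ h) (inj₂ T₀) ≈ inj₂ T₀
          trivial _ refl = φ≈ ατ (shift-ε (ψ ατ (inj₂ T₀))) ⟫ φψ≈ ατ {inj₂ T₀}
            where
            shift-ε : ∀ z → shift ε z ≈ z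
            shift-ε (inj₁ x) = ≡⇒≈ (cong inj₁ (identityʳ x))
            shift-ε (inj₂ _) = ≈-refl

        u-fixed : ∀ x → φ u (inj₁ x) ≈ inj₁ x → S (proj₁ (x ∙ s ⁻¹))
        u-fixed x fixed = cases (Inf? (ψ ατ (inj₁ x)))
          where
          cases : Dec (Inf (ψ ατ (inj₁ x))) → S (proj₁ (x ∙ s ⁻¹))
          cases (yes inf) = onSs⇒ x inf
          cases (no fin) = ⊥-elim (h≢ε (conj-free ατ h {inj₁ x} fin fixed))

        -- Carried back by `ατ`, the map Λ still preserves every class of `_∼_`, so `Commute` makes
        -- it commute with right multiplication by h.
        u-commutes : ∀ Λ → (∀ y → φ Λ y ∼ y) → ∀ y → φ Λ (φ u y) ≈ φ u (φ Λ y)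
        u-commutes Λ Λ-∼ y = ≈-sym (φψ≈ ατ {φ Λ (φ u y)}) ⟫ φ≈ ατ (Commute.commutes n n-∼ h (ψ ατ y) ⟫ shift≈ h (ψ≈ ατ (φ≈ Λ (φψ≈ ατ {y}))))
          where
          n : Aut
          n = ατ ⁻ᴬ ∘ᴬ Λ ∘ᴬ ατ
          n-∼ : ∀ y → φ n y ∼ y
          n-∼ y = ∼-resp {φ n y} {φ n y} {ψ ατ (φ ατ y)} {y} ≈-refl (ψφ≈ ατ {y}) (φ-∼ (ατ ⁻ᴬ) {φ Λ (φ ατ y)} {φ ατ y} (Λ-∼ (φ ατ y)))

      impossible : ⊥
      impossible = go (avoid₂ 0# 1#)
        where
        go : ∃[ c ] (c ≢ 0# × c ≢ 1#) → ⊥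
        -- As `U₂.u` fixes t, the point t lies on S (lower c). Then t (lower c)⁻¹ belongs to both S
        -- and T₀, so it is ε and c = 1.
        go (c , c≢0 , c≢1) = c≢1 (sym (lower-injective (xy⁻¹≡ε⇒x≡y (SL-≡ {t ∙ lower c ⁻¹} {ε}
          (S∩Sylow T₀ (U₂.u-fixed t u₂-t) (∋-∙ T₀ {t} {lower c ⁻¹} (T₀∋lower 1#) (∋-⁻¹ T₀ {lower c} (T₀∋lower c))))))))
          where
          module U₁ = Involution 1# (0≢1 ∘ sym)
          module U₂ = Involution c c≢0
          γ : Aut
          γ = U₁.u ∘ᴬ U₂.u
          γ-ε : φ γ (inj₁ ε) ≈ inj₁ ε
          γ-ε = φ≈ U₁.u U₂.u-ε ⟫ U₁.u-T₀
          γ-T₀ : φ γ (inj₂ T₀) ≈ inj₂ T₀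
          γ-T₀ = φ≈ U₁.u U₂.u-T₀ ⟫ U₁.u-ε
          γ-Inf : ∀ y → Inf y → φ γ y ≈ y
          -- Left multiplications by S carry T₀ to every new point and commute with both
          -- involutions, so that fixing T₀ spreads to all of [∞].
          γ-Inf (inj₂ T) _ = fixed (Sylow⇒Z T)
            where
            fixed : ∃[ s ] (S (proj₁ s) × (proj₁ T ≐ proj₁ (Z s))) → φ γ (inj₂ T) ≈ inj₂ T
            fixed (s , Ss , T≐Z) = φ≈ γ T≈ΛT₀ ⟫ ≈-sym commute ⟫ φ≈ Λ γ-T₀ ⟫ ≈-sym T≈ΛT₀
              where
              open LeftMultiplication (s ⁻¹) (S-⁻¹ {s} Ss) using (Λ; Λ-∼; Λ-T₀)
              T≈ΛT₀ : inj₂ T ≈ φ Λ (inj₂ T₀)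
              T≈ΛT₀ = mk (≐-trans T≐Z (Z-≡ (sym (⁻¹-involutive s)))) ⟫ ≈-sym Λ-T₀
              commute : φ Λ (φ γ (inj₂ T₀)) ≈ φ γ (φ Λ (inj₂ T₀))
              commute = U₁.u-commutes Λ Λ-∼ (φ U₂.u (inj₂ T₀)) ⟫ φ≈ U₁.u (U₂.u-commutes Λ Λ-∼ (inj₂ T₀))
          γ-id : ∀ x → φ γ (inj₁ x) ≋ inj₁ x
          γ-id = rigid γ (λ y inf → un (γ-Inf y inf)) (un γ-ε) (Fixes∞-one γ {inj₂ T₀} tt (Inf≈ (≈-sym γ-T₀) tt))
          -- t = lower 1# is on the block that the first involution fixes pointwise. Since the
          -- product of the two involutions is trivial on SL(2,q), the second one fixes t as well.
          u₂-t : φ U₂.u (inj₁ t) ≈ inj₁ t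
          u₂-t = φ-cancel U₁.u (mk (γ-id t) ⟫ ≈-sym U₁.u-fixes-s)

    impossible : ⊥
    impossible with (1# + 1#) ≟ 0#
    ... | yes 2≡0 = Even.impossible 2≡0
    ... | no 2≢0 = Odd.impossible 2≢0

  -- Conclusion: every automorphism fixes [∞]

  fixes-∞ : ∀ α → Fixes∞ α
  fixes-∞ α = [ id , (λ (g , eq) → ⊥-elim (not-S g eq)) ]′ (image-of-∞ α)
    where
    not-S : ∀ g → ¬ ((block∞ ∘ ψ α) ≐ blockS (proj₁ {B = InSL} g))
    not-S g eq = MovedToS.impossible ((right g) ⁻ᴬ ∘ᴬ α)
      (λ x → let to , from = Coset-cancel S g x S-InSL in
        (λ inf → to (Level.lower (proj₁ (eq (inj₁ (x ∙ g))) (Inf⇒block∞ inf)))) ,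
        (λ Sx → block∞⇒Inf (proj₂ (eq (inj₁ (x ∙ g))) (lift (from Sx)))))
      (λ T inf → Level.lower (proj₁ (eq (inj₂ T)) (Inf⇒block∞ inf)))

  image-block∞ : ∀ (α : Automorphism) → image (Automorphism.φ α) block∞ ≐ block∞
  image-block∞ α y =
    (λ (x , x∈∞ , φx≋y) → Inf⇒block∞ (Inf-resp {Automorphism.φ α x} {y} φx≋y (proj₂ (Fixes∞-φ β fix x) (block∞⇒Inf x∈∞)))) ,
    (λ y∈∞ → Automorphism.ψ α y , Inf⇒block∞ (proj₂ (fix y) (block∞⇒Inf y∈∞)) , Automorphism.φψ α y)
    where
    β : Aut
    β = fromAutomorphism α
    fix : Fixes∞ β
    fix = fixes-∞ β

mainTheorem9 : (p e q : ℕ) → Prime p → q ≡ p ^ e → 3 ≤ q →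
    (F : FiniteField q) (S : SL2.Mat F → Set) →
    SL2.IsSubgroup F S → HasSize S (suc q) →
    (m : ℕ) (D : Fin m → SL2.Mat F → Set) →
    SL2.Unital.IsDFamily F p S m D →
    SL2.Unital.IsPartition F p S m D →
    (α : SL2.Unital.Automorphism F p S m D) →
    SL2.Unital.image F p S m D (SL2.Unital.Automorphism.φ α) (SL2.Unital.block∞ F p S m D)
    ≐ SL2.Unital.block∞ F p S m D
mainTheorem9 p e q p-prime q≡p^e 3≤q F S S-sub S-size m D D-family partition =
  Geometry.image-block∞ F {p} {e} p-prime q≡p^e 3≤q S S-sub S-size m D D-family partition
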